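{- Let $q$ be a prime power and $n\ge 2$. Then $$\delta^{\mathrm{rk}}_q(n\times n, 2, n) = \frac{s_q(n)\prod_{i=0}^{n-1}(q^n-q^i)}{(q^{n^2}-1)(q^{n^2}-q)}.$$ In particular, $$\lim_{q \to +\infty} \delta^{\mathrm{rk}}_q(n \times n, 2, n) = \sum_{i=0}^n \frac{(-1)^i}{i!}, \qquad \lim_{n \to +\infty} \delta^{\mathrm{rk}}_q(n \times n, 2, n) = \prod_{i=1}^{\infty} \left(1-\frac{1}{q^i}\right)^{q+1}.$$
   Context: $s_q(n)$ is the number of matrices $M\in\mathbb{F}_q^{n\times n}$ having no eigenvalue in $\mathbb{F}_q$. $\delta^{\mathrm{rk}}_q(n\times m,k,d)$ is the number of $k$-dimensional $\mathbb{F}_q$-linear subspaces of $\mathbb{F}_q^{n\times m}$ in which every nonzero matrix has rank at least $d$, divided by the number $\prod_{\ell=0}^{k-1}\frac{q^{mn}-q^\ell}{q^k-q^\ell}$ of all $k$-dimensional subspaces of $\mathbb{F}_q^{n\times m}$. The limit in $q$ is over prime powers with $n$ fixed; the limit in $n$ has $q$ fixed. -}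

module Defs where

open import Level using (0ℓ)
open import Data.Bool using (Bool; true; false; _∧_; _∨_; not; T)
import Data.Bool as Bool
open import Data.Nat as ℕ using (ℕ; zero; suc; _^_)
open import Data.Nat using (_!)
open import Data.Integer using (+_; -[1+_])
open import Data.Fin using (Fin; zero; suc)
open import Data.List using (List; []; _∷_; map; concatMap; length; allFin; filterᵇ; deduplicate)
open import Data.Bool.ListAction using (all; any)
open import Data.List.Properties using (≡-dec)
open import Data.List.Relation.Unary.Unique.Propositional using (Unique)
open import Data.List.Membership.Propositional using (_∈_)
open import Data.Product using (∃; _,_)
open import Data.Rational as ℚ using (ℚ; 0ℚ; 1ℚ; _*_; _+_; _-_; _/_; _÷_; ≢-nonZero)
open import Relation.Binary.PropositionalEquality using (_≡_; _≢_)
open import Relation.Binary.Definitions using (DecidableEquality)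
open import Relation.Nullary using (¬_; yes; no; does)
open import Algebra.Structures using (IsCommutativeRing)

-- Finite fields.  A finite field is a commutative ring (with
-- propositional equality) in which 0 ≠ 1 and every nonzero element is
-- invertible, together with a duplicate-free complete enumeration of
-- its elements.  Its order q is the length of that enumeration.
-- (Every finite field has prime-power order, and for every prime power
-- there is such a field, so "q a prime power, F = F_q" is rendered as
-- "F an arbitrary finite field, q = its order".)

record FiniteField : Set₁ where
  field
    F      : Set
    _≟_    : DecidableEquality F
    0# 1#  : F
    _+F_   : F → F → F
    _*F_   : F → F → F
    -F_    : F → F
    isCommutativeRing : IsCommutativeRing _≡_ _+F_ _*F_ -F_ 0# 1#
    0≢1    : 0# ≢ 1#
    inverse : ∀ x → x ≢ 0# → ∃ λ y → x *F y ≡ 1#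
    elems    : List F
    unique   : Unique elems
    complete : ∀ x → x ∈ elems

  card : ℕ
  card = length elems

open FiniteField public using (card)

allFuns : ∀ {A : Set} (k : ℕ) → List A → List (Fin k → A)
allFuns zero    xs = (λ ()) ∷ []
allFuns (suc k) xs =
  concatMap (λ x → map (λ f → λ { zero → x ; (suc i) → f i }) (allFuns k xs)) xs

module LinAlg (𝔽 : FiniteField) where
  open FiniteField 𝔽

  eqᵇ : F → F → Bool
  eqᵇ x y = does (x ≟ y)

  Σ : (k : ℕ) → (Fin k → F) → F
  Σ zero    f = 0#
  Σ (suc k) f = f zero +F Σ k (λ i → f (suc i))

  Vect : ℕ → Set
  Vect r = Fin r → F

  isZeroVec : ∀ {r} → Vect r → Bool
  isZeroVec {r} v = all (λ i → eqᵇ (v i) 0#) (allFin r)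

  eqVec : ∀ {r} → Vect r → Vect r → Bool
  eqVec {r} v w = all (λ i → eqᵇ (v i) (w i)) (allFin r)

  combVec : ∀ {r d} → Vect d → (Fin d → Vect r) → Vect r
  combVec {r} {d} c v i = Σ d (λ l → c l *F v l i)

  indepVecs : ∀ {r d} → (Fin d → Vect r) → Bool
  indepVecs {r} {d} v =
    all (λ c → not (isZeroVec (combVec c v)) ∨ isZeroVec c) (allFuns d elems)

  Mat : ℕ → ℕ → Set
  Mat n m = Fin n → Fin m → F

  allMats : (n m : ℕ) → List (Mat n m)
  allMats n m = allFuns n (allFuns m elems)

  eqMat : ∀ {n m} → Mat n m → Mat n m → Bool
  eqMat {n} {m} X Y = all (λ i → all (λ j → eqᵇ (X i j) (Y i j)) (allFin m)) (allFin n)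

  isZeroMat : ∀ {n m} → Mat n m → Bool
  isZeroMat {n} {m} X = eqMat X (λ _ _ → 0#)

  col : ∀ {n m} → Mat n m → Fin m → Vect n
  col X j i = X i j

  rank≥ : ∀ {n m} → ℕ → Mat n m → Bool
  rank≥ {n} {m} d X = any (λ s → indepVecs (λ l → col X (s l))) (allFuns d (allFin m))

  combMat : ∀ {n m k} → Vect k → (Fin k → Mat n m) → Mat n m
  combMat {k = k} c B i j = Σ k (λ l → c l *F B l i j)

  indepMats : ∀ {n m k} → (Fin k → Mat n m) → Bool
  indepMats {k = k} B =
    all (λ c → not (isZeroMat (combMat c B)) ∨ isZeroVec c) (allFuns k elems)

  inSpan : ∀ {n m k} → (Fin k → Mat n m) → Mat n m → Bool
  inSpan {k = k} B X = any (λ c → eqMat (combMat c B) X) (allFuns k elems)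

  -- the subspace span(B), encoded as its characteristic vector over the
  -- fixed enumeration of F^{n×m}; distinct subspaces give distinct codes
  spanCode : ∀ {n m k} → (Fin k → Mat n m) → List Bool
  spanCode {n} {m} B = map (inSpan B) (allMats n m)

  goodSpan : ∀ {n m k} → ℕ → (Fin k → Mat n m) → Bool
  goodSpan {n} {m} d B =
    all (λ X → not (inSpan B X) ∨ isZeroMat X ∨ rank≥ d X) (allMats n m)

  numRankSubspaces : (n m k d : ℕ) → ℕ
  numRankSubspaces n m k d =
    length (deduplicate (≡-dec Bool._≟_)
      (map spanCode (filterᵇ (λ B → indepMats B ∧ goodSpan d B)
                             (allFuns k (allMats n m)))))

  isEigenvalue : ∀ {n} → Mat n n → F → Bool
  isEigenvalue {n} X λ₀ =
    any (λ v → not (isZeroVec v) ∧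
               eqVec (λ i → Σ n (λ j → X i j *F v j)) (λ i → λ₀ *F v i))
        (allFuns n elems)

  s : ℕ → ℕ
  s n = length (filterᵇ (λ X → not (any (isEigenvalue X) elems)) (allMats n n))

ℕ→ℚ : ℕ → ℚ
ℕ→ℚ n = (+ n) / 1

-- total division on ℚ (returns 0 when the divisor is 0; all divisors
-- used below are nonzero for q ≥ 2)
infixl 7 _÷'_
_÷'_ : ℚ → ℚ → ℚ
p ÷' r with r ℚ.≟ 0ℚ
... | yes _  = 0ℚ
... | no r≢0 = _÷_ p r {{≢-nonZero r≢0}}

∏ : ℕ → (ℕ → ℚ) → ℚ
∏ zero    f = 1ℚ
∏ (suc k) f = ∏ k f * f k

∑ : ℕ → (ℕ → ℚ) → ℚ
∑ zero    f = 0ℚ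
∑ (suc k) f = ∑ k f + f k

infixr 8 _^ℚ_
_^ℚ_ : ℚ → ℕ → ℚ
x ^ℚ zero  = 1ℚ
x ^ℚ suc e = x * (x ^ℚ e)

δrk : (𝔽 : FiniteField) (n m k d : ℕ) → ℚ
δrk 𝔽 n m k d =
  ℕ→ℚ (LinAlg.numRankSubspaces 𝔽 n m k d)
  ÷' ∏ k (λ ℓ → (ℕ→ℚ (q ^ (m ℕ.* n)) - ℕ→ℚ (q ^ ℓ)) ÷' (ℕ→ℚ (q ^ k) - ℕ→ℚ (q ^ ℓ)))
  where q = card 𝔽

sq : FiniteField → ℕ → ℕ
sq 𝔽 n = LinAlg.s 𝔽 n

formula : FiniteField → ℕ → ℚ
formula 𝔽 n =
  (ℕ→ℚ (sq 𝔽 n) * ∏ n (λ i → ℕ→ℚ (q ^ n) - ℕ→ℚ (q ^ i)))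
  ÷' ((ℕ→ℚ (q ^ (n ℕ.* n)) - 1ℚ) * (ℕ→ℚ (q ^ (n ℕ.* n)) - ℕ→ℚ q))
  where q = card 𝔽

derangementSum : ℕ → ℚ
derangementSum n = ∑ (suc n) (λ i → (ℚ.- 1ℚ) ^ℚ i ÷' ℕ→ℚ (i !))

partialProd : ℕ → ℕ → ℚ
partialProd q M = ∏ M (λ i → (1ℚ - (1ℚ ÷' ℕ→ℚ (q ^ suc i))) ^ℚ suc q)

{-# OPTIONS --safe #-}
module Submission where

-- A basis (A , B) of a two-dimensional space all of whose nonzero elements are invertible
-- consists of an invertible A and a B such that B v = σ A v has no solution with v ≠ 0; for
-- each A there are s_q(n) such B, and each space has |GL_2| bases.
--
-- To evaluate s_q(n), let K = q^k be the size of the σ-eigenspace of M.  With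
-- a_d = 1 / ∏_{i=1}^d (1 - q^i) the sum ∑_{d≤n} a_d ∏_{i<d} (K - q^i) telescopes to
-- ∏_{i=1}^n (K - q^i) / (1 - q^i), the indicator of k = 0.  Here ∏_{i<d} (K - q^i) counts
-- independent d-tuples of σ-eigenvectors, and tuples for distinct σ are jointly
-- independent; a fixed independent D-tuple with prescribed eigenvalues belongs to q^{n(n-D)}
-- matrices M.  Summing over M and over all σ ∈ F_q gives
-- s_q(n) = q^{n²} φ_n ∑_{D≤n} [u^D] (∑_d a_d u^d)^{q-1}, where φ_n = ∏_{i=1}^n (1 - q^{-i}).
--
-- For n → ∞ the series converge geometrically, and ∑_d a_d = ∏_{i≥1} (1 - q^{-i}).  For
-- q → ∞ the series ∑_d a_d u^d is 1 - u / (q - 1) up to O(q^{-2}), so that its (q - 1)-st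
-- power tends coefficientwise to exp (- u).

-- All linear algebra is done by counting instead of by dimension. A condition becomes a rational
-- sum of indicators over a finite list, two summations are interchanged, and even existence or
-- uniqueness is read off from a sum equal to 1. That K is a power of q is one instance: ∏_{i≤n} (K
-- - q^i) counts independent (n + 1)-tuples, of which there are none. The exponent is q - 1,
-- although q eigenvalues are excluded, because excluding a single one amounts to counting GL_n.
-- That one sum already yields φ_n, whatever the length of the tuple prescribed so far, and only the
-- other q - 1 sums remain as power series. The two limits need different estimates of the same
-- partial sums. For fixed q the constant may grow exponentially in the number q - 1 of factors. For
-- fixed n it must not depend on q; this works because each of the q - 1 factors deviates from 1 - u
-- / (q - 1) by O(q^(-2)) only. Closeness to the infinite product is expressed in the rationals, by
-- comparison with all late partial products.

open import Defs
open import Algebra.Bundles using (CommutativeRing)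
import Algebra.Properties.Ring as RingProperties
open import Data.Bool using (Bool; true; false; _∧_; _∨_; not)
import Data.Bool as Bool
open import Data.Bool.ListAction using (all; any)
open import Data.Empty using (⊥; ⊥-elim)
open import Data.Fin using (Fin; zero; suc)
import Data.Fin as Fin
import Data.Integer as ℤ
import Data.Integer.Properties as ℤP
open import Data.List using (List; []; _∷_; _++_; map; concatMap; length; allFin; filterᵇ; deduplicate)
open import Data.List.Membership.Propositional using (_∈_)
open import Data.List.Membership.Propositional.Properties using (∈-deduplicate⁺; ∈-deduplicate⁻; ∈-allFin)
open import Data.List.Properties using (map-tabulate; ≡-dec; map-cong; ∷-injectiveˡ; ∷-injectiveʳ)
import Data.List.Relation.Unary.All as All
open import Data.List.Relation.Unary.AllPairs using ([]; _∷_)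
open import Data.List.Relation.Unary.Any using (here; there)
open import Data.List.Relation.Unary.Unique.DecPropositional.Properties using (deduplicate-!)
open import Data.List.Relation.Unary.Unique.Propositional using (Unique)
open import Data.List.Relation.Unary.Unique.Propositional.Properties using (allFin⁺)
open import Data.Maybe using (Maybe; just; nothing)
open import Data.Nat as ℕ using (ℕ; zero; suc; s≤s; z≤n; _≤_; _!)
import Data.Nat.Properties as ℕP
open import Data.Product using (_×_; ∃; _,_; proj₁; proj₂)
open import Data.Rational as ℚ using (ℚ; 0ℚ; 1ℚ; ½; _*_; _+_; _-_; -_; _<_; ∣_∣; Positive; toℚᵘ; 1/_; ↥_; ↧_)
open import Data.Rational.Properties
import Data.Rational.Unnormalised as ℚᵘ
import Data.Rational.Unnormalised.Properties as ℚᵘP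
open import Data.Sum using (_⊎_; inj₁; inj₂)
open import Data.Vec.Functional using () renaming (_∷_ to _◂_)
open import Function using (_∘_; id)
open import Level using (0ℓ)
open import Relation.Binary.Definitions using (DecidableEquality)
open import Relation.Binary.PropositionalEquality using (_≡_; _≢_; refl; sym; trans; cong; cong₂; subst; subst₂; module ≡-Reasoning)
open import Relation.Nullary using (¬_; Dec; yes; no; does)
open import Relation.Nullary.Decidable using (dec-true)
open import Tactic.RingSolver using (solve-∀)
open import Tactic.RingSolver.Core.AlmostCommutativeRing using (AlmostCommutativeRing; fromCommutativeRing)
import Tactic.RingSolver.NonReflective as NonReflective

-- Rational arithmetic

ringℚ : AlmostCommutativeRing 0ℓ 0ℓ
ringℚ = fromCommutativeRing +-*-commutativeRing isZero?
  where
  isZero? : (x : ℚ) → Maybe (0ℚ ≡ x)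
  isZero? x with 0ℚ ≟ x
  ... | yes p = just p
  ... | no _  = nothing

*-exchange : ∀ x y z → x * (y * z) ≡ y * (x * z)
*-exchange = solve-∀ ringℚ

*-interchange : ∀ w x y z → (w * x) * (y * z) ≡ (w * y) * (x * z)
*-interchange = solve-∀ ringℚ

+-interchange : ∀ w x y z → (w + x) + (y + z) ≡ (w + y) + (x + z)
+-interchange = solve-∀ ringℚ

module _ where
  private
    ι : ℕ → ℚᵘ.ℚᵘ
    ι n = ℚᵘ.mkℚᵘ (ℤ.+ n) 0

    to-ℕ→ℚ : ∀ n → toℚᵘ (ℕ→ℚ n) ℚᵘ.≃ ι n
    to-ℕ→ℚ n = toℚᵘ-fromℚᵘ (ι n)

  ℕ→ℚ-+ : ∀ m n → ℕ→ℚ (m ℕ.+ n) ≡ ℕ→ℚ m + ℕ→ℚ n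
  ℕ→ℚ-+ m n = toℚᵘ-injective (ℚᵘP.≃-trans (to-ℕ→ℚ (m ℕ.+ n))
    (ℚᵘP.≃-sym (ℚᵘP.≃-trans (toℚᵘ-homo-+ (ℕ→ℚ m) (ℕ→ℚ n))
      (ℚᵘP.≃-trans (ℚᵘP.+-cong (to-ℕ→ℚ m) (to-ℕ→ℚ n)) (ℚᵘ.*≡* eq)))))
    where
    eq : (ℤ.+ m ℤ.* ℤ.+ 1 ℤ.+ ℤ.+ n ℤ.* ℤ.+ 1) ℤ.* ℤ.+ 1 ≡ ℤ.+ (m ℕ.+ n) ℤ.* (ℤ.+ 1 ℤ.* ℤ.+ 1)
    eq rewrite ℤP.*-identityʳ (ℤ.+ m) | ℤP.*-identityʳ (ℤ.+ n) = refl

  ℕ→ℚ-* : ∀ m n → ℕ→ℚ (m ℕ.* n) ≡ ℕ→ℚ m * ℕ→ℚ n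
  ℕ→ℚ-* m n = toℚᵘ-injective (ℚᵘP.≃-trans (to-ℕ→ℚ (m ℕ.* n))
    (ℚᵘP.≃-sym (ℚᵘP.≃-trans (toℚᵘ-homo-* (ℕ→ℚ m) (ℕ→ℚ n))
      (ℚᵘP.≃-trans (ℚᵘP.*-cong (to-ℕ→ℚ m) (to-ℕ→ℚ n)) (ℚᵘ.*≡* eq)))))
    where
    eq : (ℤ.+ m ℤ.* ℤ.+ n) ℤ.* ℤ.+ 1 ≡ ℤ.+ (m ℕ.* n) ℤ.* (ℤ.+ 1 ℤ.* ℤ.+ 1)
    eq = cong (ℤ._* ℤ.+ 1) (sym (ℤP.pos-* m n))

  ℕ→ℚ-mono : ∀ {m n} → m ≤ n → ℕ→ℚ m ℚ.≤ ℕ→ℚ n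
  ℕ→ℚ-mono {m} {n} p = toℚᵘ-cancel-≤
    (ℚᵘP.≤-trans (ℚᵘP.≤-reflexive (to-ℕ→ℚ m))
      (ℚᵘP.≤-trans (ℚᵘ.*≤* (ℤP.*-monoʳ-≤-nonNeg (ℤ.+ 1) (ℤ.+≤+ p)))
        (ℚᵘP.≤-reflexive (ℚᵘP.≃-sym (to-ℕ→ℚ n)))))

ℕ→ℚ-suc : ∀ n → ℕ→ℚ (suc n) ≡ 1ℚ + ℕ→ℚ n
ℕ→ℚ-suc n = ℕ→ℚ-+ 1 n

0≤1 : 0ℚ ℚ.≤ 1ℚ
0≤1 = ℕ→ℚ-mono {0} {1} z≤n

0≤ℕ→ℚ : ∀ n → 0ℚ ℚ.≤ ℕ→ℚ n
0≤ℕ→ℚ n = ℕ→ℚ-mono {0} {n} z≤n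

ℕ→ℚ-^ : ∀ m n → ℕ→ℚ (m ℕ.^ n) ≡ ℕ→ℚ m ^ℚ n
ℕ→ℚ-^ m zero = refl
ℕ→ℚ-^ m (suc n) = trans (ℕ→ℚ-* m (m ℕ.^ n)) (cong (ℕ→ℚ m *_) (ℕ→ℚ-^ m n))

^ℚ-+ : ∀ x m n → x ^ℚ (m ℕ.+ n) ≡ x ^ℚ m * x ^ℚ n
^ℚ-+ x zero n = sym (*-identityˡ _)
^ℚ-+ x (suc m) n = trans (cong (x *_) (^ℚ-+ x m n)) (sym (*-assoc x _ _))

^ℚ-distrib-* : ∀ x y n → (x * y) ^ℚ n ≡ x ^ℚ n * y ^ℚ n
^ℚ-distrib-* x y zero = refl
^ℚ-distrib-* x y (suc n) = trans (cong ((x * y) *_) (^ℚ-distrib-* x y n)) (*-interchange x y (x ^ℚ n) (y ^ℚ n))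

1^ℚ : ∀ n → 1ℚ ^ℚ n ≡ 1ℚ
1^ℚ zero = refl
1^ℚ (suc n) = trans (*-identityˡ _) (1^ℚ n)

^ℚ-* : ∀ x m n → x ^ℚ (m ℕ.* n) ≡ (x ^ℚ n) ^ℚ m
^ℚ-* x zero n = refl
^ℚ-* x (suc m) n = trans (^ℚ-+ x n (m ℕ.* n)) (cong (x ^ℚ n *_) (^ℚ-* x m n))

*-mono-≤ˡ : ∀ {r p q} → 0ℚ ℚ.≤ r → p ℚ.≤ q → r * p ℚ.≤ r * q
*-mono-≤ˡ {r} 0≤r = *-monoˡ-≤-nonNeg r {{ℚ.nonNegative 0≤r}}

*-mono-≤ʳ : ∀ {r p q} → 0ℚ ℚ.≤ r → p ℚ.≤ q → p * r ℚ.≤ q * r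
*-mono-≤ʳ {r} 0≤r = *-monoʳ-≤-nonNeg r {{ℚ.nonNegative 0≤r}}

*-mono-≤-nonNeg : ∀ {a b c d} → 0ℚ ℚ.≤ a → 0ℚ ℚ.≤ d → a ℚ.≤ b → c ℚ.≤ d → a * c ℚ.≤ b * d
*-mono-≤-nonNeg 0≤a 0≤d a≤b c≤d = ≤-trans (*-mono-≤ˡ 0≤a c≤d) (*-mono-≤ʳ 0≤d a≤b)

0≤* : ∀ {p q} → 0ℚ ℚ.≤ p → 0ℚ ℚ.≤ q → 0ℚ ℚ.≤ p * q
0≤* {p} {q} 0≤p 0≤q = subst (ℚ._≤ p * q) (*-zeroʳ p) (*-mono-≤ˡ 0≤p 0≤q)

0≤+ : ∀ {p q} → 0ℚ ℚ.≤ p → 0ℚ ℚ.≤ q → 0ℚ ℚ.≤ p + q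
0≤+ = +-mono-≤

0≤^ℚ : ∀ {x} n → 0ℚ ℚ.≤ x → 0ℚ ℚ.≤ x ^ℚ n
0≤^ℚ zero _ = 0≤1
0≤^ℚ (suc n) 0≤x = 0≤* 0≤x (0≤^ℚ n 0≤x)

≤-via : ∀ {x y} r → 0ℚ ℚ.≤ r → x + r ≡ y → x ℚ.≤ y
≤-via {x} {y} r 0≤r eq = subst₂ ℚ._≤_ (+-identityʳ x) eq (+-monoʳ-≤ x 0≤r)

x≤y⇒0≤y-x : ∀ {x y} → x ℚ.≤ y → 0ℚ ℚ.≤ y - x
x≤y⇒0≤y-x {x} {y} p = subst (ℚ._≤ y - x) (+-inverseʳ x) (+-monoˡ-≤ (- x) p)

x-y≡0⇒x≡y : ∀ x y → x - y ≡ 0ℚ → x ≡ y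
x-y≡0⇒x≡y x y e = trans (eq x y) (trans (cong (_+ y) e) (+-identityˡ y))
  where
  eq : ∀ x y → x ≡ (x - y) + y
  eq = solve-∀ ringℚ

abstract
  -- Opaque, so that the zero test inside `÷'` never unfolds in later goals. The default value
  -- `inv 0ℚ` = 0 lets `÷'≡*inv` hold without a side condition.
  inv : ℚ → ℚ
  inv r = 1ℚ ÷' r

  ÷'≡*inv : ∀ p r → p ÷' r ≡ p * inv r
  ÷'≡*inv p r with r ≟ 0ℚ
  ... | yes _ = sym (*-zeroʳ p)
  ... | no r≢0 = cong (p *_) (sym (*-identityˡ (1/_ r {{ℚ.≢-nonZero r≢0}})))

  *-invʳ : ∀ {r} → r ≢ 0ℚ → r * inv r ≡ 1ℚ
  *-invʳ {r} r≢0 with r ≟ 0ℚ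
  ... | yes r≡0 = ⊥-elim (r≢0 r≡0)
  ... | no r≢0 = trans (cong (r *_) (*-identityˡ (1/_ r {{ℚ.≢-nonZero r≢0}}))) (*-inverseʳ r {{ℚ.≢-nonZero r≢0}})

*-invˡ : ∀ {r} → r ≢ 0ℚ → inv r * r ≡ 1ℚ
*-invˡ {r} r≢0 = trans (*-comm (inv r) r) (*-invʳ r≢0)

*-cancelˡ : ∀ {r p q} → r ≢ 0ℚ → r * p ≡ r * q → p ≡ q
*-cancelˡ {r} {p} {q} r≢0 e = begin
  p                 ≡⟨ sym (*-identityˡ p) ⟩
  1ℚ * p            ≡⟨ cong (_* p) (sym (*-invˡ r≢0)) ⟩
  (inv r * r) * p   ≡⟨ *-assoc (inv r) r p ⟩
  inv r * (r * p)   ≡⟨ cong (inv r *_) e ⟩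
  inv r * (r * q)   ≡⟨ sym (*-assoc (inv r) r q) ⟩
  (inv r * r) * q   ≡⟨ cong (_* q) (*-invˡ r≢0) ⟩
  1ℚ * q            ≡⟨ *-identityˡ q ⟩
  q                 ∎ where open ≡-Reasoning

*-cancelʳ : ∀ {r p q} → r ≢ 0ℚ → p * r ≡ q * r → p ≡ q
*-cancelʳ {r} {p} {q} r≢0 e = *-cancelˡ r≢0 (trans (*-comm r p) (trans e (*-comm q r)))

inv-unique : ∀ {r p} → r * p ≡ 1ℚ → r ≢ 0ℚ → inv r ≡ p
inv-unique {r} {p} e r≢0 = *-cancelˡ r≢0 (trans (*-invʳ r≢0) (sym e))

*-≢0 : ∀ {p q} → p ≢ 0ℚ → q ≢ 0ℚ → p * q ≢ 0ℚ
*-≢0 {p} {q} p≢0 q≢0 e = q≢0 (*-cancelˡ p≢0 (trans e (sym (*-zeroʳ p))))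

x*y≡0 : ∀ {p q} → p * q ≡ 0ℚ → p ≡ 0ℚ ⊎ q ≡ 0ℚ
x*y≡0 {p} {q} e with p ≟ 0ℚ
... | yes p≡0 = inj₁ p≡0
... | no p≢0 = inj₂ (*-cancelˡ p≢0 (trans e (sym (*-zeroʳ p))))

inv-* : ∀ {p q} → p ≢ 0ℚ → q ≢ 0ℚ → inv (p * q) ≡ inv p * inv q
inv-* {p} {q} p≢0 q≢0 = inv-unique
  (trans (*-interchange p q (inv p) (inv q)) (cong₂ _*_ (*-invʳ p≢0) (*-invʳ q≢0)))
  (*-≢0 p≢0 q≢0)

^ℚ≢0 : ∀ {x} n → x ≢ 0ℚ → x ^ℚ n ≢ 0ℚ
^ℚ≢0 zero    _   = 1≢0
^ℚ≢0 (suc n) x≢0 = *-≢0 x≢0 (^ℚ≢0 n x≢0)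

inv-1 : inv 1ℚ ≡ 1ℚ
inv-1 = inv-unique refl 1≢0

inv-^ : ∀ m {x} → x ≢ 0ℚ → inv (x ^ℚ m) ≡ inv x ^ℚ m
inv-^ zero    x≢0 = inv-1
inv-^ (suc m) {x} x≢0 = trans (inv-* x≢0 (^ℚ≢0 m x≢0)) (cong (inv x *_) (inv-^ m x≢0))

>0⇒≢0 : ∀ {x} → 0ℚ < x → x ≢ 0ℚ
>0⇒≢0 0<x x≡0 = <⇒≢ 0<x (sym x≡0)

0<1 : 0ℚ < 1ℚ
0<1 = positive⁻¹ 1ℚ

1≤⇒0< : ∀ {x} → 1ℚ ℚ.≤ x → 0ℚ < x
1≤⇒0< = <-≤-trans 0<1

0≤inv : ∀ {r} → 0ℚ < r → 0ℚ ℚ.≤ inv r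
0≤inv {r} 0<r with ≤-total 0ℚ (inv r)
... | inj₁ p = p
... | inj₂ p = ⊥-elim (<⇒≢ 0<1 (≤-antisym 0≤1
    (subst₂ ℚ._≤_ (*-invʳ (>0⇒≢0 0<r)) (*-zeroʳ r) (*-mono-≤ˡ (<⇒≤ 0<r) p))))

inv-≤ : ∀ {r p} → 0ℚ < r → 1ℚ ℚ.≤ r * p → inv r ℚ.≤ p
inv-≤ {r} {p} 0<r h = subst₂ ℚ._≤_ (*-identityʳ (inv r))
  (trans (sym (*-assoc (inv r) r p)) (trans (cong (_* p) (*-invˡ (>0⇒≢0 0<r))) (*-identityˡ p)))
  (*-mono-≤ˡ (0≤inv 0<r) h)

nonNeg-∣∣≤ : ∀ {x b} → 0ℚ ℚ.≤ x → x ℚ.≤ b → ∣ x ∣ ℚ.≤ b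
nonNeg-∣∣≤ {x} {b} p q = subst (ℚ._≤ b) (sym (0≤p⇒∣p∣≡p p)) q

∑-cong : ∀ k {f g} → (∀ i → i ℕ.< k → f i ≡ g i) → ∑ k f ≡ ∑ k g
∑-cong zero e = refl
∑-cong (suc k) e = cong₂ _+_ (∑-cong k (λ i p → e i (ℕP.m<n⇒m<1+n p))) (e k ℕP.≤-refl)

∏-cong : ∀ k {f g} → (∀ i → i ℕ.< k → f i ≡ g i) → ∏ k f ≡ ∏ k g
∏-cong zero e = refl
∏-cong (suc k) e = cong₂ _*_ (∏-cong k (λ i p → e i (ℕP.m<n⇒m<1+n p))) (e k ℕP.≤-refl)

∏-*-distrib : ∀ k f g → ∏ k (λ i → f i * g i) ≡ ∏ k f * ∏ k g
∏-*-distrib zero f g = refl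
∏-*-distrib (suc k) f g = trans (cong (_* (f k * g k)) (∏-*-distrib k f g)) (*-interchange (∏ k f) (∏ k g) (f k) (g k))

∏-^ℚ : ∀ k f e → ∏ k (λ i → f i ^ℚ e) ≡ ∏ k f ^ℚ e
∏-^ℚ zero f e = sym (1^ℚ e)
∏-^ℚ (suc k) f e = trans (cong (_* f k ^ℚ e) (∏-^ℚ k f e)) (sym (^ℚ-distrib-* (∏ k f) (f k) e))

∏-const : ∀ k x → ∏ k (λ _ → x) ≡ x ^ℚ k
∏-const zero x = refl
∏-const (suc k) x = trans (cong (_* x) (∏-const k x)) (*-comm _ x)

∏-shift : ∀ k f → ∏ (suc k) f ≡ f 0 * ∏ k (λ i → f (suc i))
∏-shift zero f = *-comm 1ℚ (f 0)
∏-shift (suc k) f = trans (cong (_* f (suc k)) (∏-shift k f)) (*-assoc (f 0) _ _)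

∏-zero : ∀ k {f} i → i ℕ.< k → f i ≡ 0ℚ → ∏ k f ≡ 0ℚ
∏-zero (suc k) {f} i i<k e with ℕP.m≤n⇒m<n∨m≡n (ℕP.≤-pred i<k)
... | inj₁ i<k′ = trans (cong (_* f k) (∏-zero k i i<k′ e)) (*-zeroˡ (f k))
... | inj₂ refl = trans (cong (∏ k f *_) e) (*-zeroʳ (∏ k f))

∏-zero⁻¹ : ∀ k {f} → ∏ k f ≡ 0ℚ → ∃ λ i → i ℕ.< k × f i ≡ 0ℚ
∏-zero⁻¹ zero e = ⊥-elim (1≢0 e)
∏-zero⁻¹ (suc k) {f} e with x*y≡0 {∏ k f} {f k} e
... | inj₂ p = k , ℕP.≤-refl , p
... | inj₁ p with ∏-zero⁻¹ k p
...   | i , i<k , q = i , ℕP.m<n⇒m<1+n i<k , q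

∑-*ˡ : ∀ k c f → c * ∑ k f ≡ ∑ k (λ i → c * f i)
∑-*ˡ zero c f = *-zeroʳ c
∑-*ˡ (suc k) c f = trans (*-distribˡ-+ c _ _) (cong (_+ c * f k) (∑-*ˡ k c f))

∑-*ʳ : ∀ k c f → ∑ k f * c ≡ ∑ k (λ i → f i * c)
∑-*ʳ k c f = trans (*-comm _ c) (trans (∑-*ˡ k c f) (∑-cong k (λ i _ → *-comm c (f i))))

∑-+-distrib : ∀ k f g → ∑ k (λ i → f i + g i) ≡ ∑ k f + ∑ k g
∑-+-distrib zero f g = refl
∑-+-distrib (suc k) f g = trans (cong (_+ (f k + g k)) (∑-+-distrib k f g)) (+-interchange (∑ k f) (∑ k g) (f k) (g k))

∑-zero : ∀ k {f} → (∀ i → i ℕ.< k → f i ≡ 0ℚ) → ∑ k f ≡ 0ℚ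
∑-zero zero e = refl
∑-zero (suc k) e = cong₂ _+_ (∑-zero k (λ i p → e i (ℕP.m<n⇒m<1+n p))) (e k ℕP.≤-refl)

∑-zero-tail : ∀ k l {f} → (∀ i → k ≤ i → f i ≡ 0ℚ) → ∑ (l ℕ.+ k) f ≡ ∑ k f
∑-zero-tail k zero e = refl
∑-zero-tail k (suc l) {f} e = trans (cong₂ _+_ (∑-zero-tail k l e) (e (l ℕ.+ k) (ℕP.m≤n+m k l))) (+-identityʳ _)

∑-mono : ∀ k {f g} → (∀ i → i ℕ.< k → f i ℚ.≤ g i) → ∑ k f ℚ.≤ ∑ k g
∑-mono zero e = ≤-refl
∑-mono (suc k) e = +-mono-≤ (∑-mono k (λ i p → e i (ℕP.m<n⇒m<1+n p))) (e k ℕP.≤-refl)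

∣∑∣≤ : ∀ k {f g} → (∀ i → i ℕ.< k → ∣ f i ∣ ℚ.≤ g i) → ∣ ∑ k f ∣ ℚ.≤ ∑ k g
∣∑∣≤ zero e = ≤-refl
∣∑∣≤ (suc k) {f} e = ≤-trans (∣p+q∣≤∣p∣+∣q∣ (∑ k f) (f k))
  (+-mono-≤ (∣∑∣≤ k (λ i p → e i (ℕP.m<n⇒m<1+n p))) (e k ℕP.≤-refl))

∑-shift : ∀ k f → ∑ (suc k) f ≡ f 0 + ∑ k (λ i → f (suc i))
∑-shift zero f = +-comm 0ℚ (f 0)
∑-shift (suc k) f = trans (cong (_+ f (suc k)) (∑-shift k f)) (+-assoc (f 0) _ _)

-- Sums over lists and finite sets

𝟙 : Bool → ℚ
𝟙 true  = 1ℚ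
𝟙 false = 0ℚ

𝟙-∧ : ∀ a b → 𝟙 (a ∧ b) ≡ 𝟙 a * 𝟙 b
𝟙-∧ true  b = sym (*-identityˡ (𝟙 b))
𝟙-∧ false b = sym (*-zeroˡ (𝟙 b))

𝟙-not : ∀ a → 𝟙 (not a) ≡ 1ℚ - 𝟙 a
𝟙-not true  = refl
𝟙-not false = refl

0≤𝟙 : ∀ b → 0ℚ ℚ.≤ 𝟙 b
0≤𝟙 true  = 0≤1
0≤𝟙 false = ≤-refl

false≢true : ∀ {A : Set} {b} → b ≡ false → b ≡ true → A
false≢true refl ()

⇔⇒≡ : ∀ {a b} → (a ≡ true → b ≡ true) → (b ≡ true → a ≡ true) → a ≡ b
⇔⇒≡ {true}  {true}  f g = refl
⇔⇒≡ {true}  {false} f g = sym (f refl)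
⇔⇒≡ {false} {true}  f g = g refl
⇔⇒≡ {false} {false} f g = refl

∧⁻ : ∀ {a b} → a ∧ b ≡ true → a ≡ true × b ≡ true
∧⁻ {true} {true} _ = refl , refl

∧⁺ : ∀ {a b} → a ≡ true → b ≡ true → a ∧ b ≡ true
∧⁺ refl refl = refl

⇒⁻ : ∀ {a b} → not a ∨ b ≡ true → a ≡ true → b ≡ true
⇒⁻ {true} p refl = p

⇒⁺ : ∀ {a b} → (a ≡ true → b ≡ true) → not a ∨ b ≡ true
⇒⁺ {true}  f = f refl
⇒⁺ {false} f = refl

not⁻ : ∀ {a} → not a ≡ true → a ≡ true → ⊥
not⁻ {true} () _

not⁺ : ∀ {a} → (a ≡ true → ⊥) → not a ≡ true
not⁺ {true}  f = ⊥-elim (f refl)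
not⁺ {false} f = refl

¬true⇒false : ∀ {a} → (a ≡ true → ⊥) → a ≡ false
¬true⇒false {true}  f = ⊥-elim (f refl)
¬true⇒false {false} f = refl

sumL : ∀ {A : Set} → List A → (A → ℚ) → ℚ
sumL []       f = 0ℚ
sumL (x ∷ xs) f = f x + sumL xs f

module _ {A : Set} where

  sumL-cong : ∀ (xs : List A) {f g} → (∀ x → f x ≡ g x) → sumL xs f ≡ sumL xs g
  sumL-cong []       e = refl
  sumL-cong (x ∷ xs) e = cong₂ _+_ (e x) (sumL-cong xs e)

  sumL-zero : ∀ (xs : List A) {f} → (∀ x → f x ≡ 0ℚ) → sumL xs f ≡ 0ℚ
  sumL-zero []       e = refl
  sumL-zero (x ∷ xs) e = cong₂ _+_ (e x) (sumL-zero xs e)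

  sumL-+ : ∀ (xs : List A) f g → sumL xs (λ x → f x + g x) ≡ sumL xs f + sumL xs g
  sumL-+ []       f g = refl
  sumL-+ (x ∷ xs) f g = trans (cong (f x + g x +_) (sumL-+ xs f g)) (+-interchange (f x) (g x) (sumL xs f) (sumL xs g))

  sumL-minus : ∀ (xs : List A) f g → sumL xs (λ x → f x - g x) ≡ sumL xs f - sumL xs g
  sumL-minus []       f g = refl
  sumL-minus (x ∷ xs) f g = trans (cong (f x - g x +_) (sumL-minus xs f g)) (eq (f x) (g x) (sumL xs f) (sumL xs g))
    where
    eq : ∀ a b c d → (a - b) + (c - d) ≡ (a + c) - (b + d)
    eq = solve-∀ ringℚ

  sumL-*ˡ : ∀ (xs : List A) c f → c * sumL xs f ≡ sumL xs (λ x → c * f x)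
  sumL-*ˡ []       c f = *-zeroʳ c
  sumL-*ˡ (x ∷ xs) c f = trans (*-distribˡ-+ c _ _) (cong (c * f x +_) (sumL-*ˡ xs c f))

  sumL-*ʳ : ∀ (xs : List A) c f → sumL xs f * c ≡ sumL xs (λ x → f x * c)
  sumL-*ʳ xs c f = trans (*-comm _ c) (trans (sumL-*ˡ xs c f) (sumL-cong xs (λ x → *-comm c (f x))))

  sumL-++ : ∀ (xs ys : List A) f → sumL (xs ++ ys) f ≡ sumL xs f + sumL ys f
  sumL-++ []       ys f = sym (+-identityˡ _)
  sumL-++ (x ∷ xs) ys f = trans (cong (f x +_) (sumL-++ xs ys f)) (sym (+-assoc (f x) _ _))

  sumL-mono : ∀ (xs : List A) {f g} → (∀ x → f x ℚ.≤ g x) → sumL xs f ℚ.≤ sumL xs g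
  sumL-mono []       e = ≤-refl
  sumL-mono (x ∷ xs) e = +-mono-≤ (e x) (sumL-mono xs e)

  sumL-∑ : ∀ (xs : List A) k (f : A → ℕ → ℚ) → sumL xs (λ x → ∑ k (f x)) ≡ ∑ k (λ i → sumL xs (λ x → f x i))
  sumL-∑ xs zero    f = sumL-zero xs (λ _ → refl)
  sumL-∑ xs (suc k) f = trans (sumL-+ xs (λ x → ∑ k (f x)) (λ x → f x k)) (cong (_+ sumL xs (λ x → f x k)) (sumL-∑ xs k f))

  length-sumL : ∀ (xs : List A) → ℕ→ℚ (length xs) ≡ sumL xs (λ _ → 1ℚ)
  length-sumL []       = refl
  length-sumL (x ∷ xs) = trans (ℕ→ℚ-suc (length xs)) (cong (1ℚ +_) (length-sumL xs))

  sumL-filterᵇ : ∀ p (xs : List A) f → sumL (filterᵇ p xs) f ≡ sumL xs (λ x → 𝟙 (p x) * f x)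
  sumL-filterᵇ p []       f = refl
  sumL-filterᵇ p (x ∷ xs) f with p x
  ... | true  = cong₂ _+_ (sym (*-identityˡ (f x))) (sumL-filterᵇ p xs f)
  ... | false = trans (sumL-filterᵇ p xs f) (trans (sym (+-identityˡ _)) (cong (_+ _) (sym (*-zeroˡ (f x)))))

  length-filterᵇ : ∀ p (xs : List A) → ℕ→ℚ (length (filterᵇ p xs)) ≡ sumL xs (λ x → 𝟙 (p x))
  length-filterᵇ p xs = trans (length-sumL (filterᵇ p xs)) (trans (sumL-filterᵇ p xs (λ _ → 1ℚ))
    (sumL-cong xs (λ x → *-identityʳ (𝟙 (p x)))))

  all⁺ : ∀ {p} (xs : List A) → (∀ x → p x ≡ true) → all p xs ≡ true
  all⁺ []       h = refl
  all⁺ (x ∷ xs) h = ∧⁺ (h x) (all⁺ xs h)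

  any⁻ : ∀ {p} (xs : List A) → any p xs ≡ true → ∃ λ x → p x ≡ true
  any⁻ {p} (x ∷ xs) h with p x in e
  ... | true  = x , e
  ... | false = any⁻ xs h

module _ {A B : Set} where

  sumL-map : ∀ (φ : A → B) xs f → sumL (map φ xs) f ≡ sumL xs (f ∘ φ)
  sumL-map φ []       f = refl
  sumL-map φ (x ∷ xs) f = cong (f (φ x) +_) (sumL-map φ xs f)

  sumL-concatMap : ∀ (φ : A → List B) xs f → sumL (concatMap φ xs) f ≡ sumL xs (λ x → sumL (φ x) f)
  sumL-concatMap φ []       f = refl
  sumL-concatMap φ (x ∷ xs) f = trans (sumL-++ (φ x) _ f) (cong (sumL (φ x) f +_) (sumL-concatMap φ xs f))

  sumL-swap : ∀ (xs : List A) (ys : List B) (f : A → B → ℚ) →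
    sumL xs (λ x → sumL ys (λ y → f x y)) ≡ sumL ys (λ y → sumL xs (λ x → f x y))
  sumL-swap []       ys f = sym (sumL-zero ys (λ _ → refl))
  sumL-swap (x ∷ xs) ys f = trans (cong (sumL ys (f x) +_) (sumL-swap xs ys f)) (sym (sumL-+ ys (f x) _))

-- `allFuns` builds its functions by a pattern-matching lambda that agrees with `x ◂ f` only
-- pointwise; hence the hypothesis that `g` respects pointwise equality.
sumL-allFuns : ∀ {A : Set} k (xs : List A) (g : (Fin (suc k) → A) → ℚ) →
  (∀ {u v} → (∀ i → u i ≡ v i) → g u ≡ g v) →
  sumL (allFuns (suc k) xs) g ≡ sumL xs (λ x → sumL (allFuns k xs) (λ f → g (x ◂ f)))
sumL-allFuns k xs g resp = trans (sumL-concatMap _ xs g)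
  (sumL-cong xs (λ x → trans (sumL-map _ (allFuns k xs) g)
    (sumL-cong (allFuns k xs) (λ f → resp λ { zero → refl ; (suc i) → refl }))))

all-allFin : ∀ k p → all p (allFin (suc k)) ≡ p zero ∧ all (p ∘ suc) (allFin k)
all-allFin k p = cong (λ bs → p zero ∧ Data.Bool.ListAction.and bs)
  (trans (map-tabulate suc p) (sym (map-tabulate id (p ∘ suc))))

all-allFin⁻ : ∀ {k p} → all p (allFin k) ≡ true → ∀ i → p i ≡ true
all-allFin⁻ {suc k} {p} h zero    = proj₁ (∧⁻ (trans (sym (all-allFin k p)) h))
all-allFin⁻ {suc k} {p} h (suc i) = all-allFin⁻ {k} (proj₂ (∧⁻ {p zero} (trans (sym (all-allFin k p)) h))) i

∏ᶠ : (k : ℕ) → (Fin k → ℚ) → ℚ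
∏ᶠ zero    f = 1ℚ
∏ᶠ (suc k) f = f zero * ∏ᶠ k (f ∘ suc)

∏ᶠ-const : ∀ k {f c} → (∀ i → f i ≡ c) → ∏ᶠ k f ≡ c ^ℚ k
∏ᶠ-const zero e = refl
∏ᶠ-const (suc k) e = cong₂ _*_ (e zero) (∏ᶠ-const k (e ∘ suc))

𝟙-all : ∀ k (p : Fin k → Bool) → 𝟙 (all p (allFin k)) ≡ ∏ᶠ k (𝟙 ∘ p)
𝟙-all zero    p = refl
𝟙-all (suc k) p = trans (cong 𝟙 (all-allFin k p)) (trans (𝟙-∧ (p zero) _) (cong (𝟙 (p zero) *_) (𝟙-all k (p ∘ suc))))

module _ {A : Set} (_≟A_ : DecidableEquality A) where

  does-sound : ∀ {x y} → does (x ≟A y) ≡ true → x ≡ y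
  does-sound {x} {y} e with x ≟A y
  ... | yes p = p

  count-unique : ∀ {xs a} → Unique xs → a ∈ xs → sumL xs (λ x → 𝟙 (does (x ≟A a))) ≡ 1ℚ
  count-unique {a = a} (h ∷ u) (here refl) =
    trans (cong₂ _+_ (cong 𝟙 (dec-true (a ≟A a) refl)) (none _ h)) (+-identityʳ 1ℚ)
    where
    none : ∀ xs → All.All (a ≢_) xs → sumL xs (λ x → 𝟙 (does (x ≟A a))) ≡ 0ℚ
    none []       _              = refl
    none (x ∷ xs) (a≢x All.∷ h) = cong₂ _+_ (cong 𝟙 (¬true⇒false (λ e → a≢x (sym (does-sound e))))) (none xs h)
  count-unique {x ∷ xs} {a} (h ∷ u) (there a∈) =
    trans (cong₂ _+_ (cong 𝟙 (¬true⇒false (λ e → All.lookup h a∈ (does-sound e)))) (count-unique u a∈)) (+-identityˡ 1ℚ)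

-- Finite sets up to an equivalence: without function extensionality a list of functions
-- can only be complete and duplicate-free up to pointwise equality.
record FinSet : Set₁ where
  infix 4 _≈_
  field
    Carrier      : Set
    _≈_          : Carrier → Carrier → Set
    ≈-refl       : ∀ {x} → x ≈ x
    ≈-sym        : ∀ {x y} → x ≈ y → y ≈ x
    ≈-trans      : ∀ {x y z} → x ≈ y → y ≈ z → x ≈ z
    eqb          : Carrier → Carrier → Bool
    eqb-sound    : ∀ {x y} → eqb x y ≡ true → x ≈ y
    eqb-complete : ∀ {x y} → x ≈ y → eqb x y ≡ true
    elements     : List Carrier
    count-eqb    : ∀ a → sumL elements (λ x → 𝟙 (eqb x a)) ≡ 1ℚ

  Resp : ∀ {B : Set} → (Carrier → B) → Set
  Resp f = ∀ {x y} → x ≈ y → f x ≡ f y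

  sum : (Carrier → ℚ) → ℚ
  sum = sumL elements

  eqb-sym : ∀ x y → eqb x y ≡ eqb y x
  eqb-sym x y = ⇔⇒≡ (eqb-complete ∘ ≈-sym ∘ eqb-sound) (eqb-complete ∘ ≈-sym ∘ eqb-sound)

  sum-pick : ∀ {f} a → Resp f → sum (λ x → 𝟙 (eqb x a) * f x) ≡ f a
  sum-pick {f} a resp = begin
    sum (λ x → 𝟙 (eqb x a) * f x)   ≡⟨ sumL-cong elements pointwise ⟩
    sum (λ x → 𝟙 (eqb x a) * f a)   ≡⟨ sym (sumL-*ʳ elements (f a) _) ⟩
    sum (λ x → 𝟙 (eqb x a)) * f a   ≡⟨ cong (_* f a) (count-eqb a) ⟩
    1ℚ * f a                        ≡⟨ *-identityˡ (f a) ⟩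
    f a                             ∎
    where
    open ≡-Reasoning
    pointwise : ∀ x → 𝟙 (eqb x a) * f x ≡ 𝟙 (eqb x a) * f a
    pointwise x with eqb x a in e
    ... | true  = cong (1ℚ *_) (resp (eqb-sound e))
    ... | false = trans (*-zeroˡ (f x)) (sym (*-zeroˡ (f a)))

  sum-pick′ : ∀ {f} a → Resp f → sum (λ x → 𝟙 (eqb a x) * f x) ≡ f a
  sum-pick′ {f} a resp = trans (sumL-cong elements (λ x → cong (λ b → 𝟙 b * f x) (eqb-sym a x))) (sum-pick a resp)

  -- That some representative of `a` occurs in the list is recovered from the count: if `p` failed
  -- throughout, the sum that `sum-pick` evaluates to 1 would vanish.
  any⁺ : ∀ {p} a → Resp p → p a ≡ true → any p elements ≡ true
  any⁺ {p} a resp pa = go elements (λ e → 1≢0 (trans (sym (trans (sum-pick a resp′) (cong 𝟙 pa))) e))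
    where
    resp′ : Resp (𝟙 ∘ p)
    resp′ = cong 𝟙 ∘ resp
    go : ∀ xs → (sumL xs (λ x → 𝟙 (eqb x a) * 𝟙 (p x)) ≡ 0ℚ → ⊥) → any p xs ≡ true
    go []       h = ⊥-elim (h refl)
    go (x ∷ xs) h with p x
    ... | true  = refl
    ... | false = go xs (λ e → h (trans (cong₂ _+_ (*-zeroʳ (𝟙 (eqb x a))) e) refl))

  all⁻ : ∀ {p} → Resp p → all p elements ≡ true → ∀ x → p x ≡ true
  all⁻ {p} resp h a with p a in pa
  ... | true  = refl
  ... | false = sym (go elements h (λ e → 1≢0 (trans (sym (count-eqb a)) e)))
    where
    go : ∀ xs → all p xs ≡ true → (sumL xs (λ x → 𝟙 (eqb x a)) ≡ 0ℚ → ⊥) → true ≡ false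
    go []       _ h = ⊥-elim (h refl)
    go (x ∷ xs) g h with eqb x a in e
    ... | true  = trans (sym (proj₁ (∧⁻ {p x} g))) (trans (resp (eqb-sound e)) pa)
    ... | false = go xs (proj₂ (∧⁻ {p x} g)) (λ e′ → h (trans (+-identityˡ _) e′))

  -- Uniqueness turns an existential test into a sum, which can then be interchanged with other
  -- sums; spans and sets of bases are counted in this way.
  𝟙-any-unique : ∀ {p} → Resp p → (∀ x y → p x ≡ true → p y ≡ true → x ≈ y) →
    𝟙 (any p elements) ≡ sum (𝟙 ∘ p)
  𝟙-any-unique {p} resp uniq with any p elements in e
  ... | true with any⁻ elements e
  ...   | a , pa = sym (trans (sumL-cong elements (λ x → cong 𝟙 (⇔⇒≡
            (λ px → eqb-complete (uniq x a px pa))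
            (λ q → trans (resp (eqb-sound q)) pa)))) (count-eqb a))
  𝟙-any-unique {p} resp uniq | false = sym (sumL-zero elements
    (λ x → cong 𝟙 (¬true⇒false (λ px → false≢true e (any⁺ x resp px)))))

  count≡1⇒∃ : ∀ {p} → sum (𝟙 ∘ p) ≡ 1ℚ → ∃ λ x → p x ≡ true
  count≡1⇒∃ {p} h = go elements (λ e → 1≢0 (trans (sym h) e))
    where
    go : ∀ xs → (sumL xs (𝟙 ∘ p) ≡ 0ℚ → ⊥) → ∃ λ x → p x ≡ true
    go []       h = ⊥-elim (h refl)
    go (x ∷ xs) h with p x in e
    ... | true  = x , e
    ... | false = go xs (λ e′ → h (trans (+-identityˡ _) e′))

  -- Two inequivalent solutions would contribute 2 to a sum equal to 1.
  count≡1⇒unique : ∀ {p} → Resp p → sum (𝟙 ∘ p) ≡ 1ℚ → ∀ {a b} → p a ≡ true → p b ≡ true → a ≈ b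
  count≡1⇒unique {p} resp h {a} {b} pa pb with eqb a b in e
  ... | true  = eqb-sound e
  ... | false = ⊥-elim (<⇒≢ 0<1 (≤-antisym 0≤1 (subst₂ ℚ._≤_ lhs rhs (+-monoʳ-≤ (- 1ℚ) 2≤1))))
    where
    lhs : - 1ℚ + (1ℚ + 1ℚ) ≡ 1ℚ
    lhs = refl
    rhs : - 1ℚ + 1ℚ ≡ 0ℚ
    rhs = refl
    pointwise : ∀ x → 𝟙 (eqb x a) + 𝟙 (eqb x b) ℚ.≤ 𝟙 (p x)
    pointwise x with eqb x a in ea | eqb x b in eb
    ... | true  | true  = false≢true e (eqb-complete (≈-trans (≈-sym (eqb-sound ea)) (eqb-sound eb)))
    ... | true  | false = ≤-reflexive (trans (+-identityʳ 1ℚ) (cong 𝟙 (sym (trans (resp (eqb-sound ea)) pa))))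
    ... | false | true  = ≤-reflexive (trans (+-identityˡ 1ℚ) (cong 𝟙 (sym (trans (resp (eqb-sound eb)) pb))))
    ... | false | false = 0≤𝟙 (p x)
    2≤1 : 1ℚ + 1ℚ ℚ.≤ 1ℚ
    2≤1 = subst₂ ℚ._≤_ (trans (sumL-+ elements _ _) (cong₂ _+_ (count-eqb a) (count-eqb b))) h
            (sumL-mono elements pointwise)

  size : ℚ
  size = sum (λ _ → 1ℚ)

discrete : ∀ {A : Set} → DecidableEquality A → (xs : List A) → Unique xs → (∀ x → x ∈ xs) → FinSet
discrete {A} _≟A_ xs unique complete = record
  { Carrier = A ; _≈_ = _≡_ ; ≈-refl = refl ; ≈-sym = sym ; ≈-trans = trans
  ; eqb = λ x y → does (x ≟A y) ; eqb-sound = does-sound _≟A_ ; eqb-complete = λ {x} {y} → dec-true (x ≟A y)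
  ; elements = xs ; count-eqb = λ a → count-unique _≟A_ unique (complete a) }

open FinSet public using (Carrier; sum; size; elements)

Fun : ℕ → FinSet → FinSet
Fun k A = record
  { Carrier      = Fin k → A.Carrier
  ; _≈_          = λ u v → ∀ i → u i A.≈ v i
  ; ≈-refl       = λ i → A.≈-refl
  ; ≈-sym        = λ e i → A.≈-sym (e i)
  ; ≈-trans      = λ e e′ i → A.≈-trans (e i) (e′ i)
  ; eqb          = eqF k
  ; eqb-sound    = λ e i → A.eqb-sound (all-allFin⁻ e i)
  ; eqb-complete = λ {x} {y} e → complete k {x} {y} e
  ; elements     = allFuns k A.elements
  ; count-eqb    = cnt k
  }
  where
  module A = FinSet A
  eqF : ∀ k → (Fin k → A.Carrier) → (Fin k → A.Carrier) → Bool
  eqF k u v = all (λ i → A.eqb (u i) (v i)) (allFin k)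
  complete : ∀ k {u v : Fin k → A.Carrier} → (∀ i → u i A.≈ v i) → eqF k u v ≡ true
  complete k e = all⁺ (allFin k) (λ i → A.eqb-complete (e i))
  cnt : ∀ k a → sumL (allFuns k A.elements) (λ u → 𝟙 (eqF k u a)) ≡ 1ℚ
  cnt zero    a = refl
  cnt (suc k) a = begin
    sumL (allFuns (suc k) A.elements) (λ u → 𝟙 (eqF (suc k) u a))
      ≡⟨ sumL-allFuns k A.elements _ (λ {u} {v} e → cong 𝟙 (⇔⇒≡
           (λ h → complete (suc k) {v} (λ i → subst (A._≈ a i) (e i) (A.eqb-sound (all-allFin⁻ h i))))
           (λ h → complete (suc k) {u} (λ i → subst (A._≈ a i) (sym (e i)) (A.eqb-sound (all-allFin⁻ h i)))))) ⟩
    sumL A.elements (λ x → sumL (allFuns k A.elements) (λ f → 𝟙 (eqF (suc k) (x ◂ f) a)))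
      ≡⟨ sumL-cong A.elements (λ x → trans
           (sumL-cong (allFuns k A.elements) (λ f → trans (cong 𝟙 (all-allFin k (λ i → A.eqb ((x ◂ f) i) (a i)))) (𝟙-∧ (A.eqb x (a zero)) _)))
           (sym (sumL-*ˡ (allFuns k A.elements) (𝟙 (A.eqb x (a zero))) _))) ⟩
    sumL A.elements (λ x → 𝟙 (A.eqb x (a zero)) * sumL (allFuns k A.elements) (λ f → 𝟙 (eqF k f (a ∘ suc))))
      ≡⟨ A.sum-pick (a zero) (λ _ → refl) ⟩
    sumL (allFuns k A.elements) (λ f → 𝟙 (eqF k f (a ∘ suc)))
      ≡⟨ cnt k (a ∘ suc) ⟩
    1ℚ ∎ where open ≡-Reasoning

-- Conditions imposed coordinate by coordinate are independent, so the count factors. It is applied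
-- to the rows of a matrix and to the coefficients of a linear combination.
sum-Fun-all : ∀ k A (p : Fin k → Carrier A → Bool) →
  sum (Fun k A) (λ f → 𝟙 (all (λ i → p i (f i)) (allFin k))) ≡ ∏ᶠ k (λ i → sum A (𝟙 ∘ p i))
sum-Fun-all zero    A p = refl
sum-Fun-all (suc k) A p = begin
  sum (Fun (suc k) A) (λ f → 𝟙 (all (λ i → p i (f i)) (allFin (suc k))))
    ≡⟨ sumL-allFuns k A.elements _ (λ {u} {v} e → cong 𝟙 (⇔⇒≡
         (λ h → all⁺ (allFin (suc k)) (λ i → subst (λ x → p i x ≡ true) (e i) (all-allFin⁻ h i)))
         (λ h → all⁺ (allFin (suc k)) (λ i → subst (λ x → p i x ≡ true) (sym (e i)) (all-allFin⁻ h i))))) ⟩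
  A.sum (λ x → sum (Fun k A) (λ f → 𝟙 (all (λ i → p i ((x ◂ f) i)) (allFin (suc k)))))
    ≡⟨ sumL-cong A.elements (λ x → trans
         (sumL-cong (allFuns k A.elements) (λ f → trans (cong 𝟙 (all-allFin k (λ i → p i ((x ◂ f) i)))) (𝟙-∧ (p zero x) _)))
         (sym (sumL-*ˡ (allFuns k A.elements) (𝟙 (p zero x)) _))) ⟩
  A.sum (λ x → 𝟙 (p zero x) * sum (Fun k A) (λ f → 𝟙 (all (λ i → p (suc i) (f i)) (allFin k))))
    ≡⟨ sym (sumL-*ʳ A.elements _ _) ⟩
  A.sum (𝟙 ∘ p zero) * sum (Fun k A) (λ f → 𝟙 (all (λ i → p (suc i) (f i)) (allFin k)))
    ≡⟨ cong (A.sum (𝟙 ∘ p zero) *_) (sum-Fun-all k A (p ∘ suc)) ⟩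
  ∏ᶠ (suc k) (λ i → A.sum (𝟙 ∘ p i)) ∎
  where
  open ≡-Reasoning
  module A = FinSet A

size-Fun : ∀ k A → size (Fun k A) ≡ size A ^ℚ k
size-Fun k A = trans
  (sumL-cong (elements (Fun k A)) (λ _ → cong 𝟙 (sym (all⁺ (allFin k) (λ _ → refl)))))
  (trans (sum-Fun-all k A (λ _ _ → true)) (∏ᶠ-const k (λ _ → refl)))

sumL-cong-∈ : ∀ {A : Set} (xs : List A) {f g} → (∀ {x} → x ∈ xs → f x ≡ g x) → sumL xs f ≡ sumL xs g
sumL-cong-∈ []       e = refl
sumL-cong-∈ (x ∷ xs) e = cong₂ _+_ (e (here refl)) (sumL-cong-∈ xs (e ∘ there))

-- If every value occurs `N` times, the length is `N` times the number of values. Here the values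
-- are subspaces and `N` is the number of bases of each.
length-deduplicate : ∀ {A : Set} (_≟A_ : DecidableEquality A) xs N →
  (∀ {a} → a ∈ xs → sumL xs (λ x → 𝟙 (does (a ≟A x))) ≡ N) →
  ℕ→ℚ (length xs) ≡ ℕ→ℚ (length (deduplicate _≟A_ xs)) * N
length-deduplicate _≟A_ xs N h = begin
  ℕ→ℚ (length xs)
    ≡⟨ length-sumL xs ⟩
  sumL xs (λ _ → 1ℚ)
    ≡⟨ sumL-cong-∈ xs (λ x∈ → sym (count-unique _≟A_ (deduplicate-! _≟A_ xs)
         (∈-deduplicate⁺ _≟A_ x∈))) ⟩
  sumL xs (λ x → sumL ys (λ y → 𝟙 (does (y ≟A x))))
    ≡⟨ sumL-swap xs ys _ ⟩
  sumL ys (λ y → sumL xs (λ x → 𝟙 (does (y ≟A x))))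
    ≡⟨ sumL-cong-∈ ys (λ y∈ → trans (h (∈-deduplicate⁻ _≟A_ xs y∈)) (sym (*-identityˡ N))) ⟩
  sumL ys (λ _ → 1ℚ * N)
    ≡⟨ sym (sumL-*ʳ ys N _) ⟩
  sumL ys (λ _ → 1ℚ) * N
    ≡⟨ cong (_* N) (sym (length-sumL ys)) ⟩
  ℕ→ℚ (length ys) * N ∎
  where
  open ≡-Reasoning
  ys = deduplicate _≟A_ xs

∈-map-filterᵇ⁻ : ∀ {A B : Set} (f : A → B) p xs {y} → y ∈ map f (filterᵇ p xs) → ∃ λ x → p x ≡ true × y ≡ f x
∈-map-filterᵇ⁻ f p (x ∷ xs) y∈ with p x in e
∈-map-filterᵇ⁻ f p (x ∷ xs) (here refl) | true  = x , e , refl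
∈-map-filterᵇ⁻ f p (x ∷ xs) (there y∈)  | true  = ∈-map-filterᵇ⁻ f p xs y∈
∈-map-filterᵇ⁻ f p (x ∷ xs) y∈          | false = ∈-map-filterᵇ⁻ f p xs y∈

-- Equal codes mean equal characteristic functions. The list meets each class of `≈` in one
-- representative only, so both functions have to respect `≈`.
map-injective : ∀ (A : FinSet) {f g : Carrier A → Bool} → FinSet.Resp A f → FinSet.Resp A g →
  map f (elements A) ≡ map g (elements A) → ∀ x → f x ≡ g x
map-injective A {f} {g} rf rg e x = does-sound Bool._≟_ (FinSet.all⁻ A {λ x → does (f x Bool.≟ g x)}
  (λ {x} {y} x≈y → cong₂ (λ a b → does (a Bool.≟ b)) (rf x≈y) (rg x≈y)) (go (elements A) e) x)
  where
  go : ∀ xs → map f xs ≡ map g xs → all (λ x → does (f x Bool.≟ g x)) xs ≡ true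
  go []       _ = refl
  go (x ∷ xs) e = ∧⁺ (dec-true (f x Bool.≟ g x) (∷-injectiveˡ e)) (go xs (∷-injectiveʳ e))

all-cong : ∀ {A : Set} (xs : List A) {p p′ : A → Bool} → (∀ x → p x ≡ p′ x) → all p xs ≡ all p′ xs
all-cong []       e = refl
all-cong (x ∷ xs) e = cong₂ _∧_ (e x) (all-cong xs e)

-- The power series ∑ coeff q d u^d

-- For q > 1 these are Euler's coefficients of ∏_{i≥1} (1 - u q^(-i)).
coeff : ℚ → ℕ → ℚ
coeff q d = ∏ d (λ i → inv (1ℚ - q ^ℚ suc i))

-- The probability that `D` random vectors in dimension `n` over a field of q elements are
-- independent; the factor i = n makes it vanish for `D` > `n`.
θ : ℚ → ℕ → ℕ → ℚ
θ q n D = ∏ D (λ i → 1ℚ - q ^ℚ i * inv (q ^ℚ n))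

-- Each layer excludes one more eigenvalue: `D` is the length of the tuple prescribed so far and `d`
-- the number of vectors added for the new eigenvalue. The cut at `n` is that of `telescope` taken
-- at `m` = `n`.
iter : ℚ → ℕ → ℕ → (ℕ → ℚ) → ℕ → ℚ
iter q n zero    h D = h D
iter q n (suc j) h D = ∑ (suc n) (λ d → coeff q d * iter q n j h (d ℕ.+ D))

-- Induction on `m`: the new product is (K - 1) `P`, the old coefficient is the new one times 1 -
-- `x`, and (1 - x) + (K - 1) = K - x supplies the next factor.
telescope : ∀ q K m → (∀ i → 1ℚ - q ^ℚ suc i ≢ 0ℚ) →
  ∑ (suc m) (λ d → coeff q d * ∏ d (λ i → K - q ^ℚ i)) ≡ coeff q m * ∏ m (λ i → K - q ^ℚ suc i)
telescope q K zero    _   = refl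
telescope q K (suc m) ≢0 = begin
  ∑ (suc m) (λ d → coeff q d * ∏ d (λ i → K - q ^ℚ i)) + coeff q (suc m) * ∏ (suc m) (λ i → K - q ^ℚ i)
    ≡⟨ cong₂ (λ a b → a + coeff q (suc m) * b) (telescope q K m ≢0) (∏-shift m (λ i → K - q ^ℚ i)) ⟩
  coeff q m * P + coeff q (suc m) * ((K - 1ℚ) * P)
    ≡⟨ cong (λ t → t * P + coeff q (suc m) * ((K - 1ℚ) * P)) (sym unfold) ⟩
  (coeff q (suc m) * (1ℚ - x)) * P + coeff q (suc m) * ((K - 1ℚ) * P)
    ≡⟨ eq (coeff q (suc m)) x P K ⟩
  coeff q (suc m) * (P * (K - x)) ∎
  where
  open ≡-Reasoning
  x = q ^ℚ suc m
  P = ∏ m (λ i → K - q ^ℚ suc i)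
  unfold : coeff q (suc m) * (1ℚ - x) ≡ coeff q m
  unfold = trans (*-assoc (coeff q m) _ _) (trans (cong (coeff q m *_) (*-invˡ (≢0 m))) (*-identityʳ _))
  eq : ∀ a x P K → (a * (1ℚ - x)) * P + a * ((K - 1ℚ) * P) ≡ a * (P * (K - x))
  eq = solve-∀ ringℚ

coeff-cancel : ∀ q m → (∀ i → 1ℚ - q ^ℚ suc i ≢ 0ℚ) → coeff q m * ∏ m (λ i → 1ℚ - q ^ℚ suc i) ≡ 1ℚ
coeff-cancel q m ≢0 = trans (sym (∏-*-distrib m _ _)) (trans (∏-cong m (λ i _ → *-invˡ (≢0 i)))
  (trans (∏-const m 1ℚ) (1^ℚ m)))

prodL : ∀ {A : Set} → List A → (A → ℚ) → ℚ
prodL []       f = 1ℚ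
prodL (x ∷ xs) f = f x * prodL xs f

𝟙-not-any : ∀ {A : Set} (p : A → Bool) xs → 𝟙 (not (any p xs)) ≡ prodL xs (λ x → 𝟙 (not (p x)))
𝟙-not-any p []       = refl
𝟙-not-any p (x ∷ xs) with p x
... | true  = sym (*-zeroˡ (prodL xs (λ x → 𝟙 (not (p x)))))
... | false = trans (𝟙-not-any p xs) (sym (*-identityˡ _))

-- H q j m is the m-th partial sum of the coefficients of (∑_d coeff q d u^d)^j.
H : ℚ → ℕ → ℕ → ℚ
H q zero    m = 1ℚ
H q (suc j) m = ∑ (suc m) (λ d → coeff q d * H q j (m ℕ.∸ d))

φ : ℚ → ℕ → ℚ
φ q n = ∏ n (λ i → 1ℚ - inv (q ^ℚ suc i))

∏-+ : ∀ d D f → ∏ (d ℕ.+ D) f ≡ ∏ D f * ∏ d (λ i → f (i ℕ.+ D))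
∏-+ zero    D f = sym (*-identityʳ _)
∏-+ (suc d) D f = trans (cong (_* f (d ℕ.+ D)) (∏-+ d D f)) (*-assoc (∏ D f) _ _)

iter-cong : ∀ q n j {h h′} → (∀ D → h D ≡ h′ D) → ∀ D → iter q n j h D ≡ iter q n j h′ D
iter-cong q n zero    e D = e D
iter-cong q n (suc j) e D = ∑-cong (suc n) (λ d _ → cong (coeff q d *_) (iter-cong q n j e (d ℕ.+ D)))

-- Singles out the innermost layer, which `iter-θ` then absorbs into the initial function.
iter-suc : ∀ q n j h D → iter q n (suc j) h D ≡ iter q n j (iter q n 1 h) D
iter-suc q n zero    h D = refl
iter-suc q n (suc j) h D = ∑-cong (suc n) (λ d _ → cong (coeff q d *_) (iter-suc q n j h (d ℕ.+ D)))

∑-truncate : ∀ {k l} f → k ≤ l → (∀ i → k ≤ i → f i ≡ 0ℚ) → ∑ l f ≡ ∑ k f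
∑-truncate {k} {l} f k≤l e = trans (cong (λ t → ∑ t f) (sym (ℕP.m∸n+n≡m k≤l))) (∑-zero-tail k (l ℕ.∸ k) e)

module _ (q : ℚ) (n : ℕ) where

  iter-vanish : ∀ j {h} → (∀ D → n ℕ.< D → h D ≡ 0ℚ) → ∀ D → n ℕ.< D → iter q n j h D ≡ 0ℚ
  iter-vanish zero    e D n<D = e D n<D
  iter-vanish (suc j) e D n<D = ∑-zero (suc n) (λ d _ → trans
    (cong (coeff q d *_) (iter-vanish j e (d ℕ.+ D) (ℕP.≤-trans n<D (ℕP.m≤n+m D d)))) (*-zeroʳ (coeff q d)))

  -- The initial function is `t` up to `n` and 0 beyond. So the outer sum stops at d = n - D, and
  -- the inner layers start with n - D - d left, which is the recursion of `H`.
  iter-H : ∀ j {h t} → (∀ D → D ≤ n → h D ≡ t) → (∀ D → n ℕ.< D → h D ≡ 0ℚ) →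
    ∀ D → D ≤ n → iter q n j h D ≡ t * H q j (n ℕ.∸ D)
  iter-H zero    {t = t} e₁ e₂ D D≤n = trans (e₁ D D≤n) (sym (*-identityʳ t))
  iter-H (suc j) {h} {t} e₁ e₂ D D≤n = begin
    ∑ (suc n) (λ d → coeff q d * iter q n j h (d ℕ.+ D))
      ≡⟨ ∑-truncate _ (s≤s (ℕP.m∸n≤m n D)) (λ d n∸D<d → trans (cong (coeff q d *_) (iter-vanish j e₂ (d ℕ.+ D)
           (ℕP.≤-trans (ℕP.≤-reflexive (cong suc (sym (ℕP.m∸n+n≡m D≤n)))) (ℕP.+-monoˡ-≤ D n∸D<d)))) (*-zeroʳ (coeff q d))) ⟩
    ∑ (suc (n ℕ.∸ D)) (λ d → coeff q d * iter q n j h (d ℕ.+ D))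
      ≡⟨ ∑-cong (suc (n ℕ.∸ D)) (λ d d≤ → trans
           (cong (coeff q d *_) (trans (iter-H j e₁ e₂ (d ℕ.+ D) (ℕP.≤-trans (ℕP.+-monoˡ-≤ D (ℕP.≤-pred d≤)) (ℕP.≤-reflexive (ℕP.m∸n+n≡m D≤n))))
             (cong (λ m → t * H q j m) (trans (cong (n ℕ.∸_) (ℕP.+-comm d D)) (sym (ℕP.∸-+-assoc n D d))))))
           (*-exchange (coeff q d) t (H q j (n ℕ.∸ D ℕ.∸ d)))) ⟩
    ∑ (suc (n ℕ.∸ D)) (λ d → t * (coeff q d * H q j (n ℕ.∸ D ℕ.∸ d)))
      ≡⟨ sym (∑-*ˡ (suc (n ℕ.∸ D)) t _) ⟩
    t * H q (suc j) (n ℕ.∸ D) ∎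
    where
    open ≡-Reasoning

module Theta (q : ℚ) (q^≢0 : ∀ i → q ^ℚ i ≢ 0ℚ) where

  inv-q^ : ∀ m D → inv (q ^ℚ (m ℕ.+ D)) ≡ inv (q ^ℚ m) * inv (q ^ℚ D)
  inv-q^ m D = trans (cong inv (^ℚ-+ q m D)) (inv-* (q^≢0 m) (q^≢0 D))

  θ-zero : ∀ n D → n ℕ.< D → θ q n D ≡ 0ℚ
  θ-zero n D n<D = ∏-zero D n n<D (trans (cong (λ t → 1ℚ - t) (*-invʳ (q^≢0 n))) (+-inverseʳ 1ℚ))

  -- The first `D` vectors are independent, and the other `d` are independent modulo their span, in
  -- a quotient of dimension `m`.
  θ-+ : ∀ m d D → θ q (m ℕ.+ D) (d ℕ.+ D) ≡ θ q (m ℕ.+ D) D * θ q m d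
  θ-+ m d D = trans (∏-+ d D _) (cong (θ q (m ℕ.+ D) D *_) (∏-cong d (λ i _ → cong (λ t → 1ℚ - t) (begin
    q ^ℚ (i ℕ.+ D) * inv (q ^ℚ (m ℕ.+ D))                 ≡⟨ cong₂ _*_ (^ℚ-+ q i D) (inv-q^ m D) ⟩
    (q ^ℚ i * q ^ℚ D) * (inv (q ^ℚ m) * inv (q ^ℚ D))     ≡⟨ *-interchange (q ^ℚ i) (q ^ℚ D) (inv (q ^ℚ m)) (inv (q ^ℚ D)) ⟩
    (q ^ℚ i * inv (q ^ℚ m)) * (q ^ℚ D * inv (q ^ℚ D))     ≡⟨ trans (cong (q ^ℚ i * inv (q ^ℚ m) *_) (*-invʳ (q^≢0 D))) (*-identityʳ _) ⟩
    q ^ℚ i * inv (q ^ℚ m) ∎))))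
    where
    open ≡-Reasoning

  -- The same factors in reverse order.
  θ≡φ : ∀ n → θ q n n ≡ φ q n
  θ≡φ zero    = refl
  θ≡φ (suc n) = begin
    θ q (suc n) (suc n)
      ≡⟨ ∏-shift n (λ i → 1ℚ - q ^ℚ i * inv (q ^ℚ suc n)) ⟩
    (1ℚ - 1ℚ * inv (q ^ℚ suc n)) * ∏ n (λ i → 1ℚ - q ^ℚ suc i * inv (q ^ℚ suc n))
      ≡⟨ cong₂ _*_ (cong (λ t → 1ℚ - t) (*-identityˡ (inv (q ^ℚ suc n)))) (∏-cong n (λ i _ → cong (λ t → 1ℚ - t) (lower i))) ⟩
    (1ℚ - inv (q ^ℚ suc n)) * θ q n n
      ≡⟨ trans (*-comm (1ℚ - inv (q ^ℚ suc n)) (θ q n n)) (cong (_* (1ℚ - inv (q ^ℚ suc n))) (θ≡φ n)) ⟩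
    φ q (suc n) ∎
    where
    open ≡-Reasoning
    q≢0 : q ≢ 0ℚ
    q≢0 e = q^≢0 1 (trans (*-identityʳ q) e)
    lower : ∀ i → q ^ℚ suc i * inv (q ^ℚ suc n) ≡ q ^ℚ i * inv (q ^ℚ n)
    lower i = trans (cong (q ^ℚ suc i *_) (inv-* q≢0 (q^≢0 n))) (trans (*-interchange q (q ^ℚ i) (inv q) (inv (q ^ℚ n)))
      (trans (cong (_* (q ^ℚ i * inv (q ^ℚ n))) (*-invʳ q≢0)) (*-identityˡ (q ^ℚ i * inv (q ^ℚ n)))))

  -- By `θ-+` a factor comes out of the sum, and what remains is the hypothesis at m = n - D. The
  -- result does not depend on `D`: this one layer makes the initial function constant up to `n`, as
  -- `iter-H` requires.
  iter-θ : (∀ m → ∑ (suc m) (λ d → coeff q d * θ q m (d ℕ.+ 0)) ≡ θ q m m) →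
    ∀ n D → D ≤ n → iter q n 1 (θ q n) D ≡ θ q n n
  iter-θ ∑θ n D D≤n = subst (λ k → iter q k 1 (θ q k) D ≡ θ q k k) (ℕP.m∸n+n≡m D≤n) (begin
    ∑ (suc (m ℕ.+ D)) (λ d → coeff q d * θ q (m ℕ.+ D) (d ℕ.+ D))
      ≡⟨ ∑-cong (suc (m ℕ.+ D)) (λ d _ → trans (cong (coeff q d *_) (θ-+ m d D)) (*-exchange (coeff q d) (θ q (m ℕ.+ D) D) (θ q m d))) ⟩
    ∑ (suc (m ℕ.+ D)) (λ d → θ q (m ℕ.+ D) D * (coeff q d * θ q m d))
      ≡⟨ sym (∑-*ˡ (suc (m ℕ.+ D)) (θ q (m ℕ.+ D) D) _) ⟩
    θ q (m ℕ.+ D) D * ∑ (suc (m ℕ.+ D)) (λ d → coeff q d * θ q m d)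
      ≡⟨ cong (θ q (m ℕ.+ D) D *_) (trans
           (∑-truncate _ (s≤s (ℕP.m≤m+n m D)) (λ d m<d → trans (cong (coeff q d *_) (θ-zero m d m<d)) (*-zeroʳ (coeff q d))))
           (trans (∑-cong (suc m) (λ d _ → cong (λ e → coeff q d * θ q m e) (sym (ℕP.+-identityʳ d)))) (∑θ m))) ⟩
    θ q (m ℕ.+ D) D * θ q m m
      ≡⟨ sym (θ-+ m m D) ⟩
    θ q (m ℕ.+ D) (m ℕ.+ D) ∎)
    where
    open ≡-Reasoning
    m = n ℕ.∸ D

-- The E stand for q^(n²) - q^ℓ and the D for q² - q^ℓ; the leading `1ℚ *` is how `∏ 2` unfolds.
inv-quotients : ∀ N X D₀ D₁ E₀ E₁ → D₀ ≢ 0ℚ → D₁ ≢ 0ℚ → E₀ ≢ 0ℚ → E₁ ≢ 0ℚ → N * ((1ℚ * D₀) * D₁) ≡ X →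
  N ÷' ((1ℚ * (E₀ ÷' D₀)) * (E₁ ÷' D₁)) ≡ X ÷' (E₀ * E₁)
inv-quotients N X D₀ D₁ E₀ E₁ d₀ d₁ e₀ e₁ h = begin
  N ÷' ((1ℚ * (E₀ ÷' D₀)) * (E₁ ÷' D₁))
    ≡⟨ trans (÷'≡*inv N _) (cong (λ t → N * inv t) (cong₂ (λ a b → (1ℚ * a) * b) (÷'≡*inv E₀ D₀) (÷'≡*inv E₁ D₁))) ⟩
  N * inv ((1ℚ * (E₀ * inv D₀)) * (E₁ * inv D₁))
    ≡⟨ cong (N *_) (inv-unique unit nonzero) ⟩
  N * (((1ℚ * D₀) * D₁) * inv (E₀ * E₁))
    ≡⟨ sym (*-assoc N _ _) ⟩
  (N * ((1ℚ * D₀) * D₁)) * inv (E₀ * E₁)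
    ≡⟨ cong (_* inv (E₀ * E₁)) h ⟩
  X * inv (E₀ * E₁)
    ≡⟨ sym (÷'≡*inv X (E₀ * E₁)) ⟩
  X ÷' (E₀ * E₁) ∎
  where
  open ≡-Reasoning
  eq : ∀ a b c d x y z → ((1ℚ * (a * x)) * (b * y)) * (((1ℚ * c) * d) * z) ≡ ((a * b) * z) * ((c * x) * (d * y))
  eq = solve-∀ ringℚ
  unit : ((1ℚ * (E₀ * inv D₀)) * (E₁ * inv D₁)) * (((1ℚ * D₀) * D₁) * inv (E₀ * E₁)) ≡ 1ℚ
  unit = trans (eq E₀ E₁ D₀ D₁ (inv D₀) (inv D₁) (inv (E₀ * E₁)))
    (cong₂ _*_ (*-invʳ (*-≢0 e₀ e₁)) (cong₂ _*_ (*-invʳ d₀) (*-invʳ d₁)))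
  nonzero : (1ℚ * (E₀ * inv D₀)) * (E₁ * inv D₁) ≢ 0ℚ
  nonzero z = 1≢0 (trans (sym unit) (trans (cong (_* (((1ℚ * D₀) * D₁) * inv (E₀ * E₁))) z) (*-zeroˡ (((1ℚ * D₀) * D₁) * inv (E₀ * E₁)))))

-- Absolute values and geometric sums

∣*∣≤ : ∀ {a b A B} → ∣ a ∣ ℚ.≤ A → ∣ b ∣ ℚ.≤ B → ∣ a * b ∣ ℚ.≤ A * B
∣*∣≤ {a} {b} {A} {B} p r = subst (ℚ._≤ A * B) (sym (∣p*q∣≡∣p∣*∣q∣ a b))
  (*-mono-≤-nonNeg (0≤∣p∣ a) (≤-trans (0≤∣p∣ b) r) p r)

∣+∣≤ : ∀ {a b A B} → ∣ a ∣ ℚ.≤ A → ∣ b ∣ ℚ.≤ B → ∣ a + b ∣ ℚ.≤ A + B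
∣+∣≤ {a} {b} p r = ≤-trans (∣p+q∣≤∣p∣+∣q∣ a b) (+-mono-≤ p r)

∣-∣-comm : ∀ a b → ∣ a - b ∣ ≡ ∣ b - a ∣
∣-∣-comm a b = trans (sym (∣-p∣≡∣p∣ (a - b))) (cong ∣_∣ (eq a b))
  where
  eq : ∀ a b → - (a - b) ≡ b - a
  eq = solve-∀ ringℚ

∣-∣-triangle : ∀ {a} b {c A B} → ∣ a - b ∣ ℚ.≤ A → ∣ b - c ∣ ℚ.≤ B → ∣ a - c ∣ ℚ.≤ A + B
∣-∣-triangle {a} b {c} {A} {B} p r = subst (λ t → ∣ t ∣ ℚ.≤ A + B) (eq a b c) (∣+∣≤ {a - b} p r)
  where
  eq : ∀ a b c → (a - b) + (b - c) ≡ a - c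
  eq = solve-∀ ringℚ

∣*-*∣≤ : ∀ {a a′ b b′ A B α β} → ∣ a ∣ ℚ.≤ A → ∣ b′ ∣ ℚ.≤ B → ∣ a - a′ ∣ ℚ.≤ α → ∣ b - b′ ∣ ℚ.≤ β →
  ∣ a * b - a′ * b′ ∣ ℚ.≤ A * β + α * B
∣*-*∣≤ {a} {a′} {b} {b′} {A} {B} {α} {β} p r s t = subst (λ t → ∣ t ∣ ℚ.≤ A * β + α * B) (eq a a′ b b′)
  (∣+∣≤ {a * (b - b′)} (∣*∣≤ {a} p t) (∣*∣≤ {a - a′} s r))
  where
  eq : ∀ a a′ b b′ → a * (b - b′) + (a - a′) * b′ ≡ a * b - a′ * b′
  eq = solve-∀ ringℚ

0≤½ : 0ℚ ℚ.≤ ½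
0≤½ = nonNegative⁻¹ ½

∑-geometric : ∀ k → ∑ k (½ ^ℚ_) ℚ.≤ ℕ→ℚ 2
∑-geometric k = ≤-via (ℕ→ℚ 2 * ½ ^ℚ k) (0≤* (0≤ℕ→ℚ 2) (0≤^ℚ k 0≤½)) (closed k)
  where
  closed : ∀ k → ∑ k (½ ^ℚ_) + ℕ→ℚ 2 * ½ ^ℚ k ≡ ℕ→ℚ 2
  closed zero    = refl
  closed (suc k) = trans (eq (∑ k (½ ^ℚ_)) (½ ^ℚ k)) (closed k)
    where
    eq : ∀ S x → (S + x) + ℕ→ℚ 2 * (½ * x) ≡ S + ℕ→ℚ 2 * x
    eq S x = trans (eq′ S x (ℕ→ℚ 2) ½) (cong (λ t → S + t * x) {1ℚ + ℕ→ℚ 2 * ½} {ℕ→ℚ 2} refl)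
      where
      eq′ : ∀ S x a b → (S + x) + a * (b * x) ≡ S + (1ℚ + a * b) * x
      eq′ = solve-∀ ringℚ

½≤1 : ½ ℚ.≤ 1ℚ
½≤1 = ≤-via ½ 0≤½ refl

∣1∣ : ∣ 1ℚ ∣ ℚ.≤ 1ℚ
∣1∣ = ≤-refl

^ℚ-≤1 : ∀ {x} n → 0ℚ ℚ.≤ x → x ℚ.≤ 1ℚ → x ^ℚ n ℚ.≤ 1ℚ
^ℚ-≤1 zero    _ _ = ≤-refl
^ℚ-≤1 (suc n) p r = *-mono-≤-nonNeg p 0≤1 r (^ℚ-≤1 n p r)

1≤^ℚ : ∀ {x} n → 1ℚ ℚ.≤ x → 1ℚ ℚ.≤ x ^ℚ n
1≤^ℚ zero    _ = ≤-refl
1≤^ℚ (suc n) p = *-mono-≤-nonNeg 0≤1 (≤-trans 0≤1 (1≤^ℚ n p)) p (1≤^ℚ n p)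

^ℚ-mono : ∀ {x y} n → 0ℚ ℚ.≤ x → x ℚ.≤ y → x ^ℚ n ℚ.≤ y ^ℚ n
^ℚ-mono zero    _ _ = ≤-refl
^ℚ-mono (suc n) p r = *-mono-≤-nonNeg p (0≤^ℚ n (≤-trans p r)) r (^ℚ-mono n p r)

1-∈[0,1] : ∀ {x} → 0ℚ ℚ.≤ x → x ℚ.≤ 1ℚ → 0ℚ ℚ.≤ 1ℚ - x × 1ℚ - x ℚ.≤ 1ℚ
1-∈[0,1] {x} p r = x≤y⇒0≤y-x r , ≤-via x p (eq x)
  where
  eq : ∀ x → (1ℚ - x) + x ≡ 1ℚ
  eq = solve-∀ ringℚ

∏-∈[0,1] : ∀ k {f} → (∀ i → i ℕ.< k → 0ℚ ℚ.≤ f i × f i ℚ.≤ 1ℚ) → 0ℚ ℚ.≤ ∏ k f × ∏ k f ℚ.≤ 1ℚ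
∏-∈[0,1] zero    h = 0≤1 , ≤-refl
∏-∈[0,1] (suc k) {f} h = 0≤* (proj₁ ih) (proj₁ (h k ℕP.≤-refl)) , *-mono-≤-nonNeg (proj₁ ih) 0≤1 (proj₂ ih) (proj₂ (h k ℕP.≤-refl))
  where
  ih : 0ℚ ℚ.≤ ∏ k f × ∏ k f ℚ.≤ 1ℚ
  ih = ∏-∈[0,1] k (λ i p → h i (ℕP.m<n⇒m<1+n p))

∣inv[1-t]∣≤ : ∀ {t p} → 1ℚ < t → 1ℚ ℚ.≤ (t - 1ℚ) * p → ∣ inv (1ℚ - t) ∣ ℚ.≤ p
∣inv[1-t]∣≤ {t} {p} 1<t h = subst (ℚ._≤ p) (sym (trans (cong ∣_∣ inv-neg) (trans (∣-p∣≡∣p∣ _) (0≤p⇒∣p∣≡p (0≤inv 0<t-1)))))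
  (inv-≤ 0<t-1 h)
  where
  0<t-1 : 0ℚ < t - 1ℚ
  0<t-1 = subst (_< t - 1ℚ) (+-inverseʳ 1ℚ) (+-monoˡ-< (- 1ℚ) 1<t)
  eq : ∀ t x → (1ℚ - t) * (- x) ≡ (t - 1ℚ) * x
  eq = solve-∀ ringℚ
  inv-neg : inv (1ℚ - t) ≡ - inv (t - 1ℚ)
  inv-neg = inv-unique (trans (eq t (inv (t - 1ℚ))) (*-invʳ (>0⇒≢0 0<t-1))) (λ e → <⇒≢ 1<t (x-y≡0⇒x≡y 1ℚ t e))

-- Bounds for a fixed base of at least 2

module Bounds (q : ℚ) (2≤q : ℕ→ℚ 2 ℚ.≤ q) where

  1≤q : 1ℚ ℚ.≤ q
  1≤q = ≤-trans (ℕ→ℚ-mono {1} {2} (s≤s z≤n)) 2≤q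

  0≤q : 0ℚ ℚ.≤ q
  0≤q = ≤-trans 0≤1 1≤q

  0<q : 0ℚ < q
  0<q = 1≤⇒0< 1≤q

  q≢0 : q ≢ 0ℚ
  q≢0 = >0⇒≢0 0<q

  q^≢0 : ∀ i → q ^ℚ i ≢ 0ℚ
  q^≢0 i = ^ℚ≢0 i q≢0

  open Theta q q^≢0

  q≤q^ : ∀ i → q ℚ.≤ q ^ℚ suc i
  q≤q^ i = subst (ℚ._≤ q ^ℚ suc i) (*-identityʳ q) (*-mono-≤ˡ 0≤q (1≤^ℚ i 1≤q))

  1<q^ : ∀ i → 1ℚ < q ^ℚ suc i
  1<q^ i = <-≤-trans (<-≤-trans (+-monoʳ-< 1ℚ 0<1) 2≤q) (q≤q^ i)

  x : ℚ
  x = inv q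

  0≤x : 0ℚ ℚ.≤ x
  0≤x = 0≤inv 0<q

  x≤½ : x ℚ.≤ ½
  x≤½ = inv-≤ 0<q (*-mono-≤ʳ 0≤½ 2≤q)

  x≤1 : x ℚ.≤ 1ℚ
  x≤1 = ≤-trans x≤½ ½≤1

  q^*x^ : ∀ d k → q ^ℚ d * inv (q ^ℚ (k ℕ.+ d)) ≡ x ^ℚ k
  q^*x^ d k = trans (cong (q ^ℚ d *_) (inv-q^ k d)) (trans (*-exchange (q ^ℚ d) (inv (q ^ℚ k)) (inv (q ^ℚ d)))
    (trans (cong (inv (q ^ℚ k) *_) (*-invʳ (q^≢0 d))) (trans (*-identityʳ _) (inv-^ k q≢0))))

  q^*inv∈[0,1] : ∀ {d n} → d ≤ n → 0ℚ ℚ.≤ q ^ℚ d * inv (q ^ℚ n) × q ^ℚ d * inv (q ^ℚ n) ℚ.≤ 1ℚ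
  q^*inv∈[0,1] {d} {n} d≤n = subst (λ k → 0ℚ ℚ.≤ q ^ℚ d * inv (q ^ℚ k) × q ^ℚ d * inv (q ^ℚ k) ℚ.≤ 1ℚ) (ℕP.m∸n+n≡m d≤n)
    (subst (λ t → 0ℚ ℚ.≤ t × t ℚ.≤ 1ℚ) (sym (q^*x^ d (n ℕ.∸ d))) (0≤^ℚ (n ℕ.∸ d) 0≤x , ^ℚ-≤1 (n ℕ.∸ d) 0≤x x≤1))

  θ∈[0,1] : ∀ n d → d ≤ n → 0ℚ ℚ.≤ θ q n d × θ q n d ℚ.≤ 1ℚ
  θ∈[0,1] n d d≤n = ∏-∈[0,1] d (λ i i<d → 1-∈[0,1] (proj₁ (p i i<d)) (proj₂ (p i i<d)))
    where
    p : ∀ i → i ℕ.< d → 0ℚ ℚ.≤ q ^ℚ i * inv (q ^ℚ n) × q ^ℚ i * inv (q ^ℚ n) ℚ.≤ 1ℚ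
    p i i<d = q^*inv∈[0,1] (ℕP.≤-trans (ℕP.<⇒≤ i<d) d≤n)

  φ∈[0,1] : ∀ n → 0ℚ ℚ.≤ φ q n × φ q n ℚ.≤ 1ℚ
  φ∈[0,1] n = subst (λ t → 0ℚ ℚ.≤ t × t ℚ.≤ 1ℚ) (θ≡φ n) (θ∈[0,1] n n ℕP.≤-refl)

  ∣φ∣≤1 : ∀ n → ∣ φ q n ∣ ℚ.≤ 1ℚ
  ∣φ∣≤1 n = nonNeg-∣∣≤ (proj₁ (φ∈[0,1] n)) (proj₂ (φ∈[0,1] n))

  -- A union bound: the failure probabilities q^i / q^n for i < d add up to at most q^d / q^n, since
  -- doubling costs no more than multiplying by q.
  1-θ≤ : ∀ n d → d ≤ n → 1ℚ - θ q n d ℚ.≤ q ^ℚ d * inv (q ^ℚ n)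
  1-θ≤ n zero    _   = proj₁ (q^*inv∈[0,1] {0} {n} z≤n)
  1-θ≤ n (suc d) d<n = begin
    1ℚ - t * (1ℚ - y)        ≡⟨ eq t y ⟩
    (1ℚ - t) + t * y         ≤⟨ +-mono-≤ (1-θ≤ n d d≤n) (*-mono-≤ʳ 0≤y (proj₂ (θ∈[0,1] n d d≤n))) ⟩
    y + 1ℚ * y               ≡⟨ eq′ y ⟩
    ℕ→ℚ 2 * y                ≤⟨ *-mono-≤ʳ 0≤y 2≤q ⟩
    q * y                    ≡⟨ sym (*-assoc q (q ^ℚ d) (inv (q ^ℚ n))) ⟩
    q ^ℚ suc d * inv (q ^ℚ n) ∎
    where
    open ≤-Reasoning
    d≤n = ℕP.<⇒≤ d<n
    t = θ q n d
    y = q ^ℚ d * inv (q ^ℚ n)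
    0≤y = proj₁ (q^*inv∈[0,1] d≤n)
    eq : ∀ t y → 1ℚ - t * (1ℚ - y) ≡ (1ℚ - t) + t * y
    eq = solve-∀ ringℚ
    eq′ : ∀ y → y + 1ℚ * y ≡ (1ℚ + 1ℚ) * y
    eq′ = solve-∀ ringℚ

  ∣coeff-step∣≤1 : ∀ i → ∣ inv (1ℚ - q ^ℚ suc i) ∣ ℚ.≤ 1ℚ
  ∣coeff-step∣≤1 i = ∣inv[1-t]∣≤ (1<q^ i) (subst (1ℚ ℚ.≤_) (sym (*-identityʳ _))
    (+-monoˡ-≤ (- 1ℚ) (≤-trans 2≤q (q≤q^ i))))

  ∣coeff-step∣≤¼ : ∀ i → ∣ inv (1ℚ - q ^ℚ suc (2 ℕ.+ i)) ∣ ℚ.≤ ½ * ½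
  ∣coeff-step∣≤¼ i = ∣inv[1-t]∣≤ (1<q^ (2 ℕ.+ i)) (≤-trans
    -- 1 + 3/4 = 7/4, where 7 = 2^3 - 1 is the least value of q^3 - 1.
    (≤-via (ℕ→ℚ 3 * (½ * ½)) (0≤* (0≤ℕ→ℚ 3) (0≤* 0≤½ 0≤½)) refl)
    (*-mono-≤ʳ {½ * ½} {ℕ→ℚ 7} (0≤* 0≤½ 0≤½) (+-monoˡ-≤ (- 1ℚ) 8≤)))
    where
    8≤ : ℕ→ℚ 2 ^ℚ 3 ℚ.≤ q ^ℚ suc (2 ℕ.+ i)
    8≤ = ≤-trans (^ℚ-mono 3 (0≤ℕ→ℚ 2) 2≤q) (subst₂ ℚ._≤_ (*-identityʳ (q ^ℚ 3)) (sym (^ℚ-+ q 3 i)) (*-mono-≤ˡ (0≤^ℚ 3 0≤q) (1≤^ℚ i 1≤q)))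

  -- The bound is 16 / 4^d. The first two factors are bounded by 1 only, which the first attains at
  -- q = 2, and 16 = 4^2 makes up for them; every later factor is at most 1/4.
  ∣coeff∣≤ : ∀ d → ∣ coeff q d ∣ ℚ.≤ ℕ→ℚ 16 * (½ ^ℚ d * ½ ^ℚ d)
  ∣coeff∣≤ zero = ℕ→ℚ-mono {1} {16} (s≤s z≤n)
  ∣coeff∣≤ (suc zero) = ≤-trans (∣*∣≤ {1ℚ} ∣1∣ (∣coeff-step∣≤1 0)) (ℕ→ℚ-mono {1} {4} (s≤s z≤n))
  ∣coeff∣≤ (suc (suc zero)) = ∣*∣≤ {coeff q 1} (∣*∣≤ {1ℚ} ∣1∣ (∣coeff-step∣≤1 0)) (∣coeff-step∣≤1 1)
  ∣coeff∣≤ (suc (suc (suc d))) = subst (∣ coeff q (3 ℕ.+ d) ∣ ℚ.≤_) (eq (ℕ→ℚ 16) (½ ^ℚ (2 ℕ.+ d)) ½)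
    (∣*∣≤ {coeff q (2 ℕ.+ d)} (∣coeff∣≤ (suc (suc d))) (∣coeff-step∣≤¼ d))
    where
    eq : ∀ c y a → (c * (y * y)) * (a * a) ≡ c * ((a * y) * (a * y))
    eq = solve-∀ ringℚ

  -- A convolution with coeff preserves the rate ½^m because coeff decays like ¼^d.
  ∑-coeff-bound : ∀ m (g : ℕ → ℚ) (b : ℚ) → 0ℚ ℚ.≤ b →
    (∀ d → d ≤ m → ½ ^ℚ d * ∣ g d ∣ ℚ.≤ b) →
    ∣ ∑ (suc m) (λ d → coeff q d * g d) ∣ ℚ.≤ ℕ→ℚ 32 * b
  ∑-coeff-bound m g b 0≤b h = begin
    ∣ ∑ (suc m) (λ d → coeff q d * g d) ∣
      ≤⟨ ∣∑∣≤ (suc m) (λ d d≤m → ≤-trans (∣*∣≤ {coeff q d} (∣coeff∣≤ d) ≤-refl) (≤-trans (≤-reflexive (eq (ℕ→ℚ 16) (½ ^ℚ d) ∣ g d ∣))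
           (*-mono-≤ˡ (0≤* (0≤ℕ→ℚ 16) (0≤^ℚ d 0≤½)) (h d (ℕP.≤-pred d≤m))))) ⟩
    ∑ (suc m) (λ d → (ℕ→ℚ 16 * ½ ^ℚ d) * b)
      ≡⟨ trans (sym (∑-*ʳ (suc m) b _)) (cong (_* b) (sym (∑-*ˡ (suc m) (ℕ→ℚ 16) _))) ⟩
    (ℕ→ℚ 16 * ∑ (suc m) (½ ^ℚ_)) * b
      ≤⟨ *-mono-≤ʳ 0≤b (*-mono-≤ˡ (0≤ℕ→ℚ 16) (∑-geometric (suc m))) ⟩
    ℕ→ℚ 32 * b ∎
    where
    open ≤-Reasoning
    eq : ∀ c y g → (c * (y * y)) * g ≡ (c * y) * (y * g)
    eq = solve-∀ ringℚ

  module _ (∑θ : ∀ m → ∑ (suc m) (λ d → coeff q d * θ q m (d ℕ.+ 0)) ≡ θ q m m) where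

    -- By `∑θ` the value φ is the same sum weighted with θ, so the difference is weighted with 1 -
    -- θ, which `1-θ≤` bounds by 2^(d - m).
    ∑-coeff-φ : ∀ m → ∣ ∑ (suc m) (coeff q) - φ q m ∣ ℚ.≤ ℕ→ℚ 32 * ½ ^ℚ m
    ∑-coeff-φ m = subst (λ t → ∣ t ∣ ℚ.≤ ℕ→ℚ 32 * ½ ^ℚ m) (sym difference) (∑-coeff-bound m (λ d → 1ℚ - θ q m d) (½ ^ℚ m) (0≤^ℚ m 0≤½) bound)
      where
      difference : ∑ (suc m) (coeff q) - φ q m ≡ ∑ (suc m) (λ d → coeff q d * (1ℚ - θ q m d))
      difference = trans (cong (λ t → ∑ (suc m) (coeff q) - t) (trans (sym (θ≡φ m)) (sym (∑θ m)))) (trans (eq (∑ (suc m) (coeff q)) _)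
        (trans (cong (∑ (suc m) (coeff q) +_) (∑-*ˡ (suc m) (- 1ℚ) (λ d → coeff q d * θ q m (d ℕ.+ 0)))) (trans (sym (∑-+-distrib (suc m) _ _))
          (∑-cong (suc m) (λ d _ → trans (eq′ (coeff q d) (θ q m (d ℕ.+ 0))) (cong (λ e → coeff q d * (1ℚ - θ q m e)) (ℕP.+-identityʳ d)))))))
        where
        eq : ∀ a b → a - b ≡ a + - 1ℚ * b
        eq = solve-∀ ringℚ
        eq′ : ∀ c t → c + - 1ℚ * (c * t) ≡ c * (1ℚ - t)
        eq′ = solve-∀ ringℚ
      bound : ∀ d → d ≤ m → ½ ^ℚ d * ∣ 1ℚ - θ q m d ∣ ℚ.≤ ½ ^ℚ m
      bound d d≤m = begin
        ½ ^ℚ d * ∣ 1ℚ - θ q m d ∣          ≡⟨ cong (½ ^ℚ d *_) (0≤p⇒∣p∣≡p (x≤y⇒0≤y-x (proj₂ (θ∈[0,1] m d d≤m)))) ⟩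
        ½ ^ℚ d * (1ℚ - θ q m d)            ≤⟨ *-mono-≤ˡ (0≤^ℚ d 0≤½) (1-θ≤ m d d≤m) ⟩
        ½ ^ℚ d * (q ^ℚ d * inv (q ^ℚ m))   ≡⟨ cong (λ k → ½ ^ℚ d * (q ^ℚ d * inv (q ^ℚ k))) (sym (ℕP.m∸n+n≡m d≤m)) ⟩
        ½ ^ℚ d * (q ^ℚ d * inv (q ^ℚ (m ℕ.∸ d ℕ.+ d)))   ≡⟨ cong (½ ^ℚ d *_) (q^*x^ d (m ℕ.∸ d)) ⟩
        ½ ^ℚ d * x ^ℚ (m ℕ.∸ d)            ≤⟨ *-mono-≤ˡ (0≤^ℚ d 0≤½) (^ℚ-mono (m ℕ.∸ d) 0≤x x≤½) ⟩
        ½ ^ℚ d * ½ ^ℚ (m ℕ.∸ d)            ≡⟨ sym (^ℚ-+ ½ d (m ℕ.∸ d)) ⟩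
        ½ ^ℚ (d ℕ.+ (m ℕ.∸ d))             ≡⟨ cong (½ ^ℚ_) (ℕP.m+[n∸m]≡n d≤m) ⟩
        ½ ^ℚ m ∎
        where open ≤-Reasoning

    -- The term subtracted on the right makes the induction close: the next factor costs at most
    -- half of it.
    φ-decrease : ∀ m k → φ q m - φ q (k ℕ.+ m) ℚ.≤ ½ ^ℚ m - ½ ^ℚ (k ℕ.+ m)
    φ-decrease m zero    = ≤-reflexive (trans (+-inverseʳ (φ q m)) (sym (+-inverseʳ (½ ^ℚ m))))
    φ-decrease m (suc k) = begin
      a - f * (1ℚ - y)          ≡⟨ eq a f y ⟩
      (a - f) + f * y           ≤⟨ +-mono-≤ (φ-decrease m k) (≤-trans (*-mono-≤ʳ 0≤y (proj₂ (φ∈[0,1] (k ℕ.+ m)))) (≤-trans (≤-reflexive (*-identityˡ y)) y≤)) ⟩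
      (b - t) + ½ * t           ≡⟨ half b t ⟩
      b - ½ * t                 ∎
      where
      open ≤-Reasoning
      a = φ q m
      b = ½ ^ℚ m
      f = φ q (k ℕ.+ m)
      t = ½ ^ℚ (k ℕ.+ m)
      y = inv (q ^ℚ suc (k ℕ.+ m))
      y≡ : y ≡ x ^ℚ suc (k ℕ.+ m)
      y≡ = inv-^ (suc (k ℕ.+ m)) q≢0
      0≤y : 0ℚ ℚ.≤ y
      0≤y = subst (0ℚ ℚ.≤_) (sym y≡) (0≤^ℚ (suc (k ℕ.+ m)) 0≤x)
      y≤ : y ℚ.≤ ½ ^ℚ suc (k ℕ.+ m)
      y≤ = subst (ℚ._≤ ½ ^ℚ suc (k ℕ.+ m)) (sym y≡) (^ℚ-mono (suc (k ℕ.+ m)) 0≤x x≤½)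
      eq : ∀ a f y → a - f * (1ℚ - y) ≡ (a - f) + f * y
      eq = solve-∀ ringℚ
      half : ∀ b t → (b - t) + ½ * t ≡ b - ½ * t
      half b t = trans (eq′ b t ½) (cong (λ c → b - c * t) {1ℚ - ½} {½} refl)
        where
        eq′ : ∀ b t c → (b - t) + c * t ≡ b - (1ℚ - c) * t
        eq′ = solve-∀ ringℚ

    φ-antitone : ∀ m k → φ q (k ℕ.+ m) ℚ.≤ φ q m
    φ-antitone m zero    = ≤-refl
    φ-antitone m (suc k) = ≤-trans (subst (φ q (suc k ℕ.+ m) ℚ.≤_) (*-identityʳ _) (*-mono-≤ˡ (proj₁ (φ∈[0,1] (k ℕ.+ m)))
      (≤-via y 0≤y (eq y)))) (φ-antitone m k)
      where
      y = inv (q ^ℚ suc (k ℕ.+ m))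
      0≤y : 0ℚ ℚ.≤ y
      0≤y = 0≤inv (1≤⇒0< (1≤^ℚ (suc (k ℕ.+ m)) 1≤q))
      eq : ∀ y → (1ℚ - y) + y ≡ 1ℚ
      eq = solve-∀ ringℚ

    φ-close : ∀ m M → m ≤ M → ∣ φ q m - φ q M ∣ ℚ.≤ ½ ^ℚ m
    φ-close m M m≤M = subst (λ k → ∣ φ q m - φ q k ∣ ℚ.≤ ½ ^ℚ m) (ℕP.m∸n+n≡m m≤M)
      (nonNeg-∣∣≤ (x≤y⇒0≤y-x (φ-antitone m k)) (≤-trans (φ-decrease m k)
        (≤-via (½ ^ℚ (k ℕ.+ m)) (0≤^ℚ (k ℕ.+ m) 0≤½) (eq (½ ^ℚ m) (½ ^ℚ (k ℕ.+ m))))))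
      where
      k = M ℕ.∸ m
      eq : ∀ a b → (a - b) + b ≡ a
      eq = solve-∀ ringℚ

    -- The limit in the dimension compares an expression at `m` with one at an unrelated `M`, so
    -- errors are measured by both.
    err : ℕ → ℕ → ℚ
    err m M = ½ ^ℚ m + ½ ^ℚ M

    0≤err : ∀ m M → 0ℚ ℚ.≤ err m M
    0≤err m M = 0≤+ (0≤^ℚ m 0≤½) (0≤^ℚ M 0≤½)

    ½^≤errˡ : ∀ m M → ½ ^ℚ m ℚ.≤ err m M
    ½^≤errˡ m M = ≤-via (½ ^ℚ M) (0≤^ℚ M 0≤½) refl

    ∣φ-φ∣≤ : ∀ m M → ∣ φ q m - φ q M ∣ ℚ.≤ err m M
    ∣φ-φ∣≤ m M with ℕP.≤-total m M
    ... | inj₁ m≤M = ≤-trans (φ-close m M m≤M) (½^≤errˡ m M)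
    ... | inj₂ M≤m = subst (ℚ._≤ err m M) (∣-∣-comm (φ q M) (φ q m)) (≤-trans (φ-close M m M≤m)
                       (≤-via (½ ^ℚ m) (0≤^ℚ m 0≤½) (+-comm (½ ^ℚ M) (½ ^ℚ m))))

    -- The factor 32 is the constant of `∑-coeff-bound`; 33 adds to the 32 of `∑-coeff-φ` one for
    -- passing from φ at `m` to φ at `M`. The growth in j is harmless, as j = q - 1 is fixed in this
    -- limit.
    rate : ℕ → ℚ
    rate zero    = 0ℚ
    rate (suc j) = ℕ→ℚ 32 * rate j + ℕ→ℚ 33

    0≤rate : ∀ j → 0ℚ ℚ.≤ rate j
    0≤rate zero    = ≤-refl
    0≤rate (suc j) = 0≤+ (0≤* (0≤ℕ→ℚ 32) (0≤rate j)) (0≤ℕ→ℚ 33)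

    H-close : ∀ M j m → ∣ H q j m - φ q M ^ℚ j ∣ ℚ.≤ rate j * err m M
    H-close M zero    m = ≤-reflexive (sym (*-zeroˡ (err m M)))
    H-close M (suc j) m = subst (λ t → ∣ t ∣ ℚ.≤ rate (suc j) * err m M) (sym split)
      (≤-trans (∣+∣≤ {∑ (suc m) (λ d → coeff q d * (H q j (m ℕ.∸ d) - F))} first second) (≤-reflexive (eq (rate j) (err m M))))
      where
      F = φ q M ^ℚ j
      eq : ∀ r e → ℕ→ℚ 32 * (r * e) + 1ℚ * (ℕ→ℚ 33 * e) ≡ (ℕ→ℚ 32 * r + ℕ→ℚ 33) * e
      eq r e = eq′ (ℕ→ℚ 32) (ℕ→ℚ 33) r e
        where
        eq′ : ∀ a b r e → a * (r * e) + 1ℚ * (b * e) ≡ (a * r + b) * e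
        eq′ = solve-∀ ringℚ
      -- The target `F` of `H q j` is subtracted inside the convolution, which leaves `F` times the
      -- error of the coefficient sum.
      split : H q (suc j) m - φ q M * F ≡
        ∑ (suc m) (λ d → coeff q d * (H q j (m ℕ.∸ d) - F)) + F * (∑ (suc m) (coeff q) - φ q M)
      split = trans (cong (_- φ q M * F) (trans (∑-cong (suc m) (λ d _ → eq₁ (coeff q d) (H q j (m ℕ.∸ d)) F))
          (trans (∑-+-distrib (suc m) _ _) (cong (∑ (suc m) (λ d → coeff q d * (H q j (m ℕ.∸ d) - F)) +_) (sym (∑-*ʳ (suc m) F (coeff q)))))))
        (eq₂ (∑ (suc m) (λ d → coeff q d * (H q j (m ℕ.∸ d) - F))) (∑ (suc m) (coeff q)) F (φ q M))
        where
        eq₁ : ∀ a h f → a * h ≡ a * (h - f) + a * f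
        eq₁ = solve-∀ ringℚ
        eq₂ : ∀ s t f p → (s + t * f) - p * f ≡ s + f * (t - p)
        eq₂ = solve-∀ ringℚ
      first : ∣ ∑ (suc m) (λ d → coeff q d * (H q j (m ℕ.∸ d) - F)) ∣ ℚ.≤ ℕ→ℚ 32 * (rate j * err m M)
      first = ∑-coeff-bound m (λ d → H q j (m ℕ.∸ d) - F) (rate j * err m M) (0≤* (0≤rate j) (0≤err m M)) (λ d d≤m → begin
        ½ ^ℚ d * ∣ H q j (m ℕ.∸ d) - F ∣        ≤⟨ *-mono-≤ˡ (0≤^ℚ d 0≤½) (H-close M j (m ℕ.∸ d)) ⟩
        ½ ^ℚ d * (rate j * err (m ℕ.∸ d) M)     ≡⟨ eq₃ (½ ^ℚ d) (rate j) (½ ^ℚ (m ℕ.∸ d)) (½ ^ℚ M) ⟩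
        rate j * (½ ^ℚ d * ½ ^ℚ (m ℕ.∸ d) + ½ ^ℚ d * ½ ^ℚ M)
          ≤⟨ *-mono-≤ˡ (0≤rate j) (+-mono-≤ (≤-reflexive (trans (sym (^ℚ-+ ½ d (m ℕ.∸ d))) (cong (½ ^ℚ_) (ℕP.m+[n∸m]≡n d≤m))))
               (≤-trans (*-mono-≤ʳ (0≤^ℚ M 0≤½) (^ℚ-≤1 d 0≤½ ½≤1)) (≤-reflexive (*-identityˡ (½ ^ℚ M))))) ⟩
        rate j * err m M ∎)
        where
        open ≤-Reasoning
        eq₃ : ∀ d r a b → d * (r * (a + b)) ≡ r * (d * a + d * b)
        eq₃ = solve-∀ ringℚ
      ∣F∣≤1 : ∣ F ∣ ℚ.≤ 1ℚ
      ∣F∣≤1 = nonNeg-∣∣≤ (0≤^ℚ j (proj₁ (φ∈[0,1] M))) (^ℚ-≤1 j (proj₁ (φ∈[0,1] M)) (proj₂ (φ∈[0,1] M)))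
      second : ∣ F * (∑ (suc m) (coeff q) - φ q M) ∣ ℚ.≤ 1ℚ * (ℕ→ℚ 33 * err m M)
      second = ∣*∣≤ {F} ∣F∣≤1 (≤-trans (∣-∣-triangle {∑ (suc m) (coeff q)} (φ q m) (∑-coeff-φ m) (∣φ-φ∣≤ m M))
        (≤-trans (+-monoˡ-≤ (err m M) (*-mono-≤ˡ (0≤ℕ→ℚ 32) (½^≤errˡ m M))) (≤-reflexive (eq₄ (err m M)))))
        where
        eq₄ : ∀ e → ℕ→ℚ 32 * e + e ≡ ℕ→ℚ 33 * e
        eq₄ e = trans (eq₅ (ℕ→ℚ 32) e) (cong (_* e) {ℕ→ℚ 32 + 1ℚ} {ℕ→ℚ 33} refl)
          where
          eq₅ : ∀ a e → a * e + e ≡ (a + 1ℚ) * e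
          eq₅ = solve-∀ ringℚ

-- Archimedean bounds and the normalising factor

p≤∣↥p∣ : ∀ r → r ℚ.≤ ℕ→ℚ (ℤ.∣ ↥ r ∣)
p≤∣↥p∣ r@(ℚ.mkℚ _ _ _) = toℚᵘ-cancel-≤ (ℚᵘP.≤-trans (ℚᵘ.*≤* {toℚᵘ r} {ℚᵘ.mkℚᵘ (ℤ.+ k) 0} bound)
  (ℚᵘP.≤-reflexive (ℚᵘP.≃-sym (toℚᵘ-fromℚᵘ (ℚᵘ.mkℚᵘ (ℤ.+ k) 0)))))
  where
  k = ℤ.∣ ↥ r ∣
  i≤∣i∣ : ∀ i → i ℤ.≤ ℤ.+ ℤ.∣ i ∣
  i≤∣i∣ (ℤ.+ n)      = ℤP.≤-refl
  i≤∣i∣ (ℤ.-[1+ n ]) = ℤ.-≤+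
  bound : ↥ r ℤ.* ℤ.+ 1 ℤ.≤ ℤ.+ k ℤ.* ↧ r
  bound = ℤP.≤-trans (ℤP.≤-reflexive (ℤP.*-identityʳ (↥ r))) (ℤP.≤-trans (i≤∣i∣ (↥ r))
    (ℤP.≤-trans (ℤP.≤-reflexive (sym (ℤP.*-identityʳ (ℤ.+ k))))
      (ℤP.*-monoˡ-≤-nonNeg (ℤ.+ k) (ℤ.+≤+ (s≤s z≤n)))))

archimedean : ∀ K ε → 0ℚ < ε → ∃ λ N → ∀ t → 0ℚ < t → ℕ→ℚ N ℚ.≤ t → K * inv t < ε
archimedean K ε 0<ε = N , λ t 0<t N≤t → *-cancelʳ-<-nonNeg t {{ℚ.nonNegative (<⇒≤ 0<t)}} (begin-strict
    (K * inv t) * t   ≡⟨ trans (*-assoc K (inv t) t) (trans (cong (K *_) (*-invˡ (>0⇒≢0 0<t))) (*-identityʳ K)) ⟩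
    K                 ≡⟨ sym (trans (*-comm ε r) (trans (*-assoc K (inv ε) ε) (trans (cong (K *_) (*-invˡ (>0⇒≢0 0<ε))) (*-identityʳ K)))) ⟩
    ε * r             <⟨ *-monoʳ-<-pos ε {{ℚ.positive 0<ε}} r<N ⟩
    ε * ℕ→ℚ N         ≤⟨ *-mono-≤ˡ (<⇒≤ 0<ε) N≤t ⟩
    ε * t             ∎)
  where
  open ≤-Reasoning
  r = K * inv ε
  N = suc (ℤ.∣ ↥ r ∣)
  r<N : r < ℕ→ℚ N
  r<N = ≤-<-trans (p≤∣↥p∣ r) (subst₂ _<_ (+-identityˡ _) (sym (ℕ→ℚ-suc (ℤ.∣ ↥ r ∣))) (+-monoˡ-< (ℕ→ℚ (ℤ.∣ ↥ r ∣)) 0<1))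

n≤2^n : ∀ n → n ≤ 2 ℕ.^ n
n≤2^n zero    = z≤n
n≤2^n (suc n) = ℕP.≤-trans (ℕP.+-mono-≤ {1} (ℕP.m^n>0 2 n) (n≤2^n n)) (ℕP.+-monoʳ-≤ (2 ℕ.^ n) (ℕP.m≤m+n (2 ℕ.^ n) 0))

½^≡ : ∀ n → ½ ^ℚ n ≡ inv (ℕ→ℚ (2 ℕ.^ n))
½^≡ n = sym (trans (cong inv (ℕ→ℚ-^ 2 n)) (trans (inv-^ n 2≢0) (cong (_^ℚ n) (inv-unique {ℕ→ℚ 2} {½} refl 2≢0))))
  where
  2≢0 : ℕ→ℚ 2 ≢ 0ℚ
  2≢0 ()

½^-archimedean : ∀ K ε → 0ℚ < ε → ∃ λ N → ∀ m → N ≤ m → K * ½ ^ℚ m < ε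
½^-archimedean K ε 0<ε = proj₁ a , λ m N≤m → subst (λ t → K * t < ε) (sym (½^≡ m))
  (proj₂ a (ℕ→ℚ (2 ℕ.^ m)) (1≤⇒0< (ℕ→ℚ-mono (ℕP.m^n>0 2 m))) (ℕ→ℚ-mono (ℕP.≤-trans N≤m (n≤2^n m))))
  where
  a = archimedean K ε 0<ε

-- Used with y = q^(n²) and W = q^n. The numerator y² - E = q (y - 1) + y is at most 2 q y ≤ q² y ≤
-- y² / W, and y² ≤ 4 E because y ≥ 2 and y ≥ 2 q. The form `q * 1ℚ` is how `q ^ℚ 1` unfolds.
ρ-close : ∀ q y W → ℕ→ℚ 2 ℚ.≤ q → 1ℚ ℚ.≤ W → W * (q * q) ℚ.≤ y →
  ∣ (y * y) * inv ((y - 1ℚ) * (y - q * 1ℚ)) - 1ℚ ∣ ℚ.≤ ℕ→ℚ 4 * inv W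
ρ-close q y W 2≤q 1≤W Wqq≤y = subst (λ t → ∣ t ∣ ℚ.≤ ℕ→ℚ 4 * inv W) (sym difference)
  (nonNeg-∣∣≤ (0≤* 0≤num (0≤inv 0<E)) (begin
    (y * y - E) * inv E              ≤⟨ *-mono-≤ʳ (0≤inv 0<E) num≤ ⟩
    ((ℕ→ℚ 4 * inv W) * E) * inv E    ≡⟨ trans (*-assoc (ℕ→ℚ 4 * inv W) E (inv E)) (trans (cong (ℕ→ℚ 4 * inv W *_) (*-invʳ (>0⇒≢0 0<E))) (*-identityʳ _)) ⟩
    ℕ→ℚ 4 * inv W                    ∎))
  where
  open ≤-Reasoning
  E = (y - 1ℚ) * (y - q * 1ℚ)
  0≤q : 0ℚ ℚ.≤ q
  0≤q = ≤-trans (0≤ℕ→ℚ 2) 2≤q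
  0≤2 = 0≤ℕ→ℚ 2
  0<W : 0ℚ < W
  0<W = 1≤⇒0< 1≤W
  qq≤y : q * q ℚ.≤ y
  qq≤y = ≤-trans (subst (ℚ._≤ W * (q * q)) (*-identityˡ (q * q)) (*-mono-≤ʳ (0≤* 0≤q 0≤q) 1≤W)) Wqq≤y
  2q≤y : ℕ→ℚ 2 * q ℚ.≤ y
  2q≤y = ≤-trans (*-mono-≤ʳ 0≤q 2≤q) qq≤y
  1≤q : 1ℚ ℚ.≤ q
  1≤q = ≤-trans (ℕ→ℚ-mono {1} {2} (s≤s z≤n)) 2≤q
  2≤y : ℕ→ℚ 2 ℚ.≤ y
  2≤y = ≤-trans (subst (ℚ._≤ ℕ→ℚ 2 * q) (*-identityʳ (ℕ→ℚ 2)) (*-mono-≤ˡ 0≤2 1≤q)) 2q≤y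
  0≤y : 0ℚ ℚ.≤ y
  0≤y = ≤-trans 0≤2 2≤y
  double : ∀ {c} → ℕ→ℚ 2 * c ℚ.≤ y → y ℚ.≤ ℕ→ℚ 2 * (y - c)
  double {c} h = ≤-via (y - ℕ→ℚ 2 * c) (x≤y⇒0≤y-x h) (eq y c)
    where
    eq : ∀ y c → y + (y - (1ℚ + 1ℚ) * c) ≡ (1ℚ + 1ℚ) * (y - c)
    eq = solve-∀ ringℚ
  y≤₁ : y ℚ.≤ ℕ→ℚ 2 * (y - 1ℚ)
  y≤₁ = double {1ℚ} (subst (ℚ._≤ y) (sym (*-identityʳ (ℕ→ℚ 2))) 2≤y)
  y≤₂ : y ℚ.≤ ℕ→ℚ 2 * (y - q * 1ℚ)
  y≤₂ = double {q * 1ℚ} (subst (λ t → ℕ→ℚ 2 * t ℚ.≤ y) (sym (*-identityʳ q)) 2q≤y)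
  yy≤4E : y * y ℚ.≤ ℕ→ℚ 4 * E
  yy≤4E = ≤-trans (*-mono-≤-nonNeg 0≤y (≤-trans 0≤y y≤₂) y≤₁ y≤₂) (≤-reflexive (eq (ℕ→ℚ 2) (y - 1ℚ) (y - q * 1ℚ)))
    where
    eq : ∀ t a b → (t * a) * (t * b) ≡ (t * t) * (a * b)
    eq = solve-∀ ringℚ
  0<E : 0ℚ < E
  0<E = *-cancelˡ-<-nonNeg (ℕ→ℚ 4) (subst (_< ℕ→ℚ 4 * E) (sym (*-zeroʳ (ℕ→ℚ 4))) (<-≤-trans
    (<-≤-trans (positive⁻¹ (ℕ→ℚ 4)) (*-mono-≤-nonNeg 0≤2 0≤y 2≤y 2≤y)) yy≤4E))
  difference : (y * y) * inv E - 1ℚ ≡ (y * y - E) * inv E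
  difference = sym (trans (eq (y * y) E (inv E)) (cong (λ t → (y * y) * inv E - t) (*-invʳ (>0⇒≢0 0<E))))
    where
    eq : ∀ a e i → (a - e) * i ≡ a * i - e * i
    eq = solve-∀ ringℚ
  0≤num : 0ℚ ℚ.≤ y * y - E
  0≤num = subst (0ℚ ℚ.≤_) (sym (eq y q)) (0≤+ (0≤* 0≤q (x≤y⇒0≤y-x (≤-trans (ℕ→ℚ-mono {1} {2} (s≤s z≤n)) 2≤y))) 0≤y)
    where
    eq : ∀ y q → y * y - (y - 1ℚ) * (y - q * 1ℚ) ≡ q * (y - 1ℚ) + y
    eq = solve-∀ ringℚ
  num≤ : y * y - E ℚ.≤ (ℕ→ℚ 4 * inv W) * E
  num≤ = begin
    y * y - E                        ≤⟨ ≤-via (q + (q - 1ℚ) * y) (0≤+ 0≤q (0≤* (x≤y⇒0≤y-x 1≤q) 0≤y)) (eq y q) ⟩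
    ((1ℚ + 1ℚ) * q) * y              ≤⟨ *-mono-≤ʳ 0≤y (*-mono-≤ʳ 0≤q 2≤q) ⟩
    (q * q) * y                      ≡⟨ sym (trans (cong (_* ((q * q) * y)) (*-invˡ (>0⇒≢0 0<W))) (*-identityˡ _)) ⟩
    (inv W * W) * ((q * q) * y)      ≡⟨ eq′ (inv W) W (q * q) y ⟩
    inv W * ((W * (q * q)) * y)      ≤⟨ *-mono-≤ˡ (0≤inv 0<W) (*-mono-≤ʳ 0≤y Wqq≤y) ⟩
    inv W * (y * y)                  ≤⟨ *-mono-≤ˡ (0≤inv 0<W) yy≤4E ⟩
    inv W * (ℕ→ℚ 4 * E)              ≡⟨ trans (sym (*-assoc (inv W) (ℕ→ℚ 4) E)) (cong (_* E) (*-comm (inv W) (ℕ→ℚ 4))) ⟩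
    (ℕ→ℚ 4 * inv W) * E              ∎
    where
    eq : ∀ y q → (y * y - (y - 1ℚ) * (y - q * 1ℚ)) + (q + (q - 1ℚ) * y) ≡ ((1ℚ + 1ℚ) * q) * y
    eq = solve-∀ ringℚ
    eq′ : ∀ i w a y → (i * w) * (a * y) ≡ i * ((w * a) * y)
    eq′ = solve-∀ ringℚ

-- Comparison with (1 - u / (q - 1))^(q - 1)

falling : ℕ → ℕ → ℚ
falling j i = ∏ i (λ l → ℕ→ℚ j - ℕ→ℚ l)

-- The i-th coefficient of (1 - h u)^j.
γ : ℚ → ℕ → ℕ → ℚ
γ h j i = (- h) ^ℚ i * (falling j i * inv (ℕ→ℚ (i !)))

η : ℚ → ℕ → ℕ → ℚ
η h j m = ∑ (suc m) (γ h j)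

ℕ→ℚ-suc≢0 : ∀ n → ℕ→ℚ (suc n) ≢ 0ℚ
ℕ→ℚ-suc≢0 n = >0⇒≢0 (1≤⇒0< (ℕ→ℚ-mono {1} {suc n} (s≤s z≤n)))

ℕ→ℚ-!≢0 : ∀ n → ℕ→ℚ (n !) ≢ 0ℚ
ℕ→ℚ-!≢0 n = >0⇒≢0 (1≤⇒0< (ℕ→ℚ-mono (ℕP.1≤n! n)))

γ-zero : ∀ h j → γ h j 0 ≡ 1ℚ
γ-zero h j = trans (cong (λ t → 1ℚ * (1ℚ * t)) inv-1) refl

γ-0-suc : ∀ h i → γ h 0 (suc i) ≡ 0ℚ
γ-0-suc h i = trans (cong (λ t → (- h) ^ℚ suc i * (t * inv (ℕ→ℚ (suc i !)))) (∏-zero (suc i) 0 (s≤s z≤n) refl))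
  (eq ((- h) ^ℚ suc i) (inv (ℕ→ℚ (suc i !))))
  where
  eq : ∀ a b → a * (0ℚ * b) ≡ 0ℚ
  eq = solve-∀ ringℚ

γ-pascal : ∀ h j i → γ h (suc j) (suc i) ≡ γ h j (suc i) - h * γ h j i
γ-pascal h j i = begin
  (- h * p) * (falling (suc j) (suc i) * inv (ℕ→ℚ (suc i !)))
    ≡⟨ cong₂ (λ a b → (- h * p) * (a * b)) falling-suc inv-! ⟩
  (- h * p) * (((1ℚ + J) * F) * (u * v))
    ≡⟨ eq h p J I F u v ⟩
  ((- h * p) * ((F * (J - I)) * (u * v)) - h * (p * (F * v)) * ((1ℚ + I) * u))
    ≡⟨ cong (λ t → (- h * p) * ((F * (J - I)) * (u * v)) - h * (p * (F * v)) * t) cancel ⟩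
  ((- h * p) * ((F * (J - I)) * (u * v)) - h * (p * (F * v)) * 1ℚ)
    ≡⟨ cong₂ (λ a b → (- h * p) * ((F * (J - I)) * a) - b) (sym inv-!) (*-identityʳ _) ⟩
  γ h j (suc i) - h * γ h j i ∎
  where
  open ≡-Reasoning
  p = (- h) ^ℚ i
  J = ℕ→ℚ j
  I = ℕ→ℚ i
  F = falling j i
  u = inv (ℕ→ℚ (suc i))
  v = inv (ℕ→ℚ (i !))
  inv-! : inv (ℕ→ℚ (suc i !)) ≡ u * v
  inv-! = trans (cong inv (ℕ→ℚ-* (suc i) (i !))) (inv-* (ℕ→ℚ-suc≢0 i) (ℕ→ℚ-!≢0 i))
  cancel : (1ℚ + I) * u ≡ 1ℚ
  cancel = trans (cong (_* u) (sym (ℕ→ℚ-suc i))) (*-invʳ (ℕ→ℚ-suc≢0 i))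
  falling-suc : falling (suc j) (suc i) ≡ (1ℚ + J) * F
  falling-suc = trans (∏-shift i (λ l → ℕ→ℚ (suc j) - ℕ→ℚ l)) (cong₂ _*_
    (trans (+-identityʳ (ℕ→ℚ (suc j))) (ℕ→ℚ-suc j))
    (∏-cong i (λ l _ → trans (cong₂ _-_ (ℕ→ℚ-suc j) (ℕ→ℚ-suc l)) (eq′ J (ℕ→ℚ l)))))
    where
    eq′ : ∀ a b → (1ℚ + a) - (1ℚ + b) ≡ a - b
    eq′ = solve-∀ ringℚ
  eq : ∀ h p J I F u v → (- h * p) * (((1ℚ + J) * F) * (u * v)) ≡
    (- h * p) * ((F * (J - I)) * (u * v)) - h * (p * (F * v)) * ((1ℚ + I) * u)
  eq = solve-∀ ringℚ

-- Multiplication by 1 - h u. This is the recursion of `H` with only the coefficients 1 and - h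
-- kept, so the two can be compared by induction on `j`.
η-suc : ∀ h j m → η h (suc j) (suc m) ≡ η h j (suc m) - h * η h j m
η-suc h j m = begin
  η h (suc j) (suc m)
    ≡⟨ ∑-shift (suc m) (γ h (suc j)) ⟩
  γ h (suc j) 0 + ∑ (suc m) (λ i → γ h (suc j) (suc i))
    ≡⟨ cong₂ _+_ (trans (γ-zero h (suc j)) (sym (γ-zero h j))) (trans (∑-cong (suc m) (λ i _ → trans (γ-pascal h j i) (eq (γ h j (suc i)) h (γ h j i))))
         (trans (∑-+-distrib (suc m) (λ i → γ h j (suc i)) (λ i → - h * γ h j i)) (cong (∑ (suc m) (λ i → γ h j (suc i)) +_) (sym (∑-*ˡ (suc m) (- h) (γ h j)))))) ⟩
  γ h j 0 + (∑ (suc m) (λ i → γ h j (suc i)) + - h * η h j m)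
    ≡⟨ eq′ (γ h j 0) (∑ (suc m) (λ i → γ h j (suc i))) h (η h j m) ⟩
  (γ h j 0 + ∑ (suc m) (λ i → γ h j (suc i))) - h * η h j m
    ≡⟨ cong (_- h * η h j m) (sym (∑-shift (suc m) (γ h j))) ⟩
  η h j (suc m) - h * η h j m ∎
  where
  open ≡-Reasoning
  eq : ∀ a h b → a - h * b ≡ a + - h * b
  eq = solve-∀ ringℚ
  eq′ : ∀ a b h c → a + (b + - h * c) ≡ (a + b) - h * c
  eq′ = solve-∀ ringℚ

η-at-0 : ∀ h j → η h j 0 ≡ 1ℚ
η-at-0 h j = trans (+-identityˡ _) (γ-zero h j)

η-0 : ∀ h m → η h 0 m ≡ 1ℚ
η-0 h m = trans (∑-shift m (γ h 0)) (trans (cong₂ _+_ (γ-zero h 0) (∑-zero m (λ i _ → γ-0-suc h i))) (+-identityʳ 1ℚ))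

2^ : ℕ → ℚ
2^ m = ℕ→ℚ 2 ^ℚ m

0≤2^ : ∀ m → 0ℚ ℚ.≤ 2^ m
0≤2^ m = 0≤^ℚ m (0≤ℕ→ℚ 2)

∑-2^ : ∀ m → ∑ m (λ i → 2^ (m ℕ.∸ suc i)) ≡ 2^ m - 1ℚ
∑-2^ zero    = refl
∑-2^ (suc m) = trans (∑-shift m (λ i → 2^ (m ℕ.∸ i))) (trans (cong (2^ m +_) (∑-2^ m)) (eq (2^ m)))
  where
  eq : ∀ a → a + (a - 1ℚ) ≡ (1ℚ + 1ℚ) * a - 1ℚ
  eq = solve-∀ ringℚ

-- The errors of `density-close`: 4 · 2^n for the normalising factor, n 2^n for each of two φ
-- replaced by 1, 2^(n+1) for `H` replaced by η, and (n + 1) n² for η replaced by the derangement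
-- sum.
constant : ℕ → ℚ
constant n = 2^ n * ℕ→ℚ 4 + (((ℕ→ℚ n * 2^ n + ℕ→ℚ n * 2^ n) + 2^ (suc n)) + ℕ→ℚ (suc n) * (ℕ→ℚ n * ℕ→ℚ n))

module FieldBounds (q : ℚ) (2≤q : ℕ→ℚ 2 ℚ.≤ q) (J : ℕ) (q-1≡J : q - 1ℚ ≡ ℕ→ℚ J) where
  open Bounds q 2≤q

  1≤q-1 : 1ℚ ℚ.≤ q - 1ℚ
  1≤q-1 = +-monoˡ-≤ (- 1ℚ) 2≤q

  -- With `h` = 1 / (q - 1) the number `J` of factors satisfies J h = 1 exactly, and - h is exactly
  -- the linear coefficient of the series. Only the coefficients from u² on, each at most h²,
  -- separate it from 1 - h u.
  h : ℚ
  h = inv (q - 1ℚ)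

  0≤h : 0ℚ ℚ.≤ h
  0≤h = 0≤inv (1≤⇒0< 1≤q-1)

  q-1*h : (q - 1ℚ) * h ≡ 1ℚ
  q-1*h = *-invʳ (>0⇒≢0 (1≤⇒0< 1≤q-1))

  J*h : ℕ→ℚ J * h ≡ 1ℚ
  J*h = trans (cong (_* h) (sym q-1≡J)) q-1*h

  ∣coeff-step∣≤h : ∀ i → ∣ inv (1ℚ - q ^ℚ suc i) ∣ ℚ.≤ h
  ∣coeff-step∣≤h i = ∣inv[1-t]∣≤ (1<q^ i) (subst (ℚ._≤ (q ^ℚ suc i - 1ℚ) * h) q-1*h
    (*-mono-≤ʳ 0≤h (+-monoˡ-≤ (- 1ℚ) (q≤q^ i))))

  ∣coeff∣≤1 : ∀ d → ∣ coeff q d ∣ ℚ.≤ 1ℚ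
  ∣coeff∣≤1 zero    = ≤-refl
  ∣coeff∣≤1 (suc d) = ∣*∣≤ {coeff q d} (∣coeff∣≤1 d) (∣coeff-step∣≤1 d)

  ∣coeff∣≤h : ∀ d → ∣ coeff q (suc d) ∣ ℚ.≤ h
  ∣coeff∣≤h d = subst (∣ coeff q (suc d) ∣ ℚ.≤_) (*-identityˡ h) (∣*∣≤ {coeff q d} (∣coeff∣≤1 d) (∣coeff-step∣≤h d))

  ∣coeff∣≤h² : ∀ d → ∣ coeff q (suc (suc d)) ∣ ℚ.≤ h * h
  ∣coeff∣≤h² d = ∣*∣≤ {coeff q (suc d)} (∣coeff∣≤h d) (∣coeff-step∣≤h (suc d))

  coeff-1 : coeff q 1 ≡ - h
  coeff-1 = trans (*-identityˡ (inv (1ℚ - q * 1ℚ))) (inv-unique (trans (eq q h) q-1*h) (λ e → <⇒≢ (1<q^ 0) (x-y≡0⇒x≡y 1ℚ (q ^ℚ 1) e)))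
    where
    eq : ∀ q h → (1ℚ - q * 1ℚ) * (- h) ≡ (q - 1ℚ) * h
    eq = solve-∀ ringℚ

  j*h≤ : ∀ j → ℕ→ℚ (suc j) * h ℚ.≤ 1ℚ → ℕ→ℚ j * h ℚ.≤ 1ℚ
  j*h≤ j p = ≤-trans (*-mono-≤ʳ 0≤h (ℕ→ℚ-mono (ℕP.n≤1+n j))) p

  suc*h : ∀ j → ℕ→ℚ (suc j) * h ≡ ℕ→ℚ j * h + h
  suc*h j = trans (cong (_* h) (ℕ→ℚ-suc j)) (eq (ℕ→ℚ j) h)
    where
    eq : ∀ a b → (1ℚ + a) * b ≡ a * b + b
    eq = solve-∀ ringℚ

  0≤2^-1 : ∀ m → 0ℚ ℚ.≤ 2^ m - 1ℚ
  0≤2^-1 m = x≤y⇒0≤y-x (1≤^ℚ m (ℕ→ℚ-mono {1} {2} (s≤s z≤n)))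

  -- A further factor adds only h (2^m - 1), the contribution of its nonconstant terms. As j h ≤ 1,
  -- the total stays below 2^m for all such `j`, so the estimate does not depend on q.
  ∣H∣≤ : ∀ j m → ℕ→ℚ j * h ℚ.≤ 1ℚ → ∣ H q j m ∣ ℚ.≤ 1ℚ + (ℕ→ℚ j * h) * (2^ m - 1ℚ)
  ∣H∣≤2^ : ∀ j m → ℕ→ℚ j * h ℚ.≤ 1ℚ → ∣ H q j m ∣ ℚ.≤ 2^ m

  ∣H∣≤ zero    m p = ≤-via ((0ℚ * h) * (2^ m - 1ℚ)) (≤-reflexive (sym (trans (cong (_* (2^ m - 1ℚ)) (*-zeroˡ h)) (*-zeroˡ (2^ m - 1ℚ))))) refl
  ∣H∣≤ (suc j) m p = begin
    ∣ H q (suc j) m ∣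
      ≡⟨ cong ∣_∣ (∑-shift m (λ d → coeff q d * H q j (m ℕ.∸ d))) ⟩
    ∣ 1ℚ * H q j m + ∑ m (λ i → coeff q (suc i) * H q j (m ℕ.∸ suc i)) ∣
      ≤⟨ ∣+∣≤ {1ℚ * H q j m} (∣*∣≤ {1ℚ} ∣1∣ (∣H∣≤ j m p′)) (∣∑∣≤ m (λ i _ → ∣*∣≤ {coeff q (suc i)} (∣coeff∣≤h i) (∣H∣≤2^ j (m ℕ.∸ suc i) p′))) ⟩
    1ℚ * (1ℚ + (ℕ→ℚ j * h) * (2^ m - 1ℚ)) + ∑ m (λ i → h * 2^ (m ℕ.∸ suc i))
      ≡⟨ cong (1ℚ * (1ℚ + (ℕ→ℚ j * h) * (2^ m - 1ℚ)) +_) (trans (sym (∑-*ˡ m h _)) (cong (h *_) (∑-2^ m))) ⟩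
    1ℚ * (1ℚ + (ℕ→ℚ j * h) * (2^ m - 1ℚ)) + h * (2^ m - 1ℚ)
      ≡⟨ eq (ℕ→ℚ j * h) (2^ m - 1ℚ) h ⟩
    1ℚ + (ℕ→ℚ j * h + h) * (2^ m - 1ℚ)
      ≡⟨ cong (λ t → 1ℚ + t * (2^ m - 1ℚ)) (sym (suc*h j)) ⟩
    1ℚ + (ℕ→ℚ (suc j) * h) * (2^ m - 1ℚ) ∎
    where
    open ≤-Reasoning
    p′ = j*h≤ j p
    eq : ∀ a t h → 1ℚ * (1ℚ + a * t) + h * t ≡ 1ℚ + (a + h) * t
    eq = solve-∀ ringℚ

  ∣H∣≤2^ j m p = ≤-trans (∣H∣≤ j m p) (≤-trans (+-monoʳ-≤ 1ℚ (*-mono-≤ʳ (0≤2^-1 m) p)) (≤-reflexive (eq (2^ m))))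
    where
    eq : ∀ a → 1ℚ + 1ℚ * (a - 1ℚ) ≡ a
    eq = solve-∀ ringℚ

  H-at-0 : ∀ j → H q j 0 ≡ 1ℚ
  H-at-0 zero    = refl
  H-at-0 (suc j) = trans (+-identityˡ (1ℚ * H q j 0)) (trans (*-identityˡ (H q j 0)) (H-at-0 j))

  0≤bound : ∀ j m → 0ℚ ℚ.≤ (ℕ→ℚ j * h) * (h * 2^ (suc m))
  0≤bound j m = 0≤* (0≤* (0≤ℕ→ℚ j) 0≤h) (0≤* 0≤h (0≤2^ (suc m)))

  -- Each of the `j` factors contributes an error of order h², from the tail `T` and from the
  -- earlier error multiplied by `h`. Since j h ≤ 1, the total is of order h.
  ∣H-η∣≤ : ∀ j m → ℕ→ℚ j * h ℚ.≤ 1ℚ → ∣ H q j m - η h j m ∣ ℚ.≤ (ℕ→ℚ j * h) * (h * 2^ (suc m))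
  ∣H-η∣≤ zero    m       p = subst (λ t → ∣ 1ℚ - t ∣ ℚ.≤ (0ℚ * h) * (h * 2^ (suc m))) (sym (η-0 h m)) (0≤bound 0 m)
  ∣H-η∣≤ (suc j) zero    p = subst₂ (λ s t → ∣ s - t ∣ ℚ.≤ (ℕ→ℚ (suc j) * h) * (h * 2^ 1)) (sym (H-at-0 (suc j))) (sym (η-at-0 h (suc j))) (0≤bound (suc j) 0)
  ∣H-η∣≤ (suc j) (suc m) p = begin
    ∣ H q (suc j) (suc m) - η h (suc j) (suc m) ∣
      ≡⟨ cong ∣_∣ (trans (cong₂ _-_ expand (η-suc h j m)) (eq a b T (η h j (suc m)) (η h j m) h)) ⟩
    ∣ (a - η h j (suc m)) + ((- h) * (b - η h j m) + T) ∣
      ≤⟨ ∣+∣≤ {a - η h j (suc m)} (∣H-η∣≤ j (suc m) p′) (∣+∣≤ {(- h) * (b - η h j m)} (∣*∣≤ {(- h)} ∣-h∣≤h (∣H-η∣≤ j m p′)) tail) ⟩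
    jh * (h * (t * (t * P))) + (h * (jh * (h * (t * P))) + (h * h) * (P - 1ℚ))
      ≤⟨ +-monoʳ-≤ (jh * (h * (t * (t * P)))) (+-mono-≤
           (*-mono-≤ˡ 0≤h (≤-trans (*-mono-≤ʳ (0≤* 0≤h (0≤* (0≤ℕ→ℚ 2) (0≤2^ m))) p′) (≤-reflexive (*-identityˡ (h * (t * P))))))
           (*-mono-≤ˡ (0≤* 0≤h 0≤h) (≤-trans (≤-via 1ℚ 0≤1 (eq₂ P)) (≤-via P (0≤2^ m) refl)))) ⟩
    jh * (h * (t * (t * P))) + (h * (h * (t * P)) + (h * h) * (P + P))
      ≡⟨ eq₃ jh h P ⟩
    (jh + h) * (h * (t * (t * P)))
      ≡⟨ cong (_* (h * (t * (t * P)))) (sym (suc*h j)) ⟩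
    (ℕ→ℚ (suc j) * h) * (h * (t * (t * P))) ∎
    where
    open ≤-Reasoning
    p′ = j*h≤ j p
    t = ℕ→ℚ 2
    P = 2^ m
    jh = ℕ→ℚ j * h
    a = H q j (suc m)
    b = H q j m
    T = ∑ m (λ i → coeff q (suc (suc i)) * H q j (m ℕ.∸ suc i))
    expand : H q (suc j) (suc m) ≡ 1ℚ * a + (- h * b + T)
    expand = trans (∑-shift (suc m) (λ d → coeff q d * H q j (suc m ℕ.∸ d))) (cong (1ℚ * a +_)
      (trans (∑-shift m (λ i → coeff q (suc i) * H q j (m ℕ.∸ i))) (cong (λ c → c * b + T) coeff-1)))
    eq : ∀ a b T e f h → (1ℚ * a + (- h * b + T)) - (e - h * f) ≡ (a - e) + (- h * (b - f) + T)
    eq = solve-∀ ringℚ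
    eq₂ : ∀ P → (P - 1ℚ) + 1ℚ ≡ P
    eq₂ = solve-∀ ringℚ
    eq₃ : ∀ j h P → j * (h * ((1ℚ + 1ℚ) * ((1ℚ + 1ℚ) * P))) + (h * (h * ((1ℚ + 1ℚ) * P)) + (h * h) * (P + P)) ≡ (j + h) * (h * ((1ℚ + 1ℚ) * ((1ℚ + 1ℚ) * P)))
    eq₃ = solve-∀ ringℚ
    ∣-h∣≤h : ∣ - h ∣ ℚ.≤ h
    ∣-h∣≤h = ≤-reflexive (trans (∣-p∣≡∣p∣ h) (0≤p⇒∣p∣≡p 0≤h))
    tail : ∣ T ∣ ℚ.≤ (h * h) * (P - 1ℚ)
    tail = ≤-trans (∣∑∣≤ m (λ i _ → ∣*∣≤ {coeff q (suc (suc i))} (∣coeff∣≤h² i) (∣H∣≤2^ j (m ℕ.∸ suc i) p′)))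
      (≤-reflexive (trans (sym (∑-*ˡ m (h * h) _)) (cong (h * h *_) (∑-2^ m))))

  module _ (n : ℕ) (nh≤1 : ℕ→ℚ n * h ℚ.≤ 1ℚ) where

    -- This is h^i times the falling factorial of `J`, because J h = 1; it tends to 1 with h → 0.
    pochhammer : ℕ → ℚ
    pochhammer i = ∏ i (λ l → 1ℚ - ℕ→ℚ l * h)

    l*h∈[0,1] : ∀ {l} → l ≤ n → 0ℚ ℚ.≤ ℕ→ℚ l * h × ℕ→ℚ l * h ℚ.≤ ℕ→ℚ n * h
    l*h∈[0,1] {l} l≤n = 0≤* (0≤ℕ→ℚ l) 0≤h , *-mono-≤ʳ 0≤h (ℕ→ℚ-mono l≤n)

    ∣pochhammer∣≤1 : ∀ i → i ≤ n → ∣ pochhammer i ∣ ℚ.≤ 1ℚ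
    ∣pochhammer∣≤1 i i≤n = nonNeg-∣∣≤ (proj₁ r) (proj₂ r)
      where
      r : 0ℚ ℚ.≤ pochhammer i × pochhammer i ℚ.≤ 1ℚ
      r = ∏-∈[0,1] i (λ l l<i → let b = l*h∈[0,1] (ℕP.≤-trans (ℕP.<⇒≤ l<i) i≤n) in 1-∈[0,1] (proj₁ b) (≤-trans (proj₂ b) nh≤1))

    ∣pochhammer-1∣≤ : ∀ i → i ≤ n → ∣ pochhammer i - 1ℚ ∣ ℚ.≤ ℕ→ℚ i * (ℕ→ℚ n * h)
    ∣pochhammer-1∣≤ zero    _   = ≤-reflexive (sym (*-zeroˡ (ℕ→ℚ n * h)))
    ∣pochhammer-1∣≤ (suc i) i<n = begin
      ∣ P * (1ℚ - y) - 1ℚ ∣              ≡⟨ cong ∣_∣ (eq P y) ⟩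
      ∣ (P - 1ℚ) + P * (- y) ∣           ≤⟨ ∣+∣≤ {P - 1ℚ} (∣pochhammer-1∣≤ i i≤n) (∣*∣≤ {P} (∣pochhammer∣≤1 i i≤n)
                                              (subst (ℚ._≤ ℕ→ℚ n * h) (sym (trans (∣-p∣≡∣p∣ y) (0≤p⇒∣p∣≡p (proj₁ (l*h∈[0,1] i≤n))))) (proj₂ (l*h∈[0,1] i≤n)))) ⟩
      ℕ→ℚ i * (ℕ→ℚ n * h) + 1ℚ * (ℕ→ℚ n * h)   ≡⟨ eq′ (ℕ→ℚ i) (ℕ→ℚ n * h) ⟩
      (1ℚ + ℕ→ℚ i) * (ℕ→ℚ n * h)         ≡⟨ cong (_* (ℕ→ℚ n * h)) (sym (ℕ→ℚ-suc i)) ⟩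
      ℕ→ℚ (suc i) * (ℕ→ℚ n * h)          ∎
      where
      open ≤-Reasoning
      i≤n = ℕP.<⇒≤ i<n
      P = pochhammer i
      y = ℕ→ℚ i * h
      eq : ∀ P y → P * (1ℚ - y) - 1ℚ ≡ (P - 1ℚ) + P * (- y)
      eq = solve-∀ ringℚ
      eq′ : ∀ i y → i * y + 1ℚ * y ≡ (1ℚ + i) * y
      eq′ = solve-∀ ringℚ

    γ-J : ∀ i → γ h J i ≡ (- 1ℚ) ^ℚ i * (pochhammer i * inv (ℕ→ℚ (i !)))
    γ-J i = begin
      (- h) ^ℚ i * (falling J i * v)
        ≡⟨ cong (_* (falling J i * v)) (trans (cong (_^ℚ i) (eq h)) (^ℚ-distrib-* (- 1ℚ) h i)) ⟩
      ((- 1ℚ) ^ℚ i * h ^ℚ i) * (falling J i * v)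
        ≡⟨ eq′ ((- 1ℚ) ^ℚ i) (h ^ℚ i) (falling J i) v ⟩
      (- 1ℚ) ^ℚ i * ((h ^ℚ i * falling J i) * v)
        ≡⟨ cong (λ t → (- 1ℚ) ^ℚ i * (t * v)) (trans (cong (_* falling J i) (sym (∏-const i h))) (trans (sym (∏-*-distrib i (λ _ → h) _))
             (∏-cong i (λ l _ → trans (eq″ h (ℕ→ℚ J) (ℕ→ℚ l)) (cong (_- ℕ→ℚ l * h) J*h))))) ⟩
      (- 1ℚ) ^ℚ i * (pochhammer i * v) ∎
      where
      open ≡-Reasoning
      v = inv (ℕ→ℚ (i !))
      eq : ∀ h → - h ≡ - 1ℚ * h
      eq = solve-∀ ringℚ
      eq′ : ∀ a b c d → (a * b) * (c * d) ≡ a * ((b * c) * d)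
      eq′ = solve-∀ ringℚ
      eq″ : ∀ h J l → h * (J - l) ≡ J * h - l * h
      eq″ = solve-∀ ringℚ

    ∣-1^∣≤1 : ∀ i → ∣ (- 1ℚ) ^ℚ i ∣ ℚ.≤ 1ℚ
    ∣-1^∣≤1 zero    = ≤-refl
    ∣-1^∣≤1 (suc i) = ∣*∣≤ { - 1ℚ} {(- 1ℚ) ^ℚ i} {1ℚ} {1ℚ} ≤-refl (∣-1^∣≤1 i)

    ∣inv-!∣≤1 : ∀ i → ∣ inv (ℕ→ℚ (i !)) ∣ ℚ.≤ 1ℚ
    ∣inv-!∣≤1 i = nonNeg-∣∣≤ (0≤inv 0<i!) (inv-≤ 0<i! (subst (1ℚ ℚ.≤_) (sym (*-identityʳ (ℕ→ℚ (i !)))) 1≤i!))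
      where
      1≤i! : 1ℚ ℚ.≤ ℕ→ℚ (i !)
      1≤i! = ℕ→ℚ-mono (ℕP.1≤n! i)
      0<i! : 0ℚ < ℕ→ℚ (i !)
      0<i! = 1≤⇒0< 1≤i!

    ∣η-derangementSum∣≤ : ∣ η h J n - derangementSum n ∣ ℚ.≤ ℕ→ℚ (suc n) * (ℕ→ℚ n * (ℕ→ℚ n * h))
    ∣η-derangementSum∣≤ = subst (λ t → ∣ t ∣ ℚ.≤ ℕ→ℚ (suc n) * c) (sym difference)
      (≤-trans (∣∑∣≤ (suc n) (λ i i≤n → ≤-trans
          (∣*∣≤ {(- 1ℚ) ^ℚ i} (∣-1^∣≤1 i) (∣*∣≤ {inv (ℕ→ℚ (i !))} (∣inv-!∣≤1 i) (≤-trans (∣pochhammer-1∣≤ i (ℕP.≤-pred i≤n))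
            (*-mono-≤ʳ (0≤* (0≤ℕ→ℚ n) 0≤h) (ℕ→ℚ-mono (ℕP.≤-pred i≤n))))))
          (≤-reflexive (trans (*-identityˡ (1ℚ * c)) (*-identityˡ c)))))
        (≤-reflexive (∑-const (suc n) c)))
      where
      c = ℕ→ℚ n * (ℕ→ℚ n * h)
      ∑-const : ∀ k c → ∑ k (λ _ → c) ≡ ℕ→ℚ k * c
      ∑-const zero    c = sym (*-zeroˡ c)
      ∑-const (suc k) c = trans (cong (_+ c) (∑-const k c)) (trans (eq (ℕ→ℚ k) c) (cong (_* c) (sym (ℕ→ℚ-suc k))))
        where
        eq : ∀ k c → k * c + c ≡ (1ℚ + k) * c
        eq = solve-∀ ringℚ
      difference : η h J n - derangementSum n ≡ ∑ (suc n) (λ i → (- 1ℚ) ^ℚ i * (inv (ℕ→ℚ (i !)) * (pochhammer i - 1ℚ)))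
      difference = trans (eq (η h J n) (derangementSum n)) (trans (cong (η h J n +_) (∑-*ˡ (suc n) (- 1ℚ) (λ i → (- 1ℚ) ^ℚ i ÷' ℕ→ℚ (i !))))
        (trans (sym (∑-+-distrib (suc n) (γ h J) _)) (∑-cong (suc n) (λ i _ →
          trans (cong₂ (λ a b → a + - 1ℚ * b) (γ-J i) (÷'≡*inv ((- 1ℚ) ^ℚ i) (ℕ→ℚ (i !)))) (eq′ ((- 1ℚ) ^ℚ i) (pochhammer i) (inv (ℕ→ℚ (i !))))))))
        where
        eq : ∀ a b → a - b ≡ a + - 1ℚ * b
        eq = solve-∀ ringℚ
        eq′ : ∀ s p v → s * (p * v) + - 1ℚ * (s * v) ≡ s * (v * (p - 1ℚ))
        eq′ = solve-∀ ringℚ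

  x≤h : x ℚ.≤ h
  x≤h = inv-≤ 0<q (≤-via h 0≤h (trans (cong (_+ h) (sym q-1*h)) (eq q h)))
    where
    eq : ∀ q h → (q - 1ℚ) * h + h ≡ q * h
    eq = solve-∀ ringℚ

  inv-q^≤h : ∀ i → inv (q ^ℚ suc i) ℚ.≤ h
  inv-q^≤h i = subst (ℚ._≤ h) (sym (inv-^ (suc i) q≢0)) (≤-trans (subst (x ^ℚ suc i ℚ.≤_) (*-identityʳ x)
    (*-mono-≤ˡ 0≤x (^ℚ-≤1 i 0≤x x≤1))) x≤h)

  ∣φ-1∣≤ : ∀ n → ∣ φ q n - 1ℚ ∣ ℚ.≤ ℕ→ℚ n * h
  ∣φ-1∣≤ zero    = ≤-reflexive (sym (*-zeroˡ h))
  ∣φ-1∣≤ (suc n) = begin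
    ∣ f * (1ℚ - y) - 1ℚ ∣        ≡⟨ cong ∣_∣ (eq f y) ⟩
    ∣ (f - 1ℚ) + f * (- y) ∣     ≤⟨ ∣+∣≤ {f - 1ℚ} (∣φ-1∣≤ n) (∣*∣≤ {f} (∣φ∣≤1 n) (subst (ℚ._≤ h) (sym (trans (∣-p∣≡∣p∣ y)
                                     (0≤p⇒∣p∣≡p (0≤inv (1≤⇒0< (1≤^ℚ (suc n) 1≤q)))))) (inv-q^≤h n))) ⟩
    ℕ→ℚ n * h + 1ℚ * h           ≡⟨ trans (cong (ℕ→ℚ n * h +_) (*-identityˡ h)) (sym (suc*h n)) ⟩
    ℕ→ℚ (suc n) * h              ∎
    where
    open ≤-Reasoning
    f = φ q n
    y = inv (q ^ℚ suc n)
    eq : ∀ P y → P * (1ℚ - y) - 1ℚ ≡ (P - 1ℚ) + P * (- y)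
    eq = solve-∀ ringℚ

  density-close : ∀ n r → ℕ→ℚ n * h ℚ.≤ 1ℚ → ∣ r - 1ℚ ∣ ℚ.≤ ℕ→ℚ 4 * h →
    ∣ (φ q n * (φ q n * H q J n)) * r - derangementSum n ∣ ℚ.≤ constant n * h
  density-close n r nh≤1 r≤ = subst (λ t → ∣ X * r - t ∣ ℚ.≤ constant n * h) (*-identityʳ D)
    (≤-trans (∣*-*∣≤ {X} {D} {r} {1ℚ} ∣X∣≤ ∣1∣ X-D r≤) (≤-reflexive (eq (ℕ→ℚ 4) (2^ n) (ℕ→ℚ n) (ℕ→ℚ (suc n)) h)))
    where
    f = φ q n
    g = H q J n
    X = f * (f * g)
    D = derangementSum n
    Jh≤1 : ℕ→ℚ J * h ℚ.≤ 1ℚ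
    Jh≤1 = ≤-reflexive J*h
    ∣g∣≤ : ∣ g ∣ ℚ.≤ 2^ n
    ∣g∣≤ = ∣H∣≤2^ J n Jh≤1
    ∣X∣≤ : ∣ X ∣ ℚ.≤ 1ℚ * (1ℚ * 2^ n)
    ∣X∣≤ = ∣*∣≤ {f} (∣φ∣≤1 n) (∣*∣≤ {f} (∣φ∣≤1 n) ∣g∣≤)
    fg-g : ∣ f * g - 1ℚ * g ∣ ℚ.≤ 1ℚ * 0ℚ + (ℕ→ℚ n * h) * 2^ n
    fg-g = ∣*-*∣≤ {f} {1ℚ} {g} {g} (∣φ∣≤1 n) ∣g∣≤ (∣φ-1∣≤ n) (≤-reflexive (cong ∣_∣ (+-inverseʳ g)))
    X-g : ∣ X - 1ℚ * (1ℚ * g) ∣ ℚ.≤ 1ℚ * (1ℚ * 0ℚ + (ℕ→ℚ n * h) * 2^ n) + (ℕ→ℚ n * h) * (1ℚ * 2^ n)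
    X-g = ∣*-*∣≤ {f} {1ℚ} {f * g} {1ℚ * g} (∣φ∣≤1 n) (∣*∣≤ {1ℚ} ∣1∣ ∣g∣≤) (∣φ-1∣≤ n) fg-g
    g-η : ∣ 1ℚ * (1ℚ * g) - η h J n ∣ ℚ.≤ 1ℚ * (h * 2^ (suc n))
    g-η = subst₂ (λ a b → ∣ a - η h J n ∣ ℚ.≤ b * (h * 2^ (suc n))) (sym (trans (*-identityˡ (1ℚ * g)) (*-identityˡ g))) J*h (∣H-η∣≤ J n Jh≤1)
    X-D : ∣ X - D ∣ ℚ.≤ ((1ℚ * (1ℚ * 0ℚ + (ℕ→ℚ n * h) * 2^ n) + (ℕ→ℚ n * h) * (1ℚ * 2^ n)) + 1ℚ * (h * 2^ (suc n))) + ℕ→ℚ (suc n) * (ℕ→ℚ n * (ℕ→ℚ n * h))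
    X-D = ∣-∣-triangle {X} (η h J n) (∣-∣-triangle {X} (1ℚ * (1ℚ * g)) X-g g-η) (∣η-derangementSum∣≤ n nh≤1)
    eq : ∀ b p n m h →
      (1ℚ * (1ℚ * p)) * (b * h) + (((1ℚ * (1ℚ * 0ℚ + (n * h) * p) + (n * h) * (1ℚ * p)) + 1ℚ * (h * ((1ℚ + 1ℚ) * p))) + m * (n * (n * h))) * 1ℚ
      ≡ (p * b + (((n * p + n * p) + (1ℚ + 1ℚ) * p) + m * (n * n))) * h
    eq = solve-∀ ringℚ

module Counting (𝔽 : FiniteField) where
  open FiniteField 𝔽 hiding (card) renaming (_≟_ to _≟F_; _+F_ to infixl 6 _+F_; _*F_ to infixl 7 _*F_; -F_ to infix 8 -F_)
  open LinAlg 𝔽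

  -- Linear algebra over a finite field

  R : CommutativeRing 0ℓ 0ℓ
  R = record { isCommutativeRing = isCommutativeRing }
  module R = CommutativeRing R
  module RP = RingProperties R.ring

  private
    ringF : AlmostCommutativeRing 0ℓ 0ℓ
    ringF = fromCommutativeRing R (λ _ → nothing)
    open NonReflective ringF using (solve; _⊜_; _⊕_; _⊗_)

  abstract
    -- Opaque, so that no goal unfolds the rational built from the length of `elems`; `Q-def` is the
    -- way back.
    Q : ℚ
    Q = ℕ→ℚ (card 𝔽)

    Q-def : Q ≡ ℕ→ℚ (card 𝔽)
    Q-def = refl

  FS : FinSet
  FS = discrete _≟F_ elems unique complete

  eqᵇ-sound : ∀ {x y} → eqᵇ x y ≡ true → x ≡ y
  eqᵇ-sound = FinSet.eqb-sound FS

  eqᵇ-complete : ∀ {x y} → x ≡ y → eqᵇ x y ≡ true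
  eqᵇ-complete = FinSet.eqb-complete FS

  count-elems : ∀ a → sumL elems (λ x → 𝟙 (eqᵇ x a)) ≡ 1ℚ
  count-elems = FinSet.count-eqb FS

  VS : ℕ → FinSet
  VS n = Fun n FS

  size-FS : size FS ≡ Q
  size-FS = trans (sym (length-sumL elems)) (sym Q-def)

  size-VS : ∀ n → size (VS n) ≡ Q ^ℚ n
  size-VS n = trans (size-Fun n FS) (cong (_^ℚ n) size-FS)

  infix 4 _≋_
  _≋_ : ∀ {n} → Vect n → Vect n → Set
  u ≋ v = ∀ i → u i ≡ v i

  0ᵛ : ∀ {n} → Vect n
  0ᵛ _ = 0#

  eqVec-sound : ∀ {n} {u v : Vect n} → eqVec u v ≡ true → u ≋ v
  eqVec-sound {n} = FinSet.eqb-sound (VS n)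

  eqVec-complete : ∀ {n} {u v : Vect n} → u ≋ v → eqVec u v ≡ true
  eqVec-complete {n} = FinSet.eqb-complete (VS n)

  eqVec-cong : ∀ {n} {u u′ v v′ : Vect n} → u ≋ u′ → v ≋ v′ → eqVec u v ≡ eqVec u′ v′
  eqVec-cong {n} {u} {u′} {v} {v′} e e′ = ⇔⇒≡
    (λ h → eqVec-complete {u = u′} {v′} λ i → trans (sym (e i)) (trans (eqVec-sound {u = u} {v} h i) (e′ i)))
    (λ h → eqVec-complete {u = u} {v} λ i → trans (e i) (trans (eqVec-sound {u = u′} {v′} h i) (sym (e′ i))))

  Σ-cong : ∀ k {f g : Fin k → F} → (∀ i → f i ≡ g i) → Σ k f ≡ Σ k g
  Σ-cong zero    e = refl
  Σ-cong (suc k) e = cong₂ _+F_ (e zero) (Σ-cong k (e ∘ suc))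

  Σ-zero : ∀ k {f : Fin k → F} → (∀ i → f i ≡ 0#) → Σ k f ≡ 0#
  Σ-zero zero    e = refl
  Σ-zero (suc k) e = trans (cong₂ _+F_ (e zero) (Σ-zero k (e ∘ suc))) (R.+-identityˡ 0#)

  Σ-+ : ∀ k (f g : Fin k → F) → Σ k (λ i → f i +F g i) ≡ Σ k f +F Σ k g
  Σ-+ zero    f g = sym (R.+-identityˡ 0#)
  Σ-+ (suc k) f g = trans (cong (f zero +F g zero +F_) (Σ-+ k (f ∘ suc) (g ∘ suc)))
    (solve 4 (λ a b c d → ((a ⊕ b) ⊕ (c ⊕ d)) ⊜ ((a ⊕ c) ⊕ (b ⊕ d))) refl (f zero) (g zero) (Σ k (f ∘ suc)) (Σ k (g ∘ suc)))

  Σ-*ˡ : ∀ k c (f : Fin k → F) → c *F Σ k f ≡ Σ k (λ i → c *F f i)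
  Σ-*ˡ zero    c f = R.zeroʳ c
  Σ-*ˡ (suc k) c f = trans (R.distribˡ c _ _) (cong (c *F f zero +F_) (Σ-*ˡ k c (f ∘ suc)))

  Σ-*ʳ : ∀ k c (f : Fin k → F) → Σ k f *F c ≡ Σ k (λ i → f i *F c)
  Σ-*ʳ k c f = trans (R.*-comm _ c) (trans (Σ-*ˡ k c f) (Σ-cong k (λ i → R.*-comm c (f i))))

  Σ-neg : ∀ k (f : Fin k → F) → Σ k (λ i → -F f i) ≡ -F Σ k f
  Σ-neg zero    f = sym RP.-0#≈0#
  Σ-neg (suc k) f = trans (cong (-F f zero +F_) (Σ-neg k (f ∘ suc))) (RP.-‿+-comm (f zero) (Σ k (f ∘ suc)))

  Σ-swap : ∀ k l (f : Fin k → Fin l → F) → Σ k (λ i → Σ l (f i)) ≡ Σ l (λ j → Σ k (λ i → f i j))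
  Σ-swap zero    l f = sym (Σ-zero l (λ _ → refl))
  Σ-swap (suc k) l f = trans (cong (Σ l (f zero) +F_) (Σ-swap k l (f ∘ suc))) (sym (Σ-+ l (f zero) _))

  dot : ∀ {n} → Vect n → Vect n → F
  dot {n} x w = Σ n (λ i → x i *F w i)

  dot-cong : ∀ {n} {x x′ w w′ : Vect n} → x ≋ x′ → w ≋ w′ → dot x w ≡ dot x′ w′
  dot-cong {n} e e′ = Σ-cong n (λ i → cong₂ _*F_ (e i) (e′ i))

  dot-comm : ∀ {n} (x w : Vect n) → dot x w ≡ dot w x
  dot-comm {n} x w = Σ-cong n (λ i → R.*-comm (x i) (w i))

  dot-0ˡ : ∀ {n} {x : Vect n} w → x ≋ 0ᵛ → dot x w ≡ 0#
  dot-0ˡ {n} w e = Σ-zero n (λ i → trans (cong (_*F w i) (e i)) (R.zeroˡ (w i)))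

  dot-0ʳ : ∀ {n} {w : Vect n} x → w ≋ 0ᵛ → dot x w ≡ 0#
  dot-0ʳ x e = trans (dot-comm x _) (dot-0ˡ x e)

  dot-Σ : ∀ {n d} (x : Vect n) (c : Vect d) (v : Fin d → Vect n) →
    dot x (combVec c v) ≡ dot c (λ l → dot x (v l))
  dot-Σ {n} {d} x c v = begin
    Σ n (λ i → x i *F Σ d (λ l → c l *F v l i))
      ≡⟨ Σ-cong n (λ i → trans (Σ-*ˡ d (x i) _) (Σ-cong d (λ l →
           solve 3 (λ a b c → (a ⊗ (b ⊗ c)) ⊜ (b ⊗ (a ⊗ c))) refl (x i) (c l) (v l i)))) ⟩
    Σ n (λ i → Σ d (λ l → c l *F (x i *F v l i)))
      ≡⟨ Σ-swap n d _ ⟩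
    Σ d (λ l → Σ n (λ i → c l *F (x i *F v l i)))
      ≡⟨ Σ-cong d (λ l → sym (Σ-*ˡ n (c l) _)) ⟩
    Σ d (λ l → c l *F Σ n (λ i → x i *F v l i)) ∎ where open ≡-Reasoning

  combVec-cong : ∀ {r d} {c c′ : Vect d} {v v′ : Fin d → Vect r} → c ≋ c′ → (∀ l → v l ≋ v′ l) →
    combVec c v ≋ combVec c′ v′
  combVec-cong {r} {d} e e′ i = Σ-cong d (λ l → cong₂ _*F_ (e l) (e′ l i))

  combVec-combVec : ∀ {r d e} (x : Vect e) (c : Fin e → Vect d) (v : Fin d → Vect r) →
    combVec x (λ l → combVec (c l) v) ≋ combVec (combVec x c) v
  combVec-combVec {r} {d} {e} x c v i = begin
    Σ e (λ l → x l *F Σ d (λ k → c l k *F v k i))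
      ≡⟨ Σ-cong e (λ l → trans (Σ-*ˡ d (x l) _) (Σ-cong d (λ k → sym (R.*-assoc (x l) (c l k) (v k i))))) ⟩
    Σ e (λ l → Σ d (λ k → (x l *F c l k) *F v k i))
      ≡⟨ Σ-swap e d _ ⟩
    Σ d (λ k → Σ e (λ l → (x l *F c l k) *F v k i))
      ≡⟨ Σ-cong d (λ k → sym (Σ-*ʳ e (v k i) _)) ⟩
    Σ d (λ k → Σ e (λ l → x l *F c l k) *F v k i) ∎ where open ≡-Reasoning

  infixl 6 _-F_
  _-F_ : F → F → F
  x -F y = x +F (-F y)

  -F≡0 : ∀ {x y} → x -F y ≡ 0# → x ≡ y
  -F≡0 {x} {y} e = RP.x∙y⁻¹≈ε⇒x≈y x y e

  combVec-minus : ∀ {r d} (c c′ : Vect d) (v : Fin d → Vect r) i →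
    combVec (λ l → c l -F c′ l) v i ≡ combVec c v i -F combVec c′ v i
  combVec-minus {r} {d} c c′ v i = trans (Σ-cong d (λ l →
      trans (R.distribʳ (v l i) (c l) (-F c′ l)) (cong (c l *F v l i +F_) (sym (RP.-‿distribˡ-* (c′ l) (v l i))))))
    (trans (Σ-+ d _ _) (cong (combVec c v i +F_) (Σ-neg d _)))

  combVec-* : ∀ {r d} k (c : Vect d) (v : Fin d → Vect r) i →
    combVec (λ l → k *F c l) v i ≡ k *F combVec c v i
  combVec-* {r} {d} k c v i = trans (Σ-cong d (λ l → R.*-assoc k (c l) (v l i))) (sym (Σ-*ˡ d k _))

  Indep : ∀ {r d} → (Fin d → Vect r) → Set
  Indep v = ∀ c → combVec c v ≋ 0ᵛ → c ≋ 0ᵛ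

  indepVecs⁻ : ∀ {r d} {v : Fin d → Vect r} → indepVecs v ≡ true → Indep v
  indepVecs⁻ {r} {d} {v} h c e = eqVec-sound {u = c} {0ᵛ}
    (⇒⁻ (FinSet.all⁻ (VS d) resp h c) (eqVec-complete {u = combVec c v} {0ᵛ} e))
    where
    resp : FinSet.Resp (VS d) (λ c → not (isZeroVec (combVec c v)) ∨ isZeroVec c)
    resp {c} {c′} e = cong₂ (λ a b → not a ∨ b)
      (eqVec-cong {v = 0ᵛ} {0ᵛ} (combVec-cong {v = v} {v} e (λ _ _ → refl)) (λ _ → refl)) (eqVec-cong {u = c} {c′} {0ᵛ} {0ᵛ} e (λ _ → refl))

  indepVecs⁺ : ∀ {r d} {v : Fin d → Vect r} → Indep v → indepVecs v ≡ true
  indepVecs⁺ {r} {d} {v} h = all⁺ (allFuns d elems) (λ c → ⇒⁺ (λ e →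
    eqVec-complete {u = c} {0ᵛ} (h c (eqVec-sound {u = combVec c v} {0ᵛ} e))))

  Indep-cong : ∀ {r d} {v v′ : Fin d → Vect r} → (∀ l → v l ≋ v′ l) → Indep v → Indep v′
  Indep-cong {v = v} {v′} e h c z = h c (λ i → trans (combVec-cong {c = c} (λ _ → refl) e i) (z i))

  indepVecs-cong : ∀ {r d} {v v′ : Fin d → Vect r} → (∀ l → v l ≋ v′ l) → indepVecs v ≡ indepVecs v′
  indepVecs-cong {v = v} {v′} e = ⇔⇒≡
    (λ h → indepVecs⁺ {v = v′} (Indep-cong e (indepVecs⁻ {v = v} h)))
    (λ h → indepVecs⁺ {v = v} (Indep-cong (λ l i → sym (e l i)) (indepVecs⁻ {v = v′} h)))

  Indep-injective : ∀ {r d} {v : Fin d → Vect r} → Indep v → ∀ c c′ → combVec c v ≋ combVec c′ v → c ≋ c′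
  Indep-injective {v = v} h c c′ e l = -F≡0 (h (λ l → c l -F c′ l) (λ i →
    trans (combVec-minus c c′ v i) (trans (cong (_-F combVec c′ v i) (e i)) (R.-‿inverseʳ _))) l)

  -- Solutions of linear systems

  2≤card : 2 ≤ card 𝔽
  2≤card = go elems (complete 0#) (complete 1#)
    where
    go : ∀ xs → 0# ∈ xs → 1# ∈ xs → 2 ≤ length xs
    go (x ∷ [])     (here p) (here q) = ⊥-elim (0≢1 (trans p (sym q)))
    go (x ∷ y ∷ xs) _        _        = s≤s (s≤s z≤n)

  2≤Q : ℕ→ℚ 2 ℚ.≤ Q
  2≤Q = subst (ℕ→ℚ 2 ℚ.≤_) (sym Q-def) (ℕ→ℚ-mono 2≤card)

  1<Q : 1ℚ < Q
  1<Q = <-≤-trans (+-monoʳ-< 1ℚ 0<1) 2≤Q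

  Q≢0 : Q ≢ 0ℚ
  Q≢0 = >0⇒≢0 (<-trans 0<1 1<Q)

  Q-1≢0 : Q - 1ℚ ≢ 0ℚ
  Q-1≢0 e = <⇒≢ 1<Q (sym (x-y≡0⇒x≡y Q 1ℚ e))

  sum-const : ∀ (A : FinSet) c → sum A (λ _ → c) ≡ size A * c
  sum-const A c = trans (sumL-cong (elements A) (λ _ → sym (*-identityˡ c))) (sym (sumL-*ʳ (elements A) c _))

  -- Split off the first coordinate: if `w zero` is 0 it is free, otherwise the other coordinates
  -- determine it. The factor `Q` on the left avoids the exponent n - 1.
  hyperplane : ∀ n (w : Vect n) β → ¬ (w ≋ 0ᵛ) →
    sum (VS n) (λ x → 𝟙 (eqᵇ (dot x w) β)) * Q ≡ Q ^ℚ n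
  hyperplane zero    w β w≢0 = ⊥-elim (w≢0 λ ())
  hyperplane (suc n) w β w≢0 with w zero ≟F 0#
  ... | yes w₀≡0 = begin
    sum (VS (suc n)) (λ x → 𝟙 (eqᵇ (dot x w) β)) * Q
      ≡⟨ cong (_* Q) (trans
           (sumL-allFuns n elems (λ x → 𝟙 (eqᵇ (dot x w) β)) (λ e → cong (λ t → 𝟙 (eqᵇ t β)) (dot-cong {w = w} e (λ _ → refl))))
           (sumL-cong elems (λ x → sumL-cong (allFuns n elems) (λ f → cong (λ t → 𝟙 (eqᵇ t β))
             (trans (cong (_+F dot f (w ∘ suc)) (trans (cong (x *F_) w₀≡0) (R.zeroʳ x))) (R.+-identityˡ _)))))) ⟩
    sum FS (λ _ → N) * Q   ≡⟨ cong (_* Q) (trans (sum-const FS N) (cong (_* N) size-FS)) ⟩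
    (Q * N) * Q                   ≡⟨ *-assoc Q N Q ⟩
    Q * (N * Q)                   ≡⟨ cong (Q *_) (hyperplane n (w ∘ suc) β w′≢0) ⟩
    Q ^ℚ suc n                    ∎
    where
    open ≡-Reasoning
    N : ℚ
    N = sum (VS n) (λ x → 𝟙 (eqᵇ (dot x (w ∘ suc)) β))
    w′≢0 : ¬ ((w ∘ suc) ≋ 0ᵛ)
    w′≢0 h = w≢0 λ { zero → w₀≡0 ; (suc i) → h i }
  ... | no w₀≢0 = begin
    sum (VS (suc n)) (λ x → 𝟙 (eqᵇ (dot x w) β)) * Q
      ≡⟨ cong (_* Q) (trans
           (sumL-allFuns n elems (λ x → 𝟙 (eqᵇ (dot x w) β)) (λ e → cong (λ t → 𝟙 (eqᵇ t β)) (dot-cong {w = w} e (λ _ → refl))))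
           (sumL-swap elems (allFuns n elems) _)) ⟩
    sum (VS n) (λ f → sum FS (λ x → 𝟙 (eqᵇ (x *F w zero +F dot f (w ∘ suc)) β))) * Q
      ≡⟨ cong (_* Q) (sumL-cong (allFuns n elems) (λ f → trans
           (sumL-cong elems (λ x → cong 𝟙 (solution x (dot f (w ∘ suc)))))
           (count-elems ((β -F dot f (w ∘ suc)) *F y)))) ⟩
    size (VS n) * Q   ≡⟨ cong (_* Q) (size-VS n) ⟩
    Q ^ℚ n * Q        ≡⟨ *-comm _ Q ⟩
    Q ^ℚ suc n        ∎
    where
    open ≡-Reasoning
    y : F
    y = proj₁ (inverse (w zero) w₀≢0)
    w₀y≡1 : w zero *F y ≡ 1#
    w₀y≡1 = proj₂ (inverse (w zero) w₀≢0)
    y′ : ∀ x → x *F w zero *F y ≡ x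
    y′ x = trans (R.*-assoc x (w zero) y) (trans (cong (x *F_) w₀y≡1) (R.*-identityʳ x))
    solution : ∀ x t → eqᵇ (x *F w zero +F t) β ≡ eqᵇ x ((β -F t) *F y)
    solution x t = ⇔⇒≡
      (λ h → eqᵇ-complete (trans (sym (y′ x)) (cong (_*F y)
        (trans (sym (trans (R.+-assoc _ t (-F t)) (trans (cong (x *F w zero +F_) (R.-‿inverseʳ t)) (R.+-identityʳ _))))
          (cong (_-F t) (eqᵇ-sound h))))))
      (λ h → eqᵇ-complete (trans (cong (_+F t) (trans (cong (_*F w zero) (eqᵇ-sound h))
          (trans (R.*-assoc _ y (w zero)) (trans (cong ((β -F t) *F_) (trans (R.*-comm y (w zero)) w₀y≡1)) (R.*-identityʳ _)))))
        (trans (R.+-assoc β (-F t) t) (trans (cong (β +F_) (R.-‿inverseˡ t)) (R.+-identityʳ β)))))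

  -- One formula for zero and nonzero `w`, so that summing over a family of such conditions only
  -- requires the number of vanishing `w`.
  count-affine : ∀ n (w : Vect n) β → (w ≋ 0ᵛ → β ≡ 0#) →
    sum (VS n) (λ x → 𝟙 (eqᵇ (dot x w) β)) * Q ≡ Q ^ℚ n + 𝟙 (isZeroVec w) * ((Q - 1ℚ) * Q ^ℚ n)
  count-affine n w β β≡0 with isZeroVec w in e
  ... | false = trans (hyperplane n w β (λ h → false≢true e (eqVec-complete {u = w} {0ᵛ} h)))
                      (sym (trans (cong (Q ^ℚ n +_) (*-zeroˡ ((Q - 1ℚ) * Q ^ℚ n))) (+-identityʳ _)))
  ... | true = trans (cong (_* Q) (trans (sumL-cong (allFuns n elems) (λ x → cong 𝟙 (eqᵇ-complete
                 (trans (dot-0ʳ x w≋0) (sym (β≡0 w≋0)))))) (size-VS n))) (eq Q (Q ^ℚ n))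
    where
    w≋0 : w ≋ 0ᵛ
    w≋0 = eqVec-sound {u = w} {0ᵛ} e
    eq : ∀ q a → a * q ≡ a + 1ℚ * ((q - 1ℚ) * a)
    eq = solve-∀ ringℚ

  solves : ∀ {n D} → (Fin D → Vect n) → Vect D → Vect n → Bool
  solves {n} {D} v b x = all (λ l → eqᵇ (dot x (v l)) (b l)) (allFin D)

  -- Both sides count, up to a factor Q, the pairs (x , c) with c · (x · v - b) = 0.
  count-solutions : ∀ {n D} (v : Fin D → Vect n) b → Indep v →
    sum (VS n) (λ x → 𝟙 (solves v b x)) * Q ^ℚ D ≡ Q ^ℚ n
  count-solutions {n} {D} v b ind = *-cancelˡ Q-1≢0 (cancel Q (Q ^ℚ D) (Q ^ℚ n) Z (trans (sym by-x) by-c))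
    where
    open ≡-Reasoning
    Z : ℚ
    Z = sum (VS n) (λ x → 𝟙 (solves v b x))
    defect : Vect n → Vect D
    defect x l = dot x (v l) -F b l
    pairs : ℚ
    pairs = sum (VS n) (λ x → sum (VS D) (λ c → 𝟙 (eqᵇ (dot c (defect x)) 0#)))

    defect-zero : ∀ x → isZeroVec (defect x) ≡ solves v b x
    defect-zero x = ⇔⇒≡
      (λ h → eqVec-complete {u = λ l → dot x (v l)} {b} (λ l → -F≡0 (eqVec-sound {u = defect x} {0ᵛ} h l)))
      (λ h → eqVec-complete {u = defect x} {0ᵛ} (λ l →
        trans (cong (_-F b l) (eqVec-sound {u = λ l → dot x (v l)} {b} h l)) (R.-‿inverseʳ (b l))))

    dot-defect : ∀ x c → dot c (defect x) ≡ dot x (combVec c v) -F dot c b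
    dot-defect x c = trans (Σ-cong D (λ l → trans (R.distribˡ (c l) _ _) (cong (c l *F dot x (v l) +F_) (sym (RP.-‿distribʳ-* (c l) (b l))))))
      (trans (Σ-+ D _ _) (cong₂ _+F_ (sym (dot-Σ x c v)) (Σ-neg D _)))

    dot-defect≡0 : ∀ x c → eqᵇ (dot c (defect x)) 0# ≡ eqᵇ (dot x (combVec c v)) (dot c b)
    dot-defect≡0 x c = ⇔⇒≡
      (λ h → eqᵇ-complete (-F≡0 (trans (sym (dot-defect x c)) (eqᵇ-sound h))))
      (λ h → eqᵇ-complete (trans (dot-defect x c) (trans (cong (_-F dot c b) (eqᵇ-sound h)) (R.-‿inverseʳ _))))

    sum-split : ∀ (A : FinSet) (p : Carrier A → Bool) s t →
      sum A (λ a → s + 𝟙 (p a) * t) ≡ size A * s + sum A (𝟙 ∘ p) * t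
    sum-split A p s t = trans (sumL-+ (elements A) _ _)
      (cong₂ _+_ (sum-const A s) (sym (sumL-*ʳ (elements A) t _)))

    -- For fixed x the sum over c depends only on whether the defect vanishes, that is, on whether x
    -- is a solution.
    by-x : pairs * Q ≡ Q ^ℚ n * Q ^ℚ D + Z * ((Q - 1ℚ) * Q ^ℚ D)
    by-x = begin
      pairs * Q ≡⟨ sumL-*ʳ (allFuns n elems) Q _ ⟩
      sum (VS n) (λ x → sum (VS D) (λ c → 𝟙 (eqᵇ (dot c (defect x)) 0#)) * Q)
        ≡⟨ sumL-cong (allFuns n elems) (λ x → trans (count-affine D (defect x) 0# (λ _ → refl))
             (cong (λ b → Q ^ℚ D + 𝟙 b * ((Q - 1ℚ) * Q ^ℚ D)) (defect-zero x))) ⟩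
      sum (VS n) (λ x → Q ^ℚ D + 𝟙 (solves v b x) * ((Q - 1ℚ) * Q ^ℚ D))
        ≡⟨ sum-split (VS n) (solves v b) _ _ ⟩
      size (VS n) * Q ^ℚ D + Z * ((Q - 1ℚ) * Q ^ℚ D)
        ≡⟨ cong (λ s → s * Q ^ℚ D + Z * ((Q - 1ℚ) * Q ^ℚ D)) (size-VS n) ⟩
      Q ^ℚ n * Q ^ℚ D + Z * ((Q - 1ℚ) * Q ^ℚ D) ∎

    -- For fixed c the condition is affine in x with normal vector `combVec c v`, which by
    -- independence vanishes only for c = 0.
    by-c : pairs * Q ≡ Q ^ℚ D * Q ^ℚ n + 1ℚ * ((Q - 1ℚ) * Q ^ℚ n)
    by-c = begin
      pairs * Q ≡⟨ cong (_* Q) (sumL-swap (allFuns n elems) (allFuns D elems) _) ⟩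
      sum (VS D) (λ c → sum (VS n) (λ x → 𝟙 (eqᵇ (dot c (defect x)) 0#))) * Q
        ≡⟨ sumL-*ʳ (allFuns D elems) Q _ ⟩
      sum (VS D) (λ c → sum (VS n) (λ x → 𝟙 (eqᵇ (dot c (defect x)) 0#)) * Q)
        ≡⟨ sumL-cong (allFuns D elems) (λ c → trans
             (cong (_* Q) (sumL-cong (allFuns n elems) (λ x → cong 𝟙 (dot-defect≡0 x c))))
             (trans (count-affine n (combVec c v) (dot c b) (λ h → dot-0ˡ b (ind c h)))
               (cong (λ t → Q ^ℚ n + 𝟙 t * ((Q - 1ℚ) * Q ^ℚ n)) (⇔⇒≡
                 (λ h → eqVec-complete {u = c} {0ᵛ} (ind c (eqVec-sound {u = combVec c v} {0ᵛ} h)))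
                 (λ h → eqVec-complete {u = combVec c v} {0ᵛ} (λ i → dot-0ˡ (λ l → v l i) (eqVec-sound {u = c} {0ᵛ} h))))))) ⟩
      sum (VS D) (λ c → Q ^ℚ n + 𝟙 (isZeroVec c) * ((Q - 1ℚ) * Q ^ℚ n))
        ≡⟨ sum-split (VS D) isZeroVec _ _ ⟩
      size (VS D) * Q ^ℚ n + sum (VS D) (𝟙 ∘ isZeroVec) * ((Q - 1ℚ) * Q ^ℚ n)
        ≡⟨ cong₂ (λ s t → s * Q ^ℚ n + t * ((Q - 1ℚ) * Q ^ℚ n)) (size-VS D) (FinSet.count-eqb (VS D) 0ᵛ) ⟩
      Q ^ℚ D * Q ^ℚ n + 1ℚ * ((Q - 1ℚ) * Q ^ℚ n) ∎

    cancel : ∀ q d m z → m * d + z * ((q - 1ℚ) * d) ≡ d * m + 1ℚ * ((q - 1ℚ) * m) →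
      (q - 1ℚ) * (z * d) ≡ (q - 1ℚ) * m
    cancel q d m z e = trans (e₁ q d m z) (trans (cong (_- m * d) e) (e₂ q d m))
      where
      e₁ : ∀ q d m z → (q - 1ℚ) * (z * d) ≡ (m * d + z * ((q - 1ℚ) * d)) - m * d
      e₁ = solve-∀ ringℚ
      e₂ : ∀ q d m → (d * m + 1ℚ * ((q - 1ℚ) * m)) - m * d ≡ (q - 1ℚ) * m
      e₂ = solve-∀ ringℚ

  module _ {n} {v : Fin n → Vect n} (ind : Indep v) where
    private
      unique-solution : ∀ b → sum (VS n) (λ x → 𝟙 (solves v b x)) ≡ 1ℚ
      unique-solution b = *-cancelʳ (^ℚ≢0 n Q≢0) (trans (count-solutions v b ind) (sym (*-identityˡ _)))

      solves-resp : ∀ b → FinSet.Resp (VS n) (solves v b)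
      solves-resp b {x} {y} e = eqVec-cong {u = λ l → dot x (v l)} {λ l → dot y (v l)} {b} {b}
        (λ l → dot-cong {w = v l} e (λ _ → refl)) (λ _ → refl)

    -- With as many equations as unknowns there is exactly one solution, so this and the
    -- surjectivity below both come from the count instead of elimination.
    Indep⇒dual-injective : ∀ x → (∀ l → dot x (v l) ≡ 0#) → x ≋ 0ᵛ
    Indep⇒dual-injective x h = FinSet.count≡1⇒unique (VS n) (solves-resp 0ᵛ) (unique-solution 0ᵛ) {x} {0ᵛ}
      (eqVec-complete {u = λ l → dot x (v l)} {0ᵛ} h)
      (eqVec-complete {u = λ l → dot 0ᵛ (v l)} {0ᵛ} (λ l → dot-0ˡ (v l) (λ _ → refl)))

    Indep⇒dual-surjective : ∀ b → ∃ λ x → ∀ l → dot x (v l) ≡ b l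
    Indep⇒dual-surjective b = proj₁ solution , eqVec-sound {u = λ l → dot (proj₁ solution) (v l)} {b} (proj₂ solution)
      where
      solution : ∃ λ x → solves v b x ≡ true
      solution = FinSet.count≡1⇒∃ (VS n) {solves v b} (unique-solution b)

  Injective : ∀ {n} → Mat n n → Set
  Injective M = ∀ x → (∀ i → dot (M i) x ≡ 0#) → x ≋ 0ᵛ

  Injective⇒Indep-cols : ∀ {n} {M : Mat n n} → Injective M → Indep (col M)
  Injective⇒Indep-cols {M = M} inj c e = inj c (λ i → trans (dot-comm (M i) c) (e i))

  Indep⇒Injective : ∀ {n} {M : Mat n n} → Indep M → Injective M
  Indep⇒Injective {M = M} ind x e = Indep⇒dual-injective ind x (λ l → trans (dot-comm x (M l)) (e l))

  -- Row and column independence agree for square matrices: a trivial kernel makes the columns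
  -- independent, and only 0 is orthogonal to n independent columns.
  Injective⇒Indep : ∀ {n} {M : Mat n n} → Injective M → Indep M
  Injective⇒Indep {M = M} inj c e = Indep⇒dual-injective (Injective⇒Indep-cols {M = M} inj) c e

  Indep⇒spans : ∀ {n} {v : Fin n → Vect n} → Indep v → ∀ b → ∃ λ c → combVec c v ≋ b
  Indep⇒spans {v = v} ind b = Indep⇒dual-surjective (Injective⇒Indep-cols {M = v} (Indep⇒Injective {M = v} ind)) b

  -- Eigenvectors of a pencil

  []ᶠ : ∀ {A : Set} → Fin 0 → A
  []ᶠ ()

  span∋ : ∀ {n d} → (Fin d → Vect n) → Vect n → Bool
  span∋ {n} {d} v w = any (λ c → eqVec (combVec c v) w) (allFuns d elems)

  private
    eqVec-resp : ∀ {n d} (v : Fin d → Vect n) w → FinSet.Resp (VS d) (λ c → eqVec (combVec c v) w)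
    eqVec-resp v w {c} {c′} e = eqVec-cong {u = combVec c v} {combVec c′ v} {w} {w}
      (combVec-cong {c = c} {c′} {v} {v} e (λ _ _ → refl)) (λ _ → refl)

  span∋⁺ : ∀ {n d} (v : Fin d → Vect n) w c → combVec c v ≋ w → span∋ v w ≡ true
  span∋⁺ {n} {d} v w c e = FinSet.any⁺ (VS d) {λ c → eqVec (combVec c v) w} c (eqVec-resp v w)
    (eqVec-complete {u = combVec c v} {w} e)

  span∋⁻ : ∀ {n d} (v : Fin d → Vect n) w → span∋ v w ≡ true → ∃ λ c → combVec c v ≋ w
  span∋⁻ {n} {d} v w h = proj₁ r , eqVec-sound {u = combVec (proj₁ r) v} {w} (proj₂ r)
    where
    r : ∃ λ c → eqVec (combVec c v) w ≡ true
    r = any⁻ (allFuns d elems) h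

  Indep-◂⁻ : ∀ {n d} {w : Vect n} {v : Fin d → Vect n} → Indep (w ◂ v) → Indep v
  Indep-◂⁻ {w = w} {v} h c e l = h (0# ◂ c) (λ i → trans (cong (_+F combVec c v i) (R.zeroˡ (w i)))
    (trans (R.+-identityˡ _) (e i))) (suc l)

  indepVecs-◂ : ∀ {n d} {w : Vect n} {v : Fin d → Vect n} → Indep v → indepVecs (w ◂ v) ≡ not (span∋ v w)
  indepVecs-◂ {n} {d} {w} {v} ind = ⇔⇒≡ (λ h → not⁺ (outside (indepVecs⁻ {v = w ◂ v} h)))
                                         (λ h → indepVecs⁺ {v = w ◂ v} (extend (not⁻ h)))
    where
    outside : Indep (w ◂ v) → span∋ v w ≡ true → ⊥
    outside h s = 0≢1 (trans (sym RP.-0#≈0#) (trans (cong -F_ (sym -1≡0)) (RP.-‿involutive 1#)))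
      where
      c = proj₁ (span∋⁻ v w s)
      -1≡0 : -F 1# ≡ 0#
      -1≡0 = h (-F 1# ◂ c) (λ i → trans (cong₂ _+F_ (RP.-1*x≈-x (w i)) (proj₂ (span∋⁻ v w s) i)) (R.-‿inverseˡ (w i))) zero
    extend : (span∋ v w ≡ true → ⊥) → Indep (w ◂ v)
    extend s c e with c zero ≟F 0#
    ... | yes c₀≡0 = λ { zero → c₀≡0 ; (suc l) → ind (c ∘ suc) (λ i →
            trans (sym (trans (cong (_+F combVec (c ∘ suc) v i) (trans (cong (_*F w i) c₀≡0) (R.zeroˡ (w i)))) (R.+-identityˡ _))) (e i)) l }
    ... | no c₀≢0 = ⊥-elim (s (span∋⁺ v w (λ l → -F y *F c (suc l)) λ i →
            trans (combVec-* (-F y) (c ∘ suc) v i) (begin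
              -F y *F combVec (c ∘ suc) v i   ≡⟨ cong (-F y *F_) (RP.+-inverseʳ-unique _ _ (e i)) ⟩
              -F y *F -F (c zero *F w i)      ≡⟨ trans (sym (RP.-‿distribˡ-* y _)) (trans (cong -F_ (sym (RP.-‿distribʳ-* y _))) (RP.-‿involutive _)) ⟩
              y *F (c zero *F w i)            ≡⟨ sym (R.*-assoc y (c zero) (w i)) ⟩
              y *F c zero *F w i              ≡⟨ cong (_*F w i) (trans (R.*-comm y (c zero)) c₀y≡1) ⟩
              1# *F w i                       ≡⟨ R.*-identityˡ (w i) ⟩
              w i                             ∎)))
      where
      open ≡-Reasoning
      y = proj₁ (inverse (c zero) c₀≢0)
      c₀y≡1 = proj₂ (inverse (c zero) c₀≢0)

  sum-span : ∀ {n d} {v : Fin d → Vect n} (f : Vect n → ℚ) → Indep v → FinSet.Resp (VS n) f →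
    sum (VS n) (λ w → 𝟙 (span∋ v w) * f w) ≡ sum (VS d) (λ c → f (combVec c v))
  sum-span {n} {d} {v} f ind resp-f = begin
    sum (VS n) (λ w → 𝟙 (span∋ v w) * f w)
      ≡⟨ sumL-cong (allFuns n elems) (λ w → trans
           (cong (_* f w) (FinSet.𝟙-any-unique (VS d) {λ c → eqVec (combVec c v) w} (eqVec-resp v w)
             (λ c c′ p p′ → Indep-injective ind c c′ (λ i → trans
               (eqVec-sound {u = combVec c v} {w} p i) (sym (eqVec-sound {u = combVec c′ v} {w} p′ i))))))
           (sumL-*ʳ (allFuns d elems) (f w) _)) ⟩
    sum (VS n) (λ w → sum (VS d) (λ c → 𝟙 (eqVec (combVec c v) w) * f w))
      ≡⟨ sumL-swap (allFuns n elems) (allFuns d elems) _ ⟩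
    sum (VS d) (λ c → sum (VS n) (λ w → 𝟙 (eqVec (combVec c v) w) * f w))
      ≡⟨ sumL-cong (allFuns d elems) (λ c → FinSet.sum-pick′ (VS n) {f} (combVec c v) resp-f) ⟩
    sum (VS d) (λ c → f (combVec c v)) ∎ where open ≡-Reasoning

  -- 𝒜 = id gives the eigenvectors of M; a pair (A , B) is treated with 𝒜 = A and M = B.
  module Pencil {n : ℕ}
    (𝒜 : Vect n → Vect n)
    (𝒜-cong : ∀ {u v} → u ≋ v → 𝒜 u ≋ 𝒜 v)
    (𝒜-comb : ∀ {d} c (v : Fin d → Vect n) → 𝒜 (combVec c v) ≋ combVec c (𝒜 ∘ v))
    (𝒜-inj : ∀ {u v} → 𝒜 u ≋ 𝒜 v → u ≋ v) where

    eig : Mat n n → F → Vect n → Bool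
    eig M σ v = eqVec (λ i → dot (M i) v) (λ i → σ *F 𝒜 v i)

    eig-resp : ∀ M σ → FinSet.Resp (VS n) (eig M σ)
    eig-resp M σ {u} {v} e = eqVec-cong {u = λ i → dot (M i) u} {λ i → dot (M i) v} {λ i → σ *F 𝒜 u i} {λ i → σ *F 𝒜 v i}
      (λ i → dot-cong {x = M i} (λ _ → refl) e) (λ i → cong (σ *F_) (𝒜-cong e i))

    eig-sound : ∀ {M σ v} → eig M σ v ≡ true → ∀ i → dot (M i) v ≡ σ *F 𝒜 v i
    eig-sound {M} {σ} {v} = eqVec-sound {u = λ i → dot (M i) v} {λ i → σ *F 𝒜 v i}

    eig-complete : ∀ {M σ v} → (∀ i → dot (M i) v ≡ σ *F 𝒜 v i) → eig M σ v ≡ true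
    eig-complete {M} {σ} {v} = eqVec-complete {u = λ i → dot (M i) v} {λ i → σ *F 𝒜 v i}

    eigs : ∀ {D} → Mat n n → Vect D → (Fin D → Vect n) → Bool
    eigs {D} M μ v = all (λ l → eig M (μ l) (v l)) (allFin D)

    K : Mat n n → F → ℚ
    K M σ = sum (VS n) (𝟙 ∘ eig M σ)

    -- W σ μ is q to the multiplicity of σ in μ: the number of σ-eigenvectors, 0 included, in the
    -- span of independent eigenvectors with eigenvalues μ.
    weight : Bool → ℚ
    weight true  = Q
    weight false = 1ℚ

    W : ∀ {D} → F → Vect D → ℚ
    W {D} σ μ = ∏ᶠ D (λ l → weight (eqᵇ (μ l) σ))

    -- `M` sends the combination with coefficients c_l to 𝒜 of the one with coefficients c_l μ_l. By
    -- injectivity of 𝒜 and independence the eigenvector equation holds coefficientwise, c_l μ_l = σ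
    -- c_l. The joint independence of eigenvectors for distinct eigenvalues rests on this.
    eig-comb : ∀ {D} {M} {μ : Vect D} {v : Fin D → Vect n} σ → Indep v → (∀ l → eig M (μ l) (v l) ≡ true) → ∀ c →
      eig M σ (combVec c v) ≡ all (λ l → eqᵇ (μ l) σ ∨ eqᵇ (c l) 0#) (allFin D)
    eig-comb {D} {M} {μ} {v} σ ind h c = ⇔⇒≡
      (λ p → all⁺ (allFin D) (λ l → split l (Indep-injective ind _ _
         (𝒜-inj (λ i → trans (sym (lhs i)) (trans (eig-sound {M} {σ} {combVec c v} p i) (rhs i)))) l)))
      (λ p → eig-complete {M} {σ} {combVec c v} (λ i → trans (lhs i) (trans
         (𝒜-cong (combVec-cong {v = v} {v} (λ l → unsplit l (all-allFin⁻ p l)) (λ _ _ → refl)) i) (sym (rhs i)))))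
      where
      lhs : ∀ i → dot (M i) (combVec c v) ≡ 𝒜 (combVec (λ l → c l *F μ l) v) i
      lhs i = trans (dot-Σ (M i) c v) (trans (Σ-cong D (λ l →
        trans (cong (c l *F_) (eig-sound {M} {μ l} {v l} (h l) i)) (sym (R.*-assoc (c l) (μ l) (𝒜 (v l) i)))))
        (sym (𝒜-comb (λ l → c l *F μ l) v i)))
      rhs : ∀ i → σ *F 𝒜 (combVec c v) i ≡ 𝒜 (combVec (λ l → σ *F c l) v) i
      rhs i = trans (cong (σ *F_) (𝒜-comb c v i)) (trans (sym (combVec-* σ c (𝒜 ∘ v) i)) (sym (𝒜-comb (λ l → σ *F c l) v i)))
      split : ∀ l → c l *F μ l ≡ σ *F c l → eqᵇ (μ l) σ ∨ eqᵇ (c l) 0# ≡ true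
      split l e with eqᵇ (μ l) σ in eμ
      ... | true  = refl
      ... | false = eqᵇ-complete (decide (c l ≟F 0#))
        where
        decide : Dec (c l ≡ 0#) → c l ≡ 0#
        decide (yes p) = p
        decide (no c≢0) = false≢true eμ (eqᵇ-complete (begin
          μ l                   ≡⟨ sym (R.*-identityˡ (μ l)) ⟩
          1# *F μ l             ≡⟨ cong (_*F μ l) (sym yc≡1) ⟩
          y *F c l *F μ l       ≡⟨ R.*-assoc y (c l) (μ l) ⟩
          y *F (c l *F μ l)     ≡⟨ cong (y *F_) (trans e (R.*-comm σ (c l))) ⟩
          y *F (c l *F σ)       ≡⟨ sym (R.*-assoc y (c l) σ) ⟩
          y *F c l *F σ         ≡⟨ cong (_*F σ) yc≡1 ⟩
          1# *F σ               ≡⟨ R.*-identityˡ σ ⟩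
          σ                     ∎))
          where
          open ≡-Reasoning
          y = proj₁ (inverse (c l) c≢0)
          yc≡1 : y *F c l ≡ 1#
          yc≡1 = trans (R.*-comm y (c l)) (proj₂ (inverse (c l) c≢0))
      unsplit : ∀ l → eqᵇ (μ l) σ ∨ eqᵇ (c l) 0# ≡ true → c l *F μ l ≡ σ *F c l
      unsplit l e with eqᵇ (μ l) σ in eμ
      ... | true  = trans (cong (c l *F_) (eqᵇ-sound eμ)) (R.*-comm (c l) σ)
      ... | false = trans (cong (_*F μ l) (eqᵇ-sound e)) (trans (R.zeroˡ (μ l))
                      (sym (trans (cong (σ *F_) (eqᵇ-sound e)) (R.zeroʳ σ))))

    -- The eigenvectors inside the span of `v` are to be excluded; by `eig-comb` a coefficient is
    -- free where μ equals σ and 0 elsewhere, which leaves W of them.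
    count-extensions : ∀ {D} {M} {μ : Vect D} {v : Fin D → Vect n} σ → Indep v → (∀ l → eig M (μ l) (v l) ≡ true) →
      sum (VS n) (λ w → 𝟙 (eig M σ w) * 𝟙 (indepVecs (w ◂ v))) ≡ K M σ - W σ μ
    count-extensions {D} {M} {μ} {v} σ ind h = begin
      sum (VS n) (λ w → 𝟙 (eig M σ w) * 𝟙 (indepVecs (w ◂ v)))
        ≡⟨ sumL-cong (allFuns n elems) (λ w → trans
             (cong (λ b → 𝟙 (eig M σ w) * b) (trans (cong 𝟙 (indepVecs-◂ {w = w} ind)) (𝟙-not (span∋ v w))))
             (eq (𝟙 (eig M σ w)) (𝟙 (span∋ v w)))) ⟩
      sum (VS n) (λ w → 𝟙 (eig M σ w) - 𝟙 (span∋ v w) * 𝟙 (eig M σ w))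
        ≡⟨ sumL-minus (allFuns n elems) _ _ ⟩
      K M σ - sum (VS n) (λ w → 𝟙 (span∋ v w) * 𝟙 (eig M σ w))
        ≡⟨ cong (λ t → K M σ - t) (begin
             sum (VS n) (λ w → 𝟙 (span∋ v w) * 𝟙 (eig M σ w))
               ≡⟨ sum-span (𝟙 ∘ eig M σ) ind (λ {u} {v} e → cong 𝟙 (eig-resp M σ {u} {v} e)) ⟩
             sum (VS D) (λ c → 𝟙 (eig M σ (combVec c v)))
               ≡⟨ sumL-cong (allFuns D elems) (λ c → cong 𝟙 (eig-comb {μ = μ} σ ind h c)) ⟩
             sum (VS D) (λ c → 𝟙 (all (λ l → eqᵇ (μ l) σ ∨ eqᵇ (c l) 0#) (allFin D)))
               ≡⟨ sum-Fun-all D FS (λ l x → eqᵇ (μ l) σ ∨ eqᵇ x 0#) ⟩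
             ∏ᶠ D (λ l → sum FS (λ x → 𝟙 (eqᵇ (μ l) σ ∨ eqᵇ x 0#)))
               ≡⟨ ∏ᶠ-cong D (λ l → line (eqᵇ (μ l) σ)) ⟩
             W σ μ ∎) ⟩
      K M σ - W σ μ ∎
      where
      open ≡-Reasoning
      eq : ∀ a b → a * (1ℚ - b) ≡ a - b * a
      eq = solve-∀ ringℚ
      line : ∀ b → sum FS (λ x → 𝟙 (b ∨ eqᵇ x 0#)) ≡ weight b
      line true  = size-FS
      line false = count-elems 0#
      ∏ᶠ-cong : ∀ k {f g : Fin k → ℚ} → (∀ i → f i ≡ g i) → ∏ᶠ k f ≡ ∏ᶠ k g
      ∏ᶠ-cong zero    e = refl
      ∏ᶠ-cong (suc k) e = cong₂ _*_ (e zero) (∏ᶠ-cong k (e ∘ suc))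

    U : ∀ {D} → Mat n n → Vect D → ℚ
    U {D} M μ = sum (Fun D (VS n)) (λ v → 𝟙 (indepVecs v) * 𝟙 (eigs M μ v))

    U-[] : ∀ M → U M []ᶠ ≡ 1ℚ
    U-[] M = sumL-cong (elements (Fun 0 (VS n))) (λ v →
      trans (*-identityʳ (𝟙 (indepVecs v))) (cong 𝟙 (indepVecs⁺ {v = v} (λ c _ ()))))

    eigs-◂ : ∀ {D} M σ (μ : Vect D) w v → eigs M (σ ◂ μ) (w ◂ v) ≡ eig M σ w ∧ eigs M μ v
    eigs-◂ {D} M σ μ w v = all-allFin D (λ l → eig M ((σ ◂ μ) l) ((w ◂ v) l))

    U-◂ : ∀ {D} M σ (μ : Vect D) → U M (σ ◂ μ) ≡ U M μ * (K M σ - W σ μ)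
    U-◂ {D} M σ μ = begin
      U M (σ ◂ μ)
        ≡⟨ sumL-allFuns D (allFuns n elems) (λ v → 𝟙 (indepVecs v) * 𝟙 (eigs M (σ ◂ μ) v)) respects ⟩
      sum (VS n) (λ w → sum (Fun D (VS n)) (λ v → 𝟙 (indepVecs (w ◂ v)) * 𝟙 (eigs M (σ ◂ μ) (w ◂ v))))
        ≡⟨ sumL-swap (allFuns n elems) (allFuns D (allFuns n elems)) _ ⟩
      sum (Fun D (VS n)) (λ v → sum (VS n) (λ w → 𝟙 (indepVecs (w ◂ v)) * 𝟙 (eigs M (σ ◂ μ) (w ◂ v))))
        ≡⟨ sumL-cong (allFuns D (allFuns n elems)) (λ v → trans
             (sumL-cong (allFuns n elems) (λ w → regroup w v))
             (sym (sumL-*ˡ (allFuns n elems) (𝟙 (eigs M μ v)) _))) ⟩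
      sum (Fun D (VS n)) (λ v → 𝟙 (eigs M μ v) * sum (VS n) (λ w → 𝟙 (eig M σ w) * 𝟙 (indepVecs (w ◂ v))))
        ≡⟨ sumL-cong (allFuns D (allFuns n elems)) fibre ⟩
      sum (Fun D (VS n)) (λ v → (𝟙 (indepVecs v) * 𝟙 (eigs M μ v)) * (K M σ - W σ μ))
        ≡⟨ sym (sumL-*ʳ (allFuns D (allFuns n elems)) (K M σ - W σ μ) _) ⟩
      U M μ * (K M σ - W σ μ) ∎
      where
      open ≡-Reasoning
      respects : ∀ {u v : Fin (suc D) → Vect n} → (∀ l → u l ≡ v l) →
        𝟙 (indepVecs u) * 𝟙 (eigs M (σ ◂ μ) u) ≡ 𝟙 (indepVecs v) * 𝟙 (eigs M (σ ◂ μ) v)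
      respects {u} {v} e = cong₂ (λ a b → 𝟙 a * 𝟙 b)
        (indepVecs-cong (λ l i → cong (λ f → f i) (e l)))
        (⇔⇒≡ (λ h → all⁺ (allFin (suc D)) (λ l → subst (λ x → eig M ((σ ◂ μ) l) x ≡ true) (e l) (all-allFin⁻ h l)))
             (λ h → all⁺ (allFin (suc D)) (λ l → subst (λ x → eig M ((σ ◂ μ) l) x ≡ true) (sym (e l)) (all-allFin⁻ h l))))
      regroup : ∀ w v → 𝟙 (indepVecs (w ◂ v)) * 𝟙 (eigs M (σ ◂ μ) (w ◂ v))
        ≡ 𝟙 (eigs M μ v) * (𝟙 (eig M σ w) * 𝟙 (indepVecs (w ◂ v)))
      regroup w v = trans (cong (𝟙 (indepVecs (w ◂ v)) *_) (trans (cong 𝟙 (eigs-◂ M σ μ w v)) (𝟙-∧ (eig M σ w) (eigs M μ v))))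
        (eq (𝟙 (indepVecs (w ◂ v))) (𝟙 (eig M σ w)) (𝟙 (eigs M μ v)))
        where
        eq : ∀ a b c → a * (b * c) ≡ c * (b * a)
        eq = solve-∀ ringℚ
      fibre : ∀ v → 𝟙 (eigs M μ v) * sum (VS n) (λ w → 𝟙 (eig M σ w) * 𝟙 (indepVecs (w ◂ v)))
        ≡ (𝟙 (indepVecs v) * 𝟙 (eigs M μ v)) * (K M σ - W σ μ)
      fibre v = by-cases (indepVecs v) (eigs M μ v) refl refl
        where
        S = sum (VS n) (λ w → 𝟙 (eig M σ w) * 𝟙 (indepVecs (w ◂ v)))
        by-cases : ∀ a b → indepVecs v ≡ a → eigs M μ v ≡ b → 𝟙 b * S ≡ (𝟙 a * 𝟙 b) * (K M σ - W σ μ)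
        by-cases true  true  ha hb = cong (1ℚ *_) (count-extensions σ (indepVecs⁻ {v = v} ha) (all-allFin⁻ hb))
        by-cases a     false ha hb = eq S (𝟙 a) (K M σ - W σ μ)
          where
          eq : ∀ s a t → 0ℚ * s ≡ (a * 0ℚ) * t
          eq = solve-∀ ringℚ
        by-cases false true  ha hb = trans (cong (1ℚ *_) (sumL-zero (allFuns n elems) (λ w →
            trans (cong (𝟙 (eig M σ w) *_) (cong 𝟙 (¬true⇒false (λ h → false≢true ha
              (indepVecs⁺ {v = v} (Indep-◂⁻ {w = w} {v} (indepVecs⁻ {v = w ◂ v} h))))))) (*-zeroʳ (𝟙 (eig M σ w))))))
          (eq (K M σ - W σ μ))
          where
          eq : ∀ t → 1ℚ * 0ℚ ≡ (0ℚ * 1ℚ) * t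
          eq = solve-∀ ringℚ

    rep : ∀ d → F → ∀ {D} → Vect D → Vect (d ℕ.+ D)
    rep zero    σ μ = μ
    rep (suc d) σ μ = σ ◂ rep d σ μ

    W-rep-same : ∀ d σ {D} (μ : Vect D) → W σ μ ≡ 1ℚ → W σ (rep d σ μ) ≡ Q ^ℚ d
    W-rep-same zero    σ μ h = h
    W-rep-same (suc d) σ μ h = cong₂ _*_ (cong weight (eqᵇ-complete {σ} refl)) (W-rep-same d σ μ h)

    W-rep-other : ∀ d {σ τ D} (μ : Vect D) → σ ≢ τ → W τ (rep d σ μ) ≡ W τ μ
    W-rep-other zero    μ σ≢τ = refl
    W-rep-other (suc d) {σ} {τ} μ σ≢τ = trans (cong₂ _*_
      (cong weight (¬true⇒false (λ e → σ≢τ (eqᵇ-sound e)))) (W-rep-other d μ σ≢τ)) (*-identityˡ _)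

    -- `W σ μ ≡ 1ℚ` says that σ does not occur in μ. The first σ-eigenvector then has to avoid only
    -- 0, and each further one `Q` times as many vectors as the one before.
    U-rep : ∀ d M σ {D} (μ : Vect D) → W σ μ ≡ 1ℚ → U M (rep d σ μ) ≡ U M μ * ∏ d (λ i → K M σ - Q ^ℚ i)
    U-rep zero    M σ μ h = sym (*-identityʳ (U M μ))
    U-rep (suc d) M σ μ h = trans (U-◂ M σ (rep d σ μ)) (trans
      (cong₂ (λ a b → a * (K M σ - b)) (U-rep d M σ μ h) (W-rep-same d σ μ h))
      (*-assoc (U M μ) _ _))

  -- Matrices avoiding prescribed eigenvalues

  1<Q^ : ∀ i → 1ℚ < Q ^ℚ suc i
  1<Q^ zero    = subst (1ℚ <_) (sym (*-identityʳ Q)) 1<Q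
  1<Q^ (suc i) = <-≤-trans 1<Q (subst (ℚ._≤ Q ^ℚ suc (suc i)) (*-identityʳ Q)
    (*-mono-≤ˡ (<⇒≤ (<-trans 0<1 1<Q)) (<⇒≤ (1<Q^ i))))

  1-Q^≢0 : ∀ i → 1ℚ - Q ^ℚ suc i ≢ 0ℚ
  1-Q^≢0 i e = <⇒≢ (1<Q^ i) (x-y≡0⇒x≡y 1ℚ (Q ^ℚ suc i) e)

  MS : ℕ → FinSet
  MS n = Fun n (VS n)

  module PencilId {n} = Pencil {n} id (λ e → e) (λ c v i → refl) (λ e → e)

  -- For the zero matrix every vector is an eigenvector with eigenvalue 0, so `U-rep` with K = Q^n
  -- is the count. The length `d + 0` comes from `rep` over the empty tuple.
  count-indep : ∀ {n} d → sum (Fun d (VS n)) (𝟙 ∘ indepVecs) ≡ ∏ d (λ i → Q ^ℚ n - Q ^ℚ i)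
  count-indep {n} d = subst (λ k → sum (Fun k (VS n)) (𝟙 ∘ indepVecs) ≡ ∏ d (λ i → Q ^ℚ n - Q ^ℚ i))
    (ℕP.+-identityʳ d) (begin
    sum (Fun (d ℕ.+ 0) (VS n)) (𝟙 ∘ indepVecs)
      ≡⟨ sumL-cong (elements (Fun (d ℕ.+ 0) (VS n))) (λ v → sym (trans
           (cong (λ b → 𝟙 (indepVecs v) * 𝟙 b) (all⁺ (allFin (d ℕ.+ 0)) (λ l → eig-zero (v l) (rep-zero d l))))
           (*-identityʳ _))) ⟩
    U O (rep d 0# []ᶠ)
      ≡⟨ U-rep d O 0# []ᶠ refl ⟩
    U O []ᶠ * ∏ d (λ i → K O 0# - Q ^ℚ i)
      ≡⟨ cong₂ _*_ (U-[] O) (∏-cong d (λ i _ → cong (_- Q ^ℚ i) K≡)) ⟩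
    1ℚ * ∏ d (λ i → Q ^ℚ n - Q ^ℚ i)
      ≡⟨ *-identityˡ _ ⟩
    ∏ d (λ i → Q ^ℚ n - Q ^ℚ i) ∎)
    where
    open ≡-Reasoning
    open PencilId {n}
    O : Mat n n
    O _ _ = 0#
    rep-zero : ∀ d l → rep d 0# []ᶠ l ≡ 0#
    rep-zero (suc d) zero    = refl
    rep-zero (suc d) (suc l) = rep-zero d l
    eig-zero : ∀ {σ} v → σ ≡ 0# → eig O σ v ≡ true
    eig-zero {σ} v refl = eig-complete {O} {σ} {v} (λ i → trans (dot-0ˡ v (λ _ → refl)) (sym (R.zeroˡ (v i))))
    K≡ : K O 0# ≡ Q ^ℚ n
    K≡ = trans (sumL-cong (allFuns n elems) (λ v → cong 𝟙 (eig-zero v refl))) (size-VS n)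

  module PencilCount {n : ℕ}
    (𝒜 : Vect n → Vect n)
    (𝒜-cong : ∀ {u v} → u ≋ v → 𝒜 u ≋ 𝒜 v)
    (𝒜-comb : ∀ {d} c (v : Fin d → Vect n) → 𝒜 (combVec c v) ≋ combVec c (𝒜 ∘ v))
    (𝒜-inj : ∀ {u v} → 𝒜 u ≋ 𝒜 v → u ≋ v) where
    open Pencil 𝒜 𝒜-cong 𝒜-comb 𝒜-inj

    hasEig : Mat n n → F → Bool
    hasEig M σ = any (λ v → not (isZeroVec v) ∧ eig M σ v) (allFuns n elems)

    hasEig⁺ : ∀ M σ v → ¬ (v ≋ 0ᵛ) → (∀ i → dot (M i) v ≡ σ *F 𝒜 v i) → hasEig M σ ≡ true
    hasEig⁺ M σ v v≢0 h = FinSet.any⁺ (VS n) {λ v → not (isZeroVec v) ∧ eig M σ v} v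
      (λ {u} {v} e → cong₂ (λ a b → not a ∧ b) (eqVec-cong {u = u} {v} {0ᵛ} {0ᵛ} e (λ _ → refl)) (eig-resp M σ {u} {v} e))
      (∧⁺ (not⁺ (λ z → v≢0 (eqVec-sound {u = v} {0ᵛ} z))) (eig-complete {M} {σ} {v} h))

    hasEig⁻ : ∀ M σ → hasEig M σ ≡ true → ∃ λ v → ¬ (v ≋ 0ᵛ) × (∀ i → dot (M i) v ≡ σ *F 𝒜 v i)
    hasEig⁻ M σ h = v , (λ z → not⁻ (proj₁ p) (eqVec-complete {u = v} {0ᵛ} z)) , eig-sound {M} {σ} {v} (proj₂ p)
      where
      r : ∃ λ v → not (isZeroVec v) ∧ eig M σ v ≡ true
      r = any⁻ (allFuns n elems) h
      v = proj₁ r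
      p : not (isZeroVec v) ≡ true × eig M σ v ≡ true
      p = ∧⁻ (proj₂ r)

    𝒜-0 : 𝒜 0ᵛ ≋ 0ᵛ
    𝒜-0 i = trans (𝒜-cong (λ j → refl) i) (𝒜-comb {0} []ᶠ []ᶠ i)

    eig-0 : ∀ M σ → eig M σ 0ᵛ ≡ true
    eig-0 M σ = eig-complete {M} {σ} {0ᵛ} (λ i → trans (dot-0ʳ (M i) (λ _ → refl))
      (sym (trans (cong (σ *F_) (𝒜-0 i)) (R.zeroʳ σ))))

    -- Stands in for the dimension of the eigenspace. The product over i ≤ n counts independent (n +
    -- 1)-tuples of eigenvectors; `count-indep` shows that there are none, so some factor is zero.
    K-power : ∀ M σ → ∃ λ i → i ℕ.< suc n × K M σ - Q ^ℚ i ≡ 0ℚ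
    K-power M σ = ∏-zero⁻¹ (suc n) (begin
      ∏ (suc n) (λ i → K M σ - Q ^ℚ i)   ≡⟨ sym (*-identityˡ _) ⟩
      1ℚ * ∏ (suc n) (λ i → K M σ - Q ^ℚ i)   ≡⟨ cong (_* ∏ (suc n) (λ i → K M σ - Q ^ℚ i)) (sym (U-[] M)) ⟩
      U M []ᶠ * ∏ (suc n) (λ i → K M σ - Q ^ℚ i)   ≡⟨ sym (U-rep (suc n) M σ []ᶠ refl) ⟩
      U M (rep (suc n) σ []ᶠ)   ≡⟨ ≤-antisym U≤0 0≤U ⟩
      0ℚ ∎)
      where
      open ≡-Reasoning
      𝟙*𝟙≤ : ∀ a b → 𝟙 a * 𝟙 b ℚ.≤ 𝟙 a
      𝟙*𝟙≤ true  true  = ≤-refl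
      𝟙*𝟙≤ true  false = 0≤1
      𝟙*𝟙≤ false true  = ≤-refl
      𝟙*𝟙≤ false false = ≤-refl
      vs = elements (Fun (suc n ℕ.+ 0) (VS n))
      μ = rep (suc n) σ []ᶠ
      none : sum (Fun (suc n ℕ.+ 0) (VS n)) (𝟙 ∘ indepVecs) ≡ 0ℚ
      none = trans (count-indep {n} (suc n ℕ.+ 0)) (∏-zero (suc n ℕ.+ 0) n (s≤s (ℕP.m≤m+n n 0)) (+-inverseʳ (Q ^ℚ n)))
      U≤0 : U M μ ℚ.≤ 0ℚ
      U≤0 = subst (U M μ ℚ.≤_) none (sumL-mono vs (λ v → 𝟙*𝟙≤ (indepVecs v) (eigs M μ v)))
      0≤U : 0ℚ ℚ.≤ U M μ
      0≤U = subst (ℚ._≤ U M μ) (sumL-zero vs (λ _ → refl)) (sumL-mono vs (λ v → 0≤* (0≤𝟙 (indepVecs v)) (0≤𝟙 (eigs M μ v))))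

    -- In telescoped form, K = 1 makes the product cancel `coeff Q n`, and K = Q^i with 1 ≤ i ≤ n
    -- makes a factor vanish. A nonzero eigenvector rules out K = 1, since the vector 0 is always
    -- counted.
    𝟙-noEig : ∀ M σ → 𝟙 (not (hasEig M σ)) ≡ ∑ (suc n) (λ d → coeff Q d * ∏ d (λ i → K M σ - Q ^ℚ i))
    𝟙-noEig M σ = trans (by-cases (hasEig M σ) refl) (sym (telescope Q (K M σ) n 1-Q^≢0))
      where
      by-cases : ∀ b → hasEig M σ ≡ b → 𝟙 (not b) ≡ coeff Q n * ∏ n (λ i → K M σ - Q ^ℚ suc i)
      by-cases false h = sym (trans (cong (coeff Q n *_) (∏-cong n (λ i _ → cong (_- Q ^ℚ suc i) K≡1))) (coeff-cancel Q n 1-Q^≢0))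
        where
        K≡1 : K M σ ≡ 1ℚ
        K≡1 = trans (sumL-cong (allFuns n elems) (λ v → cong 𝟙 (⇔⇒≡ (only-0 v)
            (λ e → trans (eig-resp M σ {v} {0ᵛ} (eqVec-sound {u = v} {0ᵛ} e)) (eig-0 M σ)))))
          (FinSet.count-eqb (VS n) 0ᵛ)
          where
          only-0 : ∀ v → eig M σ v ≡ true → isZeroVec v ≡ true
          only-0 v e with isZeroVec v in z
          ... | true  = refl
          ... | false = false≢true h (hasEig⁺ M σ v (λ v≋0 → false≢true z (eqVec-complete {u = v} {0ᵛ} v≋0)) (eig-sound {M} {σ} {v} e))
      by-cases true h = sym (trans (cong (coeff Q n *_) (zero-factor (K-power M σ))) (*-zeroʳ (coeff Q n)))
        where
        zero-factor : (∃ λ i → i ℕ.< suc n × K M σ - Q ^ℚ i ≡ 0ℚ) → ∏ n (λ i → K M σ - Q ^ℚ suc i) ≡ 0ℚ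
        zero-factor (suc i , i<n , e) = ∏-zero n i (ℕP.≤-pred i<n) e
        zero-factor (zero , _ , e) = ⊥-elim (proj₁ (proj₂ (hasEig⁻ M σ h))
          (FinSet.count≡1⇒unique (VS n) (λ {u} {v} → eig-resp M σ {u} {v}) (x-y≡0⇒x≡y (K M σ) 1ℚ e) {v} {0ᵛ}
            (eig-complete {M} {σ} {v} (proj₂ (proj₂ (hasEig⁻ M σ h)))) (eig-0 M σ)))
          where v = proj₁ (hasEig⁻ M σ h)

    Q^n≢0 : Q ^ℚ n ≢ 0ℚ
    Q^n≢0 = ^ℚ≢0 n Q≢0

    -- The conditions split into rows of `M`; each row solves a system of `D` independent linear
    -- equations.
    count-pencils : ∀ {D} (μ : Vect D) {v : Fin D → Vect n} → Indep v →
      sum (MS n) (λ M → 𝟙 (eigs M μ v)) ≡ (Q ^ℚ n * inv (Q ^ℚ D)) ^ℚ n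
    count-pencils {D} μ {v} ind = begin
      sum (MS n) (λ M → 𝟙 (eigs M μ v))
        ≡⟨ sumL-cong (elements (MS n)) (λ M → cong 𝟙 (⇔⇒≡
             (λ h → all⁺ (allFin n) (λ i → eqVec-complete {u = λ l → dot (M i) (v l)} {b i}
                      (λ l → eig-sound {M} {μ l} {v l} (all-allFin⁻ h l) i)))
             (λ h → all⁺ (allFin D) (λ l → eig-complete {M} {μ l} {v l}
                      (λ i → eqVec-sound {u = λ l → dot (M i) (v l)} {b i} (all-allFin⁻ h i) l))))) ⟩
      sum (MS n) (λ M → 𝟙 (all (λ i → solves v (b i) (M i)) (allFin n)))
        ≡⟨ sum-Fun-all n (VS n) (λ i → solves v (b i)) ⟩
      ∏ᶠ n (λ i → sum (VS n) (λ x → 𝟙 (solves v (b i) x)))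
        ≡⟨ ∏ᶠ-const n (λ i → *-cancelʳ Q^D≢0 (trans (count-solutions v (b i) ind) (sym (trans (*-assoc (Q ^ℚ n) (inv (Q ^ℚ D)) (Q ^ℚ D))
             (trans (cong (Q ^ℚ n *_) (*-invˡ Q^D≢0)) (*-identityʳ _)))))) ⟩
      (Q ^ℚ n * inv (Q ^ℚ D)) ^ℚ n ∎
      where
      open ≡-Reasoning
      b : Fin n → Vect D
      b i l = μ l *F 𝒜 (v l) i
      Q^D≢0 : Q ^ℚ D ≢ 0ℚ
      Q^D≢0 = ^ℚ≢0 D Q≢0

    ∏-Q^n : ∀ D → ∏ D (λ i → Q ^ℚ n - Q ^ℚ i) ≡ (Q ^ℚ n) ^ℚ D * θ Q n D
    ∏-Q^n D = trans (∏-cong D (λ i _ → sym (trans (eq (Q ^ℚ n) (Q ^ℚ i) (inv (Q ^ℚ n)))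
        (trans (cong (λ t → Q ^ℚ n - Q ^ℚ i * t) (*-invʳ Q^n≢0)) (cong (λ t → Q ^ℚ n - t) (*-identityʳ _))))))
      (trans (∏-*-distrib D (λ _ → Q ^ℚ n) _) (cong (_* θ Q n D) (∏-const D (Q ^ℚ n))))
      where
      eq : ∀ a b c → a * (1ℚ - b * c) ≡ a - b * (a * c)
      eq = solve-∀ ringℚ

    -- By `count-pencils` the number of `M` for a given tuple depends only on its length, so the
    -- eigenvalues in μ drop out.
    sum-U : ∀ {D} (μ : Vect D) → sum (MS n) (λ M → U M μ) ≡ (Q ^ℚ n) ^ℚ n * θ Q n D
    sum-U {D} μ = begin
      sum (MS n) (λ M → U M μ)
        ≡⟨ sumL-swap (elements (MS n)) (elements (Fun D (VS n))) _ ⟩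
      sum (Fun D (VS n)) (λ v → sum (MS n) (λ M → 𝟙 (indepVecs v) * 𝟙 (eigs M μ v)))
        ≡⟨ sumL-cong (elements (Fun D (VS n))) (λ v → trans (sym (sumL-*ˡ (elements (MS n)) (𝟙 (indepVecs v)) _))
             (by-cases v (indepVecs v) refl)) ⟩
      sum (Fun D (VS n)) (λ v → 𝟙 (indepVecs v) * Z)
        ≡⟨ sym (sumL-*ʳ (elements (Fun D (VS n))) Z _) ⟩
      sum (Fun D (VS n)) (𝟙 ∘ indepVecs) * Z
        ≡⟨ cong₂ _*_ (trans (count-indep D) (∏-Q^n D)) (trans (^ℚ-distrib-* (Q ^ℚ n) (inv (Q ^ℚ D)) n)
             (cong ((Q ^ℚ n) ^ℚ n *_) exchange)) ⟩
      ((Q ^ℚ n) ^ℚ D * θ Q n D) * ((Q ^ℚ n) ^ℚ n * inv ((Q ^ℚ n) ^ℚ D))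
        ≡⟨ eq ((Q ^ℚ n) ^ℚ D) (θ Q n D) ((Q ^ℚ n) ^ℚ n) (inv ((Q ^ℚ n) ^ℚ D)) ⟩
      ((Q ^ℚ n) ^ℚ n * θ Q n D) * ((Q ^ℚ n) ^ℚ D * inv ((Q ^ℚ n) ^ℚ D))
        ≡⟨ trans (cong ((Q ^ℚ n) ^ℚ n * θ Q n D *_) (*-invʳ (^ℚ≢0 D Q^n≢0))) (*-identityʳ _) ⟩
      (Q ^ℚ n) ^ℚ n * θ Q n D ∎
      where
      open ≡-Reasoning
      Z : ℚ
      Z = (Q ^ℚ n * inv (Q ^ℚ D)) ^ℚ n
      by-cases : ∀ v b → indepVecs v ≡ b → 𝟙 b * sum (MS n) (λ M → 𝟙 (eigs M μ v)) ≡ 𝟙 b * Z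
      by-cases v true  h = cong (1ℚ *_) (count-pencils μ (indepVecs⁻ {v = v} h))
      by-cases v false h = trans (*-zeroˡ (sum (MS n) (λ M → 𝟙 (eigs M μ v)))) (sym (*-zeroˡ Z))
      exchange : inv (Q ^ℚ D) ^ℚ n ≡ inv ((Q ^ℚ n) ^ℚ D)
      exchange = trans (sym (inv-^ n (^ℚ≢0 D Q≢0))) (cong inv (trans (sym (^ℚ-* Q n D))
        (trans (cong (Q ^ℚ_) (ℕP.*-comm n D)) (^ℚ-* Q D n))))
      eq : ∀ a b c d → (a * b) * (c * d) ≡ (c * b) * (a * d)
      eq = solve-∀ ringℚ

    -- Generalised over a prescribed tuple μ for the induction on `S`: `𝟙-noEig` expands the
    -- condition at σ, and its d-th product prefixes μ with d copies of σ. The scalars still to be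
    -- avoided stay absent from the tuple because `S` has no repetitions.
    count-avoiding : ∀ S → Unique S → ∀ {D} (μ : Vect D) → (∀ {σ} → σ ∈ S → W σ μ ≡ 1ℚ) →
      sum (MS n) (λ M → prodL S (λ σ → 𝟙 (not (hasEig M σ))) * U M μ)
        ≡ (Q ^ℚ n) ^ℚ n * iter Q n (length S) (θ Q n) D
    count-avoiding [] _ μ _ = trans (sumL-cong (elements (MS n)) (λ M → *-identityˡ (U M μ))) (sum-U μ)
    count-avoiding (σ ∷ S) (σ∉S ∷ uniq) {D} μ fresh = begin
      sum (MS n) (λ M → (𝟙 (not (hasEig M σ)) * P M) * U M μ)
        ≡⟨ sumL-cong (elements (MS n)) expand ⟩
      sum (MS n) (λ M → ∑ (suc n) (λ d → coeff Q d * (P M * U M (rep d σ μ))))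
        ≡⟨ sumL-∑ (elements (MS n)) (suc n) _ ⟩
      ∑ (suc n) (λ d → sum (MS n) (λ M → coeff Q d * (P M * U M (rep d σ μ))))
        ≡⟨ ∑-cong (suc n) (λ d _ → trans (sym (sumL-*ˡ (elements (MS n)) (coeff Q d) _))
             (trans (cong (coeff Q d *_) (count-avoiding S uniq (rep d σ μ)
               (λ {τ} τ∈S → trans (W-rep-other d μ (All.lookup σ∉S τ∈S)) (fresh (there τ∈S)))))
             (*-exchange (coeff Q d) ((Q ^ℚ n) ^ℚ n) (iter Q n (length S) (θ Q n) (d ℕ.+ D))))) ⟩
      ∑ (suc n) (λ d → (Q ^ℚ n) ^ℚ n * (coeff Q d * iter Q n (length S) (θ Q n) (d ℕ.+ D)))
        ≡⟨ sym (∑-*ˡ (suc n) ((Q ^ℚ n) ^ℚ n) _) ⟩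
      (Q ^ℚ n) ^ℚ n * iter Q n (length (σ ∷ S)) (θ Q n) D ∎
      where
      open ≡-Reasoning
      P : Mat n n → ℚ
      P M = prodL S (λ σ → 𝟙 (not (hasEig M σ)))
      eq′ : ∀ a k p u → ((a * k) * p) * u ≡ a * (p * (u * k))
      eq′ = solve-∀ ringℚ
      expand : ∀ M → (𝟙 (not (hasEig M σ)) * P M) * U M μ ≡ ∑ (suc n) (λ d → coeff Q d * (P M * U M (rep d σ μ)))
      expand M = trans (cong (λ t → (t * P M) * U M μ) (𝟙-noEig M σ))
        (trans (cong (_* U M μ) (∑-*ʳ (suc n) (P M) _)) (trans (∑-*ʳ (suc n) (U M μ) _)
        (∑-cong (suc n) (λ d _ → trans (eq′ (coeff Q d) _ (P M) (U M μ))
          (cong (λ t → coeff Q d * (P M * t)) (sym (U-rep d M σ μ (fresh (here refl)))))))))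

    count-no-eigenvalue : ∀ S → Unique S →
      sum (MS n) (λ M → 𝟙 (not (any (hasEig M) S))) ≡ (Q ^ℚ n) ^ℚ n * iter Q n (length S) (θ Q n) 0
    count-no-eigenvalue S uniq = trans (sumL-cong (elements (MS n)) (λ M → trans (𝟙-not-any (hasEig M) S)
        (sym (trans (cong (prodL S (λ σ → 𝟙 (not (hasEig M σ))) *_) (U-[] M)) (*-identityʳ _)))))
      (count-avoiding S uniq []ᶠ (λ _ → refl))

  module PencilCountId {n} = PencilCount {n} id (λ e → e) (λ c v i → refl) (λ e → e)

  s-count : ∀ n → ℕ→ℚ (s n) ≡ (Q ^ℚ n) ^ℚ n * iter Q n (card 𝔽) (θ Q n) 0
  s-count n = trans (length-filterᵇ (λ X → not (any (isEigenvalue X) elems)) (allMats n n))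
    (PencilCountId.count-no-eigenvalue {n} elems unique)

  -- The number of invertible matrices, counted once by rows and once by excluding the eigenvalue 0.
  ∑-coeff-θ : ∀ n → ∑ (suc n) (λ d → coeff Q d * θ Q n (d ℕ.+ 0)) ≡ θ Q n n
  ∑-coeff-θ n = *-cancelˡ (^ℚ≢0 n (^ℚ≢0 n Q≢0)) (begin
    (Q ^ℚ n) ^ℚ n * ∑ (suc n) (λ d → coeff Q d * θ Q n (d ℕ.+ 0))
      ≡⟨ sym (count-no-eigenvalue (0# ∷ []) (All.[] ∷ [])) ⟩
    sum (MS n) (λ M → 𝟙 (not (any (hasEig M) (0# ∷ []))))
      ≡⟨ sumL-cong (elements (MS n)) (λ M → cong 𝟙 (⇔⇒≡ (to M) (from M))) ⟩
    sum (MS n) (𝟙 ∘ indepVecs)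
      ≡⟨ trans (count-indep n) (∏-Q^n n) ⟩
    (Q ^ℚ n) ^ℚ n * θ Q n n ∎)
    where
    open ≡-Reasoning
    open PencilCountId {n}
    to : ∀ M → not (any (hasEig M) (0# ∷ [])) ≡ true → indepVecs M ≡ true
    to M h = indepVecs⁺ {v = M} (Injective⇒Indep {M = M} inj)
      where
      inj : Injective M
      inj x e with isZeroVec x in z
      ... | true  = eqVec-sound {u = x} {0ᵛ} z
      ... | false = ⊥-elim (not⁻ h (cong (_∨ false) (hasEig⁺ M 0# x
              (λ x≋0 → false≢true z (eqVec-complete {u = x} {0ᵛ} x≋0)) (λ i → trans (e i) (sym (R.zeroˡ (x i)))))))
    from : ∀ M → indepVecs M ≡ true → not (any (hasEig M) (0# ∷ [])) ≡ true
    from M h = not⁺ (λ p → absurd (hasEig⁻ M 0# (∨-false p)))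
      where
      ∨-false : ∀ {b} → b ∨ false ≡ true → b ≡ true
      ∨-false {true} _ = refl
      absurd : (∃ λ v → ¬ (v ≋ 0ᵛ) × (∀ i → dot (M i) v ≡ 0# *F v i)) → ⊥
      absurd (v , v≢0 , e) = v≢0 (Indep⇒Injective {M = M} (indepVecs⁻ {v = M} h) v (λ i → trans (e i) (R.zeroˡ (v i))))

  -- Subspaces of matrices and their bases

  unit : ∀ {k} → Fin k → Vect k
  unit zero    = 1# ◂ 0ᵛ
  unit (suc l) = 0# ◂ unit l

  dot-unit : ∀ {k} l (f : Vect k) → dot (unit l) f ≡ f l
  dot-unit {suc k} zero    f = trans (cong₂ _+F_ (R.*-identityˡ (f zero)) (dot-0ˡ {x = 0ᵛ} (f ∘ suc) (λ _ → refl))) (R.+-identityʳ _)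
  dot-unit {suc k} (suc l) f = trans (cong₂ _+F_ (R.zeroˡ (f zero)) (dot-unit l (f ∘ suc))) (R.+-identityˡ _)

  module _ {n m : ℕ} where

    MatS : FinSet
    MatS = Fun n (VS m)

    infix 4 _≈ₘ_
    _≈ₘ_ : Mat n m → Mat n m → Set
    X ≈ₘ Y = ∀ i j → X i j ≡ Y i j

    0ₘ : Mat n m
    0ₘ _ _ = 0#

    eqMat-sound : ∀ {X Y : Mat n m} → eqMat X Y ≡ true → X ≈ₘ Y
    eqMat-sound = FinSet.eqb-sound MatS

    eqMat-complete : ∀ {X Y : Mat n m} → X ≈ₘ Y → eqMat X Y ≡ true
    eqMat-complete = FinSet.eqb-complete MatS

    eqMat-cong : ∀ {X X′ Y Y′ : Mat n m} → X ≈ₘ X′ → Y ≈ₘ Y′ → eqMat X Y ≡ eqMat X′ Y′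
    eqMat-cong {X} {X′} {Y} {Y′} e e′ = ⇔⇒≡
      (λ h → eqMat-complete {X′} {Y′} λ i j → trans (sym (e i j)) (trans (eqMat-sound {X} {Y} h i j) (e′ i j)))
      (λ h → eqMat-complete {X} {Y} λ i j → trans (e i j) (trans (eqMat-sound {X′} {Y′} h i j) (sym (e′ i j))))

    combMat-cong : ∀ {k} {c c′ : Vect k} {B B′ : Fin k → Mat n m} → c ≋ c′ → (∀ l → B l ≈ₘ B′ l) →
      combMat c B ≈ₘ combMat c′ B′
    combMat-cong {B = B} {B′} e e′ i = combVec-cong {v = λ l → B l i} {λ l → B′ l i} e (λ l → e′ l i)

    IndepM : ∀ {k} → (Fin k → Mat n m) → Set
    IndepM B = ∀ c → combMat c B ≈ₘ 0ₘ → c ≋ 0ᵛ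

    indepMats⁻ : ∀ {k} {B : Fin k → Mat n m} → indepMats B ≡ true → IndepM B
    indepMats⁻ {k} {B} h c e = eqVec-sound {u = c} {0ᵛ}
      (⇒⁻ (FinSet.all⁻ (VS k) respects h c) (eqMat-complete {combMat c B} {0ₘ} e))
      where
      respects : FinSet.Resp (VS k) (λ c → not (isZeroMat (combMat c B)) ∨ isZeroVec c)
      respects {c} {c′} e = cong₂ (λ a b → not a ∨ b)
        (eqMat-cong {combMat c B} {combMat c′ B} {0ₘ} {0ₘ} (combMat-cong {B = B} {B} e (λ _ _ _ → refl)) (λ _ _ → refl))
        (eqVec-cong {u = c} {c′} {0ᵛ} {0ᵛ} e (λ _ → refl))

    indepMats⁺ : ∀ {k} {B : Fin k → Mat n m} → IndepM B → indepMats B ≡ true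
    indepMats⁺ {k} {B} h = all⁺ (allFuns k elems) (λ c → ⇒⁺ (λ e →
      eqVec-complete {u = c} {0ᵛ} (h c (eqMat-sound {combMat c B} {0ₘ} e))))

    IndepM-injective : ∀ {k} {B : Fin k → Mat n m} → IndepM B → ∀ c c′ → combMat c B ≈ₘ combMat c′ B → c ≋ c′
    IndepM-injective {B = B} h c c′ e l = -F≡0 (h (λ l → c l -F c′ l) (λ i j →
      trans (combVec-minus c c′ (λ l → B l i) j) (trans (cong (_-F combMat c′ B i j) (e i j)) (R.-‿inverseʳ _))) l)

    inSpan⁺ : ∀ {k} (B : Fin k → Mat n m) X c → combMat c B ≈ₘ X → inSpan B X ≡ true
    inSpan⁺ {k} B X c e = FinSet.any⁺ (VS k) {λ c → eqMat (combMat c B) X} c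
      (λ {c} {c′} e → eqMat-cong {combMat c B} {combMat c′ B} {X} {X} (combMat-cong {B = B} {B} e (λ _ _ _ → refl)) (λ _ _ → refl))
      (eqMat-complete {combMat c B} {X} e)

    inSpan⁻ : ∀ {k} (B : Fin k → Mat n m) X → inSpan B X ≡ true → ∃ λ c → combMat c B ≈ₘ X
    inSpan⁻ {k} B X h = proj₁ r , eqMat-sound {combMat (proj₁ r) B} {X} (proj₂ r)
      where
      r : ∃ λ c → eqMat (combMat c B) X ≡ true
      r = any⁻ (allFuns k elems) h

    inSpan-resp : ∀ {k} (B : Fin k → Mat n m) → FinSet.Resp MatS (inSpan B)
    inSpan-resp B {X} {Y} e = ⇔⇒≡
      (λ h → let r = inSpan⁻ B X h in inSpan⁺ B Y (proj₁ r) (λ i j → trans (proj₂ r i j) (e i j)))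
      (λ h → let r = inSpan⁻ B Y h in inSpan⁺ B X (proj₁ r) (λ i j → trans (proj₂ r i j) (sym (e i j))))

    inSpan-basis : ∀ {k} (B : Fin k → Mat n m) l → inSpan B (B l) ≡ true
    inSpan-basis B l = inSpan⁺ B (B l) (unit l) (λ i j → dot-unit l (λ l → B l i j))

    act : ∀ {k} → (Fin k → Vect k) → (Fin k → Mat n m) → Fin k → Mat n m
    act c B l = combMat (c l) B

    combMat-act : ∀ {k} x c (B : Fin k → Mat n m) → combMat x (act c B) ≈ₘ combMat (combVec x c) B
    combMat-act x c B i j = combVec-combVec x c (λ l → B l i) j

    module _ {k d : ℕ} {B₀ : Fin k → Mat n m} (ind₀ : IndepM B₀) (good₀ : goodSpan d B₀ ≡ true) where

      same-space : (Fin k → Mat n m) → Bool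
      same-space B = (indepMats B ∧ goodSpan d B) ∧ does (≡-dec Bool._≟_ (spanCode B₀) (spanCode B))

      represents : (Fin k → Mat n m) → (Fin k → Vect k) → Bool
      represents B c = indepVecs c ∧ FinSet.eqb (Fun k MatS) (act c B₀) B

      private
        represents⁻ : ∀ {B c} → represents B c ≡ true → Indep c × (∀ l → act c B₀ l ≈ₘ B l)
        represents⁻ {B} {c} h = indepVecs⁻ {v = c} (proj₁ (∧⁻ h)) ,
          FinSet.eqb-sound (Fun k MatS) {act c B₀} {B} (proj₂ (∧⁻ {indepVecs c} h))

        represents⁺ : ∀ {B c} → Indep c → (∀ l → act c B₀ l ≈ₘ B l) → represents B c ≡ true
        represents⁺ {B} {c} ind e = ∧⁺ (indepVecs⁺ {v = c} ind) (FinSet.eqb-complete (Fun k MatS) {act c B₀} {B} e)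

        represents-resp : ∀ B → FinSet.Resp (Fun k (VS k)) (represents B)
        represents-resp B {c} {c′} e = ⇔⇒≡ (transport c c′ e) (transport c′ c (λ l i → sym (e l i)))
          where
          transport : ∀ c c′ → (∀ l → c l ≋ c′ l) → represents B c ≡ true → represents B c′ ≡ true
          transport c c′ e h = represents⁺ {B} {c′} (Indep-cong e (proj₁ p))
            (λ l i j → trans (combMat-cong {B = B₀} {B₀} (λ i → sym (e l i)) (λ _ _ _ → refl) i j) (proj₂ p l i j))
            where p = represents⁻ {B} {c} h

        to : ∀ B → same-space B ≡ true → any (represents B) (elements (Fun k (VS k))) ≡ true
        to B h = FinSet.any⁺ (Fun k (VS k)) {represents B} c (represents-resp B) (represents⁺ {B} {c} ind-c c·B₀≈B)
          where
          h₁ : indepMats B ∧ goodSpan d B ≡ true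
          h₁ = proj₁ (∧⁻ h)
          ind : IndepM B
          ind = indepMats⁻ {B = B} (proj₁ (∧⁻ {indepMats B} h₁))
          code : ∀ X → inSpan B₀ X ≡ inSpan B X
          code = map-injective MatS (λ {X} {Y} → inSpan-resp B₀ {X} {Y}) (λ {X} {Y} → inSpan-resp B {X} {Y})
            (does-sound (≡-dec Bool._≟_) (proj₂ (∧⁻ {indepMats B ∧ goodSpan d B} h)))
          r : ∀ l → ∃ λ c → combMat c B₀ ≈ₘ B l
          r l = inSpan⁻ B₀ (B l) (trans (code (B l)) (inSpan-basis B l))
          c : Fin k → Vect k
          c l = proj₁ (r l)
          c·B₀≈B : ∀ l → act c B₀ l ≈ₘ B l
          c·B₀≈B l = proj₂ (r l)
          ind-c : Indep c
          ind-c x e = ind x (λ i j → trans (sym (combMat-cong {c = x} {B = act c B₀} {B} (λ _ → refl) c·B₀≈B i j))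
            (trans (combMat-act x c B₀ i j) (dot-0ˡ (λ l → B₀ l i j) e)))

        from : ∀ B → any (represents B) (elements (Fun k (VS k))) ≡ true → same-space B ≡ true
        from B h = ∧⁺ (∧⁺ (indepMats⁺ {B = B} ind) good) (dec-true (≡-dec Bool._≟_ (spanCode B₀) (spanCode B)) (map-cong code (allMats n m)))
          where
          r : ∃ λ c → represents B c ≡ true
          r = any⁻ (elements (Fun k (VS k))) h
          c = proj₁ r
          ind-c : Indep c
          ind-c = proj₁ (represents⁻ {B} {c} (proj₂ r))
          combMat-B : ∀ x → combMat x B ≈ₘ combMat (combVec x c) B₀
          combMat-B x i j = trans (sym (combMat-cong {c = x} {B = act c B₀} {B} (λ _ → refl) (proj₂ (represents⁻ {B} {c} (proj₂ r))) i j))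
            (combMat-act x c B₀ i j)
          ind : IndepM B
          ind x e = ind-c x (ind₀ (combVec x c) (λ i j → trans (sym (combMat-B x i j)) (e i j)))
          code : ∀ X → inSpan B₀ X ≡ inSpan B X
          code X = ⇔⇒≡
            -- The k independent rows of `c` span all coefficient vectors, so coordinates with
            -- respect to `B₀` can be rewritten with respect to `B`.
            (λ h → let y = inSpan⁻ B₀ X h ; x = Indep⇒spans ind-c (proj₁ y) in
               inSpan⁺ B X (proj₁ x) (λ i j → trans (combMat-B (proj₁ x) i j)
                 (trans (combMat-cong {B = B₀} {B₀} (proj₂ x) (λ _ _ _ → refl) i j) (proj₂ y i j))))
            (λ h → let x = inSpan⁻ B X h in
               inSpan⁺ B₀ X (combVec (proj₁ x) c) (λ i j → trans (sym (combMat-B (proj₁ x) i j)) (proj₂ x i j)))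
          good : goodSpan d B ≡ true
          good = trans (all-cong (allMats n m) (λ X → cong (λ b → not b ∨ isZeroMat X ∨ rank≥ d X) (sym (code X)))) good₀

      -- The bases of a fixed span are the families `act c B₀` with `c` independent, and the basis
      -- determines `c`; hence the count is the order of GL_k.
      count-bases : sum (Fun k MatS) (𝟙 ∘ same-space) ≡ ∏ k (λ i → Q ^ℚ k - Q ^ℚ i)
      count-bases = begin
        sum (Fun k MatS) (𝟙 ∘ same-space)
          ≡⟨ sumL-cong Bs (λ B → trans (cong 𝟙 (⇔⇒≡ (to B) (from B)))
               (FinSet.𝟙-any-unique (Fun k (VS k)) {represents B} (represents-resp B) (λ c c′ p p′ l →
                 IndepM-injective ind₀ (c l) (c′ l) (λ i j → trans (proj₂ (represents⁻ {B} {c} p) l i j)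
                   (sym (proj₂ (represents⁻ {B} {c′} p′) l i j)))))) ⟩
        sum (Fun k MatS) (λ B → sum (Fun k (VS k)) (𝟙 ∘ represents B))
          ≡⟨ sumL-swap Bs cs _ ⟩
        sum (Fun k (VS k)) (λ c → sum (Fun k MatS) (λ B → 𝟙 (represents B c)))
          ≡⟨ sumL-cong cs (λ c → trans
               (sumL-cong Bs (λ B → trans (𝟙-∧ (indepVecs c) _) (*-comm (𝟙 (indepVecs c)) _)))
               (FinSet.sum-pick′ (Fun k MatS) {λ _ → 𝟙 (indepVecs c)} (act c B₀) (λ _ → refl))) ⟩
        sum (Fun k (VS k)) (𝟙 ∘ indepVecs)
          ≡⟨ count-indep k ⟩
        ∏ k (λ i → Q ^ℚ k - Q ^ℚ i) ∎
        where
        open ≡-Reasoning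
        Bs = elements (Fun k MatS)
        cs = elements (Fun k (VS k))

  -- Bases have equal codes exactly if their spans agree, so each code is repeated once per basis,
  -- and `count-bases` makes that number the same for all.
  numRankSubspaces-count : ∀ n m k d →
    sum (Fun k (MatS {n} {m})) (λ B → 𝟙 (indepMats B ∧ goodSpan d B))
      ≡ ℕ→ℚ (numRankSubspaces n m k d) * ∏ k (λ i → Q ^ℚ k - Q ^ℚ i)
  numRankSubspaces-count n m k d = trans (sym length-codes)
    (length-deduplicate (≡-dec Bool._≟_) codes (∏ k (λ i → Q ^ℚ k - Q ^ℚ i)) class)
    where
    open ≡-Reasoning
    Bs = elements (Fun k (MatS {n} {m}))
    good : (Fin k → Mat n m) → Bool
    good B = indepMats B ∧ goodSpan d B
    codes : List (List Bool)
    codes = map spanCode (filterᵇ good Bs)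
    length-codes : ℕ→ℚ (length codes) ≡ sumL Bs (𝟙 ∘ good)
    length-codes = trans (length-sumL codes) (trans (sumL-map spanCode (filterᵇ good Bs) _)
      (trans (sym (length-sumL (filterᵇ good Bs))) (length-filterᵇ good Bs)))
    class′ : ∀ {a} → (∃ λ B → good B ≡ true × a ≡ spanCode B) →
      sumL codes (λ x → 𝟙 (does (≡-dec Bool._≟_ a x))) ≡ ∏ k (λ i → Q ^ℚ k - Q ^ℚ i)
    class′ (B₀ , h , refl) = begin
      sumL codes (λ x → 𝟙 (does (≡-dec Bool._≟_ (spanCode B₀) x)))
        ≡⟨ sumL-map spanCode (filterᵇ good Bs) _ ⟩
      sumL (filterᵇ good Bs) (λ B → 𝟙 (does (≡-dec Bool._≟_ (spanCode B₀) (spanCode B))))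
        ≡⟨ sumL-filterᵇ good Bs _ ⟩
      sumL Bs (λ B → 𝟙 (good B) * 𝟙 (does (≡-dec Bool._≟_ (spanCode B₀) (spanCode B))))
        ≡⟨ sumL-cong Bs (λ B → sym (𝟙-∧ (good B) _)) ⟩
      sumL Bs (λ B → 𝟙 (same-space {d = d} {B₀} (indepMats⁻ {B = B₀} (proj₁ p)) (proj₂ p) B))
        ≡⟨ count-bases {d = d} {B₀} (indepMats⁻ {B = B₀} (proj₁ p)) (proj₂ p) ⟩
      ∏ k (λ i → Q ^ℚ k - Q ^ℚ i) ∎
      where
      p : indepMats B₀ ≡ true × goodSpan d B₀ ≡ true
      p = ∧⁻ h
    class : ∀ {a} → a ∈ codes → sumL codes (λ x → 𝟙 (does (≡-dec Bool._≟_ a x))) ≡ ∏ k (λ i → Q ^ℚ k - Q ^ℚ i)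
    class a∈ = class′ (∈-map-filterᵇ⁻ spanCode good Bs a∈)

  -- Two-dimensional spaces of invertible matrices

  -- A row combination that vanishes is orthogonal to all columns, in particular to the n
  -- independent ones selected by `s`, and is therefore trivial.
  rank-full⁻ : ∀ {n} {X : Mat n n} → rank≥ n X ≡ true → Injective X
  rank-full⁻ {n} {X} h = Indep⇒Injective {M = X} (λ x e → Indep⇒dual-injective {v = λ l → col X (proj₁ r l)}
    (indepVecs⁻ {v = λ l → col X (proj₁ r l)} (proj₂ r)) x (λ l → e (proj₁ r l)))
    where
    r : ∃ λ s → indepVecs (λ l → col X (s l)) ≡ true
    r = any⁻ (allFuns n (allFin n)) h

  rank-full⁺ : ∀ {n} {X : Mat n n} → Injective X → rank≥ n X ≡ true
  rank-full⁺ {n} {X} inj = FinSet.any⁺ (Fun n (discrete Fin._≟_ (allFin n) (allFin⁺ n) ∈-allFin))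
    {λ s → indepVecs (λ l → col X (s l))} id
    (λ e → indepVecs-cong (λ l i → cong (X i) (e l)))
    (indepVecs⁺ {v = col X} (Injective⇒Indep-cols {M = X} inj))

  Injective-cong : ∀ {n} {X Y : Mat n n} → X ≈ₘ Y → Injective X → Injective Y
  Injective-cong {X = X} {Y} e inj x h = inj x (λ i → trans (dot-cong {w = x} (e i) (λ _ → refl)) (h i))

  goodSpan⁻ : ∀ {n k} {B : Fin k → Mat n n} → goodSpan n B ≡ true → ∀ c → ¬ (combMat c B ≈ₘ 0ₘ) → Injective (combMat c B)
  goodSpan⁻ {n} {k} {B} h c ≢0 = rank-full⁻ {X = X} (drop-zero (isZeroMat X) refl
    (⇒⁻ (FinSet.all⁻ MatS respects h X) (inSpan⁺ B X c (λ _ _ → refl))))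
    where
    X = combMat c B
    drop-zero : ∀ b → isZeroMat X ≡ b → b ∨ rank≥ n X ≡ true → rank≥ n X ≡ true
    drop-zero true  z _ = ⊥-elim (≢0 (eqMat-sound {X = X} {0ₘ} z))
    drop-zero false _ r = r
    rank-resp : ∀ {X Y : Mat n n} → X ≈ₘ Y → rank≥ n X ≡ true → rank≥ n Y ≡ true
    rank-resp {X} {Y} e r = rank-full⁺ {X = Y} (Injective-cong e (rank-full⁻ {X = X} r))
    respects : FinSet.Resp (MatS {n} {n}) (λ X → not (inSpan B X) ∨ isZeroMat X ∨ rank≥ n X)
    respects {X} {Y} e = cong₂ (λ a b → not a ∨ b) (inSpan-resp B {X} {Y} e)
      (cong₂ _∨_ (eqMat-cong {X = X} {Y} {0ₘ} {0ₘ} e (λ _ _ → refl))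
        (⇔⇒≡ (rank-resp e) (rank-resp (λ i j → sym (e i j)))))

  goodSpan⁺ : ∀ {n k} {B : Fin k → Mat n n} → (∀ c → ¬ (c ≋ 0ᵛ) → Injective (combMat c B)) → goodSpan n B ≡ true
  goodSpan⁺ {n} {k} {B} h = all⁺ (allMats n n) (λ X → ⇒⁺ (λ s → check X (inSpan⁻ B X s) (isZeroMat X) refl))
    where
    check : ∀ X → (∃ λ c → combMat c B ≈ₘ X) → ∀ b → isZeroMat X ≡ b → b ∨ rank≥ n X ≡ true
    check X _       true  _ = refl
    check X (c , e) false z = rank-full⁺ {X = X} (Injective-cong e (h c (λ c≋0 → false≢true z
      (eqMat-complete {X = X} {0ₘ} (λ i j → trans (sym (e i j)) (dot-0ˡ (λ l → B l i j) c≋0))))))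

  module _ {n} (A : Mat n n) where

    app-cong : ∀ {u v : Vect n} → u ≋ v → ∀ i → dot (A i) u ≡ dot (A i) v
    app-cong e i = dot-cong {x = A i} (λ _ → refl) e

    app-comb : ∀ {d} c (v : Fin d → Vect n) → (λ i → dot (A i) (combVec c v)) ≋ combVec c (λ l i → dot (A i) (v l))
    app-comb c v i = dot-Σ (A i) c v

    app-inj : Injective A → ∀ {u v} → (λ i → dot (A i) u) ≋ (λ i → dot (A i) v) → u ≋ v
    app-inj inj {u} {v} e j = -F≡0 (inj (λ j → u j -F v j) (λ i → trans
      (trans (Σ-cong n (λ j → trans (R.distribˡ (A i j) (u j) (-F v j)) (cong (A i j *F u j +F_) (sym (RP.-‿distribʳ-* (A i j) (v j))))))
        (trans (Σ-+ n _ _) (cong (dot (A i) u +F_) (Σ-neg n _))))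
      (trans (cong (_-F dot (A i) v) (e i)) (R.-‿inverseʳ _))) j)

  module _ {n} (A : Mat n n) (inj : Injective A) where
    module P = PencilCount (λ v i → dot (A i) v) (app-cong A) (app-comb A) (app-inj A inj)

    pencil-regular : Mat n n → Bool
    pencil-regular B = not (any (P.hasEig B) elems)

    -- `count-no-eigenvalue` has the same value for every admissible 𝒜; comparing 𝒜 = `A` with the
    -- identity gives s_q(n) without forming an inverse of `A`.
    count-regular : sum (MS n) (𝟙 ∘ pencil-regular) ≡ ℕ→ℚ (s n)
    count-regular = trans (P.count-no-eigenvalue elems unique) (sym (s-count n))

  module _ {n} (A B : Mat n n) where

    -- The function `f` on the empty index set is the tail left by splitting `allFuns 2` twice.
    pair : (Fin 0 → Mat n n) → Fin 2 → Mat n n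
    pair f = A ◂ (B ◂ f)

    dot-pair : ∀ f c v i → dot (combMat c (pair f) i) v ≡ c zero *F dot (A i) v +F c (suc zero) *F dot (B i) v
    dot-pair f c v i = trans (dot-comm (combMat c (pair f) i) v) (trans (dot-Σ v c (λ l → pair f l i))
      (cong₂ _+F_ (cong (c zero *F_) (dot-comm v (A i)))
        (trans (R.+-identityʳ _) (cong (c (suc zero) *F_) (dot-comm v (B i))))))

    -- The elements A and B - σ A have coordinates (1, 0) and (- σ, 1); an entry equal to 1 makes
    -- them nonzero by independence, hence injective.
    good-pair⁻ : ∀ f → indepMats (pair f) ∧ goodSpan n (pair f) ≡ true →
      Injective A × (∀ σ v → (∀ i → dot (B i) v ≡ σ *F dot (A i) v) → v ≋ 0ᵛ)
    good-pair⁻ f h = (λ v e → inj (1# ◂ 0ᵛ) zero refl v (λ i → trans (dot-pair f (1# ◂ 0ᵛ) v i)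
          (trans (cong₂ _+F_ (trans (R.*-identityˡ _) (e i)) (R.zeroˡ _)) (R.+-identityˡ 0#)))) ,
        (λ σ v e → inj (-F σ ◂ (1# ◂ []ᶠ)) (suc zero) refl v (λ i → trans (dot-pair f (-F σ ◂ (1# ◂ []ᶠ)) v i)
          (trans (cong₂ _+F_ (sym (RP.-‿distribˡ-* σ _)) (trans (R.*-identityˡ _) (e i))) (R.-‿inverseˡ _))))
      where
      inj : ∀ c l → c l ≡ 1# → Injective (combMat c (pair f))
      inj c l cl≡1 = goodSpan⁻ {B = pair f} (proj₂ (∧⁻ {indepMats (pair f)} h)) c
        (λ z → 0≢1 (trans (sym (indepMats⁻ {B = pair f} (proj₁ (∧⁻ h)) c z l)) cl≡1))

    -- Up to a scalar every nonzero combination is A or some B - σ A.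
    good-pair⁺ : ∀ f → 0 ℕ.< n → Injective A → (∀ σ v → (∀ i → dot (B i) v ≡ σ *F dot (A i) v) → v ≋ 0ᵛ) →
      indepMats (pair f) ∧ goodSpan n (pair f) ≡ true
    good-pair⁺ f 0<n inj regular = ∧⁺ (indepMats⁺ {B = pair f} ind) (goodSpan⁺ {B = pair f} comb-inj)
      where
      comb-inj : ∀ c → ¬ (c ≋ 0ᵛ) → Injective (combMat c (pair f))
      comb-inj c c≢0 v e with c (suc zero) ≟F 0#
      -- The combination is c₁ (B - σ A) with σ = - c₀ / c₁.
      ... | no c₁≢0 = regular (-F (y *F c zero)) v (λ i → begin
        dot (B i) v                                     ≡⟨ sym (R.*-identityˡ _) ⟩
        1# *F dot (B i) v                               ≡⟨ cong (_*F dot (B i) v) (sym yc₁≡1) ⟩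
        y *F c (suc zero) *F dot (B i) v                ≡⟨ R.*-assoc y _ _ ⟩
        y *F (c (suc zero) *F dot (B i) v)              ≡⟨ cong (y *F_) (RP.+-inverseʳ-unique _ _ (trans (sym (dot-pair f c v i)) (e i))) ⟩
        y *F -F (c zero *F dot (A i) v)                 ≡⟨ sym (RP.-‿distribʳ-* y _) ⟩
        -F (y *F (c zero *F dot (A i) v))               ≡⟨ cong -F_ (sym (R.*-assoc y (c zero) _)) ⟩
        -F (y *F c zero *F dot (A i) v)                 ≡⟨ RP.-‿distribˡ-* _ _ ⟩
        -F (y *F c zero) *F dot (A i) v                 ∎)
        where
        open ≡-Reasoning
        y = proj₁ (inverse (c (suc zero)) c₁≢0)
        yc₁≡1 : y *F c (suc zero) ≡ 1#
        yc₁≡1 = trans (R.*-comm y _) (proj₂ (inverse (c (suc zero)) c₁≢0))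
      ... | yes c₁≡0 with c zero ≟F 0#
      ...   | yes c₀≡0 = ⊥-elim (c≢0 λ { zero → c₀≡0 ; (suc zero) → c₁≡0 })
      ...   | no c₀≢0 = inj v (λ i → begin
        dot (A i) v                                     ≡⟨ sym (R.*-identityˡ _) ⟩
        1# *F dot (A i) v                               ≡⟨ cong (_*F dot (A i) v) (sym yc₀≡1) ⟩
        y *F c zero *F dot (A i) v                      ≡⟨ R.*-assoc y _ _ ⟩
        y *F (c zero *F dot (A i) v)                    ≡⟨ cong (y *F_) (sym (trans (cong (c zero *F dot (A i) v +F_)
                                                              (trans (cong (_*F dot (B i) v) c₁≡0) (R.zeroˡ _))) (R.+-identityʳ _))) ⟩
        y *F (c zero *F dot (A i) v +F c (suc zero) *F dot (B i) v)
                                                        ≡⟨ cong (y *F_) (trans (sym (dot-pair f c v i)) (e i)) ⟩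
        y *F 0#                                         ≡⟨ R.zeroʳ y ⟩
        0#                                              ∎)
        where
        open ≡-Reasoning
        y = proj₁ (inverse (c zero) c₀≢0)
        yc₀≡1 : y *F c zero ≡ 1#
        yc₀≡1 = trans (R.*-comm y _) (proj₂ (inverse (c zero) c₀≢0))
      ind : IndepM (pair f)
      ind c z with isZeroVec c in ec
      ... | true  = eqVec-sound {u = c} {0ᵛ} ec
      -- A vanishing nontrivial combination would be injective and yet kill the all-ones vector,
      -- which has an entry because 0 < n.
      ... | false = ⊥-elim (0≢1 (sym (comb-inj c (λ c≋0 → false≢true ec (eqVec-complete {u = c} {0ᵛ} c≋0)) (λ _ → 1#)
                      (λ i → dot-0ˡ {x = combMat c (pair f) i} (λ _ → 1#) (z i)) (Fin.fromℕ< 0<n))))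

  count-pairs : ∀ n → 0 ℕ.< n →
    sum (Fun 2 (MatS {n} {n})) (λ B → 𝟙 (indepMats B ∧ goodSpan n B))
      ≡ ℕ→ℚ (s n) * ∏ n (λ i → Q ^ℚ n - Q ^ℚ i)
  count-pairs n 0<n = begin
    sum (Fun 2 (MatS {n} {n})) (𝟙 ∘ good)
      ≡⟨ sumL-allFuns 1 Ms (𝟙 ∘ good) respects ⟩
    sum (MS n) (λ A → sumL (allFuns 1 Ms) (λ f → 𝟙 (good (A ◂ f))))
      ≡⟨ sumL-cong Ms (λ A → trans
           (sumL-allFuns 0 Ms (λ f → 𝟙 (good (A ◂ f))) (λ {u} {v} e → respects {A ◂ u} {A ◂ v} λ { zero → refl ; (suc l) → e l }))
           (trans (sumL-swap Ms (allFuns 0 Ms) (λ B f → 𝟙 (good (A ◂ (B ◂ f))))) (trans (sumL-cong (allFuns 0 Ms) (λ f → row A (indepVecs A) refl f))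
             (+-identityʳ (𝟙 (indepVecs A) * ℕ→ℚ (s n)))))) ⟩
    sum (MS n) (λ A → 𝟙 (indepVecs A) * ℕ→ℚ (s n))
      ≡⟨ sym (sumL-*ʳ Ms (ℕ→ℚ (s n)) _) ⟩
    sum (MS n) (𝟙 ∘ indepVecs) * ℕ→ℚ (s n)
      ≡⟨ trans (cong (_* ℕ→ℚ (s n)) (count-indep n)) (*-comm (∏ n (λ i → Q ^ℚ n - Q ^ℚ i)) (ℕ→ℚ (s n))) ⟩
    ℕ→ℚ (s n) * ∏ n (λ i → Q ^ℚ n - Q ^ℚ i) ∎
    where
    open ≡-Reasoning
    Ms = elements (MS n)
    good : (Fin 2 → Mat n n) → Bool
    good B = indepMats B ∧ goodSpan n B
    good-≡ : ∀ {B B′} → (∀ l → B l ≡ B′ l) → good B ≡ true → good B′ ≡ true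
    good-≡ {B} {B′} e h = ∧⁺
      (indepMats⁺ {B = B′} (λ c z → indepMats⁻ {B = B} (proj₁ (∧⁻ h)) c (λ i j → trans (comb-≡ c i j) (z i j))))
      (goodSpan⁺ {B = B′} (λ c c≢0 → Injective-cong (comb-≡ c) (goodSpan⁻ {B = B} (proj₂ (∧⁻ {indepMats B} h)) c
        (λ z → c≢0 (indepMats⁻ {B = B} (proj₁ (∧⁻ h)) c z)))))
      where
      comb-≡ : ∀ c → combMat c B ≈ₘ combMat c B′
      comb-≡ c = combMat-cong {c = c} {B = B} {B′} (λ _ → refl) (λ l i j → cong (λ X → X i j) (e l))
    respects : ∀ {B B′ : Fin 2 → Mat n n} → (∀ l → B l ≡ B′ l) → 𝟙 (good B) ≡ 𝟙 (good B′)
    respects e = cong 𝟙 (⇔⇒≡ (good-≡ e) (good-≡ (λ l → sym (e l))))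
    row : ∀ A b → indepVecs A ≡ b → ∀ f → sum (MS n) (λ B → 𝟙 (good (A ◂ (B ◂ f)))) ≡ 𝟙 b * ℕ→ℚ (s n)
    row A false h f = trans (sumL-zero Ms (λ B → cong 𝟙 (¬true⇒false (λ g → false≢true h
        (indepVecs⁺ {v = A} (Injective⇒Indep {M = A} (proj₁ (good-pair⁻ A B f g))))))))
      (sym (*-zeroˡ (ℕ→ℚ (s n))))
    row A true h f = trans (sumL-cong Ms (λ B → cong 𝟙 (⇔⇒≡
        (λ g → not⁺ (λ p → eig⇒⊥ B g (any⁻ elems p)))
        (λ r → good-pair⁺ A B f 0<n inj (regular B r)))))
      (trans (count-regular A inj) (sym (*-identityˡ (ℕ→ℚ (s n)))))
      where
      inj : Injective A
      inj = Indep⇒Injective {M = A} (indepVecs⁻ {v = A} h)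
      eig⇒⊥ : ∀ B → good (A ◂ (B ◂ f)) ≡ true → (∃ λ σ → P.hasEig A inj B σ ≡ true) → ⊥
      eig⇒⊥ B g (σ , p) = proj₁ (proj₂ v) (proj₂ (good-pair⁻ A B f g) σ (proj₁ v) (proj₂ (proj₂ v)))
        where v = P.hasEig⁻ A inj B σ p
      regular : ∀ B → pencil-regular A inj B ≡ true → ∀ σ v → (∀ i → dot (B i) v ≡ σ *F dot (A i) v) → v ≋ 0ᵛ
      regular B r σ v e with isZeroVec v in z
      ... | true  = eqVec-sound {u = v} {0ᵛ} z
      ... | false = ⊥-elim (not⁻ r (FinSet.any⁺ FS {P.hasEig A inj B} σ (cong (P.hasEig A inj B))
              (P.hasEig⁺ A inj B σ v (λ v≋0 → false≢true z (eqVec-complete {u = v} {0ᵛ} v≋0)) e)))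

  subspace-count : ∀ n → 0 ℕ.< n →
    ℕ→ℚ (numRankSubspaces n n 2 n) * ∏ 2 (λ i → Q ^ℚ 2 - Q ^ℚ i) ≡ ℕ→ℚ (s n) * ∏ n (λ i → Q ^ℚ n - Q ^ℚ i)
  subspace-count n 0<n = trans (sym (numRankSubspaces-count n n 2 n)) (count-pairs n 0<n)

  -- The density in closed form

  pow : ∀ k → ℕ→ℚ (card 𝔽 ℕ.^ k) ≡ Q ^ℚ k
  pow k = trans (ℕ→ℚ-^ (card 𝔽) k) (cong (_^ℚ k) (sym Q-def))

  Q^-< : ∀ i j → i ℕ.< j → Q ^ℚ i < Q ^ℚ j
  Q^-< i j i<j = subst₂ _<_ (*-identityʳ (Q ^ℚ i)) (trans (sym (^ℚ-+ Q i (suc k)))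
      (cong (Q ^ℚ_) (trans (ℕP.+-suc i k) (ℕP.m+[n∸m]≡n i<j))))
    (*-monoʳ-<-pos (Q ^ℚ i) {{ℚ.positive (0<Q^ i)}} (1<Q^ k))
    where
    k = j ℕ.∸ suc i
    0<Q^ : ∀ i → 0ℚ < Q ^ℚ i
    0<Q^ zero    = 0<1
    0<Q^ (suc i) = <-trans 0<1 (1<Q^ i)

  Q^-≢ : ∀ {i j} → i ℕ.< j → Q ^ℚ j - Q ^ℚ i ≢ 0ℚ
  Q^-≢ {i} {j} i<j e = <⇒≢ (Q^-< i j i<j) (sym (x-y≡0⇒x≡y (Q ^ℚ j) (Q ^ℚ i) e))

  formula′ : ℕ → ℚ
  formula′ n = (ℕ→ℚ (s n) * ∏ n (λ i → Q ^ℚ n - Q ^ℚ i)) ÷' ((Q ^ℚ (n ℕ.* n) - Q ^ℚ 0) * (Q ^ℚ (n ℕ.* n) - Q ^ℚ 1))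

  formula≡ : ∀ n → formula 𝔽 n ≡ formula′ n
  formula≡ n = cong₂ (λ a b → (ℕ→ℚ (s n) * a) ÷' b) (∏-cong n (λ i _ → cong₂ _-_ (pow n) (pow i)))
    (cong₂ (λ a b → (a - 1ℚ) * (a - b)) (pow (n ℕ.* n)) (trans (sym Q-def) (sym (*-identityʳ Q))))

  δ≡formula′ : ∀ n → 2 ≤ n → δrk 𝔽 n n 2 n ≡ formula′ n
  δ≡formula′ n 2≤n = trans
    (cong (ℕ→ℚ (numRankSubspaces n n 2 n) ÷'_) (∏-cong 2 (λ i _ →
      cong₂ _÷'_ (cong₂ _-_ (pow (n ℕ.* n)) (pow i)) (cong₂ _-_ (pow 2) (pow i)))))
    (inv-quotients (ℕ→ℚ (numRankSubspaces n n 2 n)) _ (Q ^ℚ 2 - Q ^ℚ 0) (Q ^ℚ 2 - Q ^ℚ 1) (Q ^ℚ (n ℕ.* n) - Q ^ℚ 0) (Q ^ℚ (n ℕ.* n) - Q ^ℚ 1)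
      (Q^-≢ {0} {2} (s≤s z≤n)) (Q^-≢ {1} {2} (s≤s (s≤s z≤n))) (Q^-≢ {0} (ℕP.≤-trans (s≤s z≤n) 2≤n²)) (Q^-≢ {1} 2≤n²)
      (subspace-count n (ℕP.≤-trans (s≤s z≤n) 2≤n)))
    where
    2≤n² : 2 ≤ n ℕ.* n
    2≤n² = ℕP.≤-trans 2≤n (ℕP.m≤m*n n n {{ℕ.>-nonZero (ℕP.≤-trans (s≤s z≤n) 2≤n)}})

  δ≡formula : ∀ n → 2 ≤ n → δrk 𝔽 n n 2 n ≡ formula 𝔽 n
  δ≡formula n 2≤n = trans (δ≡formula′ n 2≤n) (sym (formula≡ n))

  Q^≢0 : ∀ i → Q ^ℚ i ≢ 0ℚ
  Q^≢0 i = ^ℚ≢0 i Q≢0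

  open Theta Q Q^≢0

  q-1 : ℕ
  q-1 = card 𝔽 ℕ.∸ 1

  card≡ : card 𝔽 ≡ suc q-1
  card≡ = sym (ℕP.m+[n∸m]≡n (ℕP.≤-trans (s≤s z≤n) 2≤card))

  -- Of the q layers, one for each field element, `iter-θ` spends one on turning θ into a constant,
  -- and `iter-H` evaluates the other q - 1.
  s-closed : ∀ n → ℕ→ℚ (s n) ≡ Q ^ℚ (n ℕ.* n) * (φ Q n * H Q q-1 n)
  s-closed n = trans (s-count n) (cong₂ _*_ (sym (^ℚ-* Q n n)) (begin
    iter Q n (card 𝔽) (θ Q n) 0          ≡⟨ cong (λ k → iter Q n k (θ Q n) 0) card≡ ⟩
    iter Q n (suc q-1) (θ Q n) 0         ≡⟨ iter-suc Q n q-1 (θ Q n) 0 ⟩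
    iter Q n q-1 (iter Q n 1 (θ Q n)) 0  ≡⟨ iter-H Q n q-1 (iter-θ ∑-coeff-θ n) (iter-vanish Q n 1 (θ-zero n)) 0 z≤n ⟩
    θ Q n n * H Q q-1 n                  ≡⟨ cong (_* H Q q-1 n) (θ≡φ n) ⟩
    φ Q n * H Q q-1 n                    ∎))
    where open ≡-Reasoning

  -- The number of all pairs of matrices divided by the number of independent pairs.
  ρ : ℕ → ℚ
  ρ n = (Q ^ℚ (n ℕ.* n) * Q ^ℚ (n ℕ.* n)) * inv ((Q ^ℚ (n ℕ.* n) - Q ^ℚ 0) * (Q ^ℚ (n ℕ.* n) - Q ^ℚ 1))

  δ-closed : ∀ n → 2 ≤ n → δrk 𝔽 n n 2 n ≡ (φ Q n * (φ Q n * H Q q-1 n)) * ρ n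
  δ-closed n 2≤n = trans (δ≡formula′ n 2≤n) (trans (÷'≡*inv (ℕ→ℚ (s n) * ∏ n (λ i → Q ^ℚ n - Q ^ℚ i)) ((y - Q ^ℚ 0) * (y - Q ^ℚ 1))) (trans
    (cong (_* inv ((y - Q ^ℚ 0) * (y - Q ^ℚ 1))) (cong₂ _*_ (s-closed n)
      (trans (PencilCountId.∏-Q^n {n} n) (cong₂ _*_ (sym (^ℚ-* Q n n)) (θ≡φ n)))))
    (eq y (φ Q n) (H Q q-1 n) (inv ((y - Q ^ℚ 0) * (y - Q ^ℚ 1))))))
    where
    y = Q ^ℚ (n ℕ.* n)
    eq : ∀ y f h z → ((y * (f * h)) * (y * f)) * z ≡ (f * (f * h)) * ((y * y) * z)
    eq = solve-∀ ringℚ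

  -- The limit in the dimension

  open Bounds Q 2≤Q

  -- W = Q^n is admissible in `ρ-close` because n ≥ 2 gives n + 2 ≤ n + n ≤ n².
  ρ-bound : ∀ n → 2 ≤ n → ∣ ρ n - 1ℚ ∣ ℚ.≤ ℕ→ℚ 4 * inv (Q ^ℚ n)
  ρ-bound n 2≤n = ρ-close Q (Q ^ℚ (n ℕ.* n)) (Q ^ℚ n) 2≤Q (1≤^ℚ n 1≤q)
    (subst (ℚ._≤ Q ^ℚ (n ℕ.* n)) (trans (^ℚ-+ Q n 2) (cong (λ t → Q ^ℚ n * (Q * t)) (*-identityʳ Q)))
      (subst₂ ℚ._≤_ (*-identityʳ _) (trans (sym (^ℚ-+ Q (n ℕ.+ 2) k)) (cong (Q ^ℚ_) (ℕP.m+[n∸m]≡n n+2≤n²)))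
        (*-mono-≤ˡ (0≤^ℚ (n ℕ.+ 2) 0≤q) (1≤^ℚ k 1≤q))))
    where
    k = n ℕ.* n ℕ.∸ (n ℕ.+ 2)
    n+2≤n² : n ℕ.+ 2 ≤ n ℕ.* n
    n+2≤n² = ℕP.≤-trans (ℕP.+-monoʳ-≤ n (ℕP.≤-trans 2≤n (ℕP.m≤m+n n 0))) (ℕP.*-monoˡ-≤ n 2≤n)

  -- The exponent q + 1 is split to match `δ-closed`: one φ for GL_n, one for the constant in
  -- s_q(n), and q - 1 for the power series.
  partialProd≡ : ∀ M → partialProd (card 𝔽) M ≡ φ Q M * (φ Q M * φ Q M ^ℚ q-1)
  partialProd≡ M = trans (∏-cong M (λ i _ → cong (λ t → (1ℚ - t) ^ℚ suc (card 𝔽))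
      (trans (÷'≡*inv 1ℚ (ℕ→ℚ (card 𝔽 ℕ.^ suc i))) (trans (*-identityˡ (inv (ℕ→ℚ (card 𝔽 ℕ.^ suc i)))) (cong inv (pow (suc i)))))))
    (trans (∏-^ℚ M (λ i → 1ℚ - inv (Q ^ℚ suc i)) (suc (card 𝔽))) (cong (λ k → φ Q M ^ℚ suc k) card≡))

  C : ℚ
  C = rate ∑-coeff-θ q-1

  -- C + 2 collects the error of `H` and of the two φ, multiplied by a bound 9 for ρ (4 + 1 would
  -- do); the last 4 is the error of ρ itself.
  limit-bound : ∀ n M → 2 ≤ n →
    ∣ δrk 𝔽 n n 2 n - partialProd (card 𝔽) M ∣ ℚ.≤ (ℕ→ℚ 9 * (C + ℕ→ℚ 2) + ℕ→ℚ 4) * err ∑-coeff-θ n M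
  limit-bound n M 2≤n = subst₂ (λ a b → ∣ a - b ∣ ℚ.≤ (ℕ→ℚ 9 * (C + ℕ→ℚ 2) + ℕ→ℚ 4) * e)
      (sym (trans (δ-closed n 2≤n) (*-comm _ (ρ n)))) (sym (trans (partialProd≡ M) (sym (*-identityˡ _))))
      (≤-trans (∣*-*∣≤ {ρ n} {1ℚ} {X} {Y} ∣ρ∣≤9 ∣Y∣≤1 ρ≤ X-Y) (≤-reflexive (eq C e (ℕ→ℚ 9) (ℕ→ℚ 4))))
    where
    e = err ∑-coeff-θ n M
    f = φ Q n
    g = φ Q M
    h = H Q q-1 n
    X = f * (f * h)
    Y = g * (g * g ^ℚ q-1)
    eq : ∀ C e a b → a * (1ℚ * (1ℚ * (C * e) + e * 1ℚ) + e * (1ℚ * 1ℚ)) + (b * e) * (1ℚ * (1ℚ * 1ℚ)) ≡ (a * (C + (1ℚ + 1ℚ)) + b) * e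
    eq = solve-∀ ringℚ
    ∣g^∣≤1 : ∣ g ^ℚ q-1 ∣ ℚ.≤ 1ℚ
    ∣g^∣≤1 = nonNeg-∣∣≤ (0≤^ℚ q-1 (proj₁ (φ∈[0,1] M))) (^ℚ-≤1 q-1 (proj₁ (φ∈[0,1] M)) (proj₂ (φ∈[0,1] M)))
    ∣gg^∣≤1 : ∣ g * g ^ℚ q-1 ∣ ℚ.≤ 1ℚ * 1ℚ
    ∣gg^∣≤1 = ∣*∣≤ {g} (∣φ∣≤1 M) ∣g^∣≤1
    ∣Y∣≤1 : ∣ Y ∣ ℚ.≤ 1ℚ * (1ℚ * 1ℚ)
    ∣Y∣≤1 = ∣*∣≤ {g} (∣φ∣≤1 M) ∣gg^∣≤1
    X-Y : ∣ X - Y ∣ ℚ.≤ 1ℚ * (1ℚ * (C * e) + e * 1ℚ) + e * (1ℚ * 1ℚ)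
    X-Y = ∣*-*∣≤ {f} {g} {f * h} {g * g ^ℚ q-1} (∣φ∣≤1 n) ∣gg^∣≤1 (∣φ-φ∣≤ ∑-coeff-θ n M)
      (∣*-*∣≤ {f} {g} {h} {g ^ℚ q-1} (∣φ∣≤1 n) ∣g^∣≤1 (∣φ-φ∣≤ ∑-coeff-θ n M) (H-close ∑-coeff-θ M q-1 n))
    ρ≤½ : ∣ ρ n - 1ℚ ∣ ℚ.≤ ℕ→ℚ 4 * ½ ^ℚ n
    ρ≤½ = ≤-trans (ρ-bound n 2≤n) (*-mono-≤ˡ (0≤ℕ→ℚ 4) (subst (ℚ._≤ ½ ^ℚ n) (sym (inv-^ n q≢0)) (^ℚ-mono n 0≤x x≤½)))
    ρ≤ : ∣ ρ n - 1ℚ ∣ ℚ.≤ ℕ→ℚ 4 * e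
    ρ≤ = ≤-trans ρ≤½ (*-mono-≤ˡ (0≤ℕ→ℚ 4) (½^≤errˡ ∑-coeff-θ n M))
    ∣ρ∣≤9 : ∣ ρ n ∣ ℚ.≤ ℕ→ℚ 9
    ∣ρ∣≤9 = ≤-trans (subst (λ t → ∣ t ∣ ℚ.≤ ℕ→ℚ 4 * 1ℚ + 1ℚ) (eq′ (ρ n)) (∣+∣≤ {ρ n - 1ℚ} {1ℚ}
        (≤-trans ρ≤½ (*-mono-≤ˡ (0≤ℕ→ℚ 4) (^ℚ-≤1 n 0≤½ ½≤1))) ∣1∣))
      (ℕ→ℚ-mono {5} {9} (s≤s (s≤s (s≤s (s≤s (s≤s z≤n))))))
      where
      eq′ : ∀ r → (r - 1ℚ) + 1ℚ ≡ r
      eq′ = solve-∀ ringℚ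

  limit-n : (ε : ℚ) → Positive ε → ∃ λ (N : ℕ) → (n M : ℕ) → N ≤ n → N ≤ M →
    ∣ δrk 𝔽 n n 2 n - partialProd (card 𝔽) M ∣ < ε
  -- The summand 2 ensures n ≥ 2, as the closed form requires.
  limit-n ε ε>0 = 2 ℕ.+ N , λ n M N≤n N≤M → ≤-<-trans (limit-bound n M (ℕP.≤-trans (ℕP.m≤m+n 2 N) N≤n)) (begin-strict
      K * err ∑-coeff-θ n M
        ≤⟨ *-mono-≤ˡ 0≤K (+-mono-≤ (½^-anti (ℕP.≤-trans (ℕP.m≤n+m N 2) N≤n)) (½^-anti (ℕP.≤-trans (ℕP.m≤n+m N 2) N≤M))) ⟩
      K * (½ ^ℚ N + ½ ^ℚ N)
        ≡⟨ eq K (½ ^ℚ N) ⟩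
      (K * ℕ→ℚ 2) * ½ ^ℚ N
        <⟨ proj₂ a N ℕP.≤-refl ⟩
      ε ∎)
    where
    open ≤-Reasoning
    K = ℕ→ℚ 9 * (C + ℕ→ℚ 2) + ℕ→ℚ 4
    0≤K : 0ℚ ℚ.≤ K
    0≤K = 0≤+ (0≤* (0≤ℕ→ℚ 9) (0≤+ (0≤rate ∑-coeff-θ q-1) (0≤ℕ→ℚ 2))) (0≤ℕ→ℚ 4)
    a = ½^-archimedean (K * ℕ→ℚ 2) ε (positive⁻¹ ε {{ε>0}})
    N = proj₁ a
    eq : ∀ K t → K * (t + t) ≡ (K * (1ℚ + 1ℚ)) * t
    eq = solve-∀ ringℚ
    ½^-anti : ∀ {m} → N ≤ m → ½ ^ℚ m ℚ.≤ ½ ^ℚ N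
    ½^-anti {m} N≤m = subst₂ ℚ._≤_ (trans (sym (^ℚ-+ ½ (m ℕ.∸ N) N)) (cong (½ ^ℚ_) (ℕP.m∸n+n≡m N≤m))) (*-identityˡ (½ ^ℚ N))
      (*-mono-≤ʳ (0≤^ℚ N 0≤½) (^ℚ-≤1 (m ℕ.∸ N) 0≤½ ½≤1))

-- The limit in the field size

limit-q : (n : ℕ) → 2 ≤ n → (ε : ℚ) → Positive ε →
  ∃ λ (N : ℕ) → (𝔽 : FiniteField) → N ≤ card 𝔽 → ∣ δrk 𝔽 n n 2 n - derangementSum n ∣ < ε
-- The threshold gives q - 1 ≥ n + N: the part n yields n h ≤ 1, and the part N makes `constant n` /
-- (q - 1) smaller than ε.
limit-q n 2≤n ε ε>0 = suc (n ℕ.+ N) , bound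
  where
  arch : ∃ λ N → ∀ t → 0ℚ < t → ℕ→ℚ N ℚ.≤ t → constant n * inv t < ε
  arch = archimedean (constant n) ε (positive⁻¹ ε {{ε>0}})
  N : ℕ
  N = proj₁ arch
  bound : (𝔽 : FiniteField) → suc (n ℕ.+ N) ≤ card 𝔽 → ∣ δrk 𝔽 n n 2 n - derangementSum n ∣ < ε
  bound 𝔽 N≤q = subst (λ t → ∣ t - derangementSum n ∣ < ε) (sym (δ-closed n 2≤n))
    (≤-<-trans (density-close n (ρ n) nh≤1 (≤-trans (ρ-bound n 2≤n) (*-mono-≤ˡ (0≤ℕ→ℚ 4) (inv-Q^≤h n 2≤n))))
      (proj₂ arch (Q - 1ℚ) (1≤⇒0< 1≤q-1) (subst (ℕ→ℚ N ℚ.≤_) (sym Q-1≡) (ℕ→ℚ-mono (ℕP.≤-trans (ℕP.m≤n+m N n) n+N≤J)))))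
    where
    open Counting 𝔽
    Q-1≡ : Q - 1ℚ ≡ ℕ→ℚ q-1
    Q-1≡ = trans (cong (_- 1ℚ) (trans Q-def (trans (cong ℕ→ℚ card≡) (ℕ→ℚ-suc q-1)))) (eq (ℕ→ℚ q-1))
      where
      eq : ∀ a → (1ℚ + a) - 1ℚ ≡ a
      eq = solve-∀ ringℚ
    open FieldBounds Q 2≤Q q-1 Q-1≡
    n+N≤J : n ℕ.+ N ≤ q-1
    n+N≤J = ℕP.≤-pred (subst (suc (n ℕ.+ N) ≤_) card≡ N≤q)
    nh≤1 : ℕ→ℚ n * h ℚ.≤ 1ℚ
    nh≤1 = subst (ℕ→ℚ n * h ℚ.≤_) J*h (*-mono-≤ʳ 0≤h (ℕ→ℚ-mono (ℕP.≤-trans (ℕP.m≤m+n n N) n+N≤J)))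
    inv-Q^≤h : ∀ n → 2 ≤ n → inv (Q ^ℚ n) ℚ.≤ h
    inv-Q^≤h (suc n) _ = inv-q^≤h n

theorem6p2 : ((𝔽 : FiniteField) (n : ℕ) → 2 ≤ n →
    δrk 𝔽 n n 2 n ≡ formula 𝔽 n)
    × ((n : ℕ) → 2 ≤ n → (ε : ℚ) → Positive ε →
    ∃ λ (Q : ℕ) → (𝔽 : FiniteField) → Q ≤ card 𝔽 →
    ∣ δrk 𝔽 n n 2 n - derangementSum n ∣ < ε)
    × ((𝔽 : FiniteField) → (ε : ℚ) → Positive ε →
    ∃ λ (N : ℕ) → (n M : ℕ) → N ≤ n → N ≤ M →
    ∣ δrk 𝔽 n n 2 n - partialProd (card 𝔽) M ∣ < ε)
theorem6p2 = Counting.δ≡formula , limit-q , Counting.limit-n
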